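{- For all integers $n \geq 1$, \[ \overline{M}_{1}^{+}(n) > \overline{N}_{1}^{+}(n), \] where $\overline{N}_{1}^{+}(n) := \sum_{m=1}^{\infty} m\, \overline{N}(m,n)$ and $\overline{M}_{1}^{+}(n) := \sum_{m=1}^{\infty} m\, \overline{M}(m,n)$.
   Context: An overpartition of $n$ is a partition of $n$ (a non-increasing sequence of positive integers summing to $n$) in which the first occurrence of each distinct part size may be overlined. The rank of an overpartition is its largest part minus its number of parts; $\overline{N}(m,n)$ denotes the number of overpartitions of $n$ with rank $m$. For ordinary partitions, the crank numbers $M(m,n)$ are defined by the generating function $\sum_{n\ge 0}\sum_{m\in\mathbb{Z}} M(m,n) z^m q^n = \frac{(q;q)_\infty}{(zq;q)_\infty (q/z;q)_\infty}$ (for $n>1$, $M(m,n)$ is the number of partitions of $n$ whose crank is $m$, the crank being the largest part if 1 is not a part, and otherwise the number of parts larger than the number of 1's minus the number of 1's). The first residual crank of an overpartition is the crank of the subpartition formed by its non-overlined parts; accordingly the numbers $\overline{M}(m,n)$ are defined by \[ \sum_{n\ge 0}\sum_{m\in\mathbb{Z}} \overline{M}(m,n) z^m q^n = (-q;q)_\infty \frac{(q;q)_\infty}{(zq;q)_\infty (q/z;q)_\infty}. \] Here $(a;q)_n=\prod_{k=1}^{n}(1-aq^{k-1})$ for $n\in\mathbb{N}\cup\{\infty\}$, $(a;q)_0=1$. -}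

module Defs where

open import Data.Nat as ℕ using (ℕ; zero; suc; _∸_; _≤?_)
import Data.Nat.Properties as ℕP
open import Data.Integer as ℤ using (ℤ; +_; -[1+_]; _≟_)
open import Data.Bool using (Bool; true; false; _∧_)
open import Data.Product using (_×_; _,_; proj₁)
open import Data.List using (List; []; _∷_; _++_; map; concatMap; filter; length; replicate; upTo; foldr; applyUpTo)
open import Relation.Nullary using (Dec; yes; no)
open import Relation.Nullary.Decidable using (⌊_⌋)

-- partitionsLE k n : all partitions of n whose parts are all ≤ k,
-- each listed exactly once as a non-increasing list.
partitionsLE : ℕ → ℕ → List (List ℕ)
partitionsLE zero zero    = [] ∷ []
partitionsLE zero (suc _) = []
partitionsLE (suc k) n =
  concatMap
    (λ j → map (λ rest → replicate j (suc k) ++ rest)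
               (partitionsLE k (n ∸ j ℕ.* suc k)))
    (filter (λ j → j ℕ.* suc k ≤? n) (upTo (suc n)))

partitions : ℕ → List (List ℕ)
partitions n = partitionsLE n n

distinctParts : List ℕ → Bool
distinctParts []           = true
distinctParts (_ ∷ [])     = true
distinctParts (a ∷ b ∷ xs) = ⌊ suc b ≤? a ⌋ ∧ distinctParts (b ∷ xs)

-- number of partitions of k into distinct parts
-- (coefficient of q^k in (-q;q)_∞)
D : ℕ → ℕ
D k = length (filter (λ p → Data.Bool._≟_ (distinctParts p) true) (partitions k))

-- Overpartitions: non-increasing lists of (part , overlined?) where only
-- the first occurrence of each part size may be overlined.

overpartitionsLE : ℕ → ℕ → List (List (ℕ × Bool))
overpartitionsLE zero zero    = [] ∷ []
overpartitionsLE zero (suc _) = []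
overpartitionsLE (suc k) n =
  concatMap
    (λ j → concatMap
             (λ rest → blocks j rest)
             (overpartitionsLE k (n ∸ j ℕ.* suc k)))
    (filter (λ j → j ℕ.* suc k ≤? n) (upTo (suc n)))
  where
  blocks : ℕ → List (ℕ × Bool) → List (List (ℕ × Bool))
  blocks zero    rest = rest ∷ []
  blocks (suc j) rest =
    (((suc k , false) ∷ replicate j (suc k , false)) ++ rest) ∷
    (((suc k , true)  ∷ replicate j (suc k , false)) ++ rest) ∷ []

overpartitions : ℕ → List (List (ℕ × Bool))
overpartitions n = overpartitionsLE n n

largestO : List (ℕ × Bool) → ℕ
largestO []             = 0
largestO ((a , _) ∷ _)  = a

rank : List (ℕ × Bool) → ℤ
rank p = + largestO p ℤ.- + length p

Nbar : ℤ → ℕ → ℕ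
Nbar m n = length (filter (λ p → rank p ≟ m) (overpartitions n))

largest : List ℕ → ℕ
largest []      = 0
largest (a ∷ _) = a

ones : List ℕ → ℕ
ones p = length (filter (λ a → a ℕ.≟ 1) p)

crank : List ℕ → ℤ
crank p with ones p
... | zero  = + largest p
... | suc w = + length (filter (λ a → suc (suc w) ≤? a) p) ℤ.- + suc w

-- M(m,n) as the coefficient of z^m q^n in (q;q)_∞/((zq;q)_∞(q/z;q)_∞).
-- For n ≠ 1 this is the number of partitions of n with crank m
-- (the empty partition has crank 0); for n = 1 the coefficient is
-- z + z⁻¹ − 1.
M : ℤ → ℕ → ℤ
M m 1 with m
... | + 1        = + 1
... | -[1+ 0 ]   = + 1
... | + 0        = -[1+ 0 ]
... | _          = + 0
M m n = + length (filter (λ p → crank p ≟ m) (partitions n))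

-- M̄(m,n): coefficient of z^m q^n in (-q;q)_∞ · (q;q)_∞/((zq;q)_∞(q/z;q)_∞),
-- i.e. the Cauchy product of the coefficients of (-q;q)_∞ with M(m,·).
Mbar : ℤ → ℕ → ℤ
Mbar m n = foldr ℤ._+_ (+ 0)
             (map (λ k → + D k ℤ.* M m (n ∸ k)) (upTo (suc n)))

-- First positive moments.  Since ranks of overpartitions of n are ≤ n − 1
-- and the coefficients M(m,n) vanish for m > n, the infinite sums over
-- m ≥ 1 reduce to m = 1 … n.

N1plus : ℕ → ℤ
N1plus n = foldr ℤ._+_ (+ 0)
             (map (λ i → + suc i ℤ.* + Nbar (+ suc i) n) (upTo n))

M1plus : ℕ → ℤ
M1plus n = foldr ℤ._+_ (+ 0)
             (map (λ i → + suc i ℤ.* Mbar (+ suc i) n) (upTo n))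

{-# OPTIONS --safe #-}

-- Let P̄ = (−q;q)_∞ / (q;q)_∞.  The generating functions Z_m of the overpartitions with first residual crank ≥ m
-- and K_m of those with rank ≥ m, plus those with rank ≥ m + 1, satisfy
--   Z_m = q^m (P̄ − Z_{m+1})   and   K_m = q^(m+1) (2 P̄ − K_{m+2}),
-- the first by Durfee rectangles, the second by a version of Dyson's adjoint.  Unrolling and summing over m,
--   Σ (M̄₁⁺(n) − N̄₁⁺(n)) q^n = P̄ (A(q) − 2 A(q²)),   A(q) = Σ_{n≥1} (−1)^(n+1) q^(n(n+1)/2) / (1 − q^n).
-- As P̄ is κ = (1 − q + q²) / (1 − q)³ times a series with nonnegative coefficients and constant term 1, it suffices
-- that κ (A(q) − 2 A(q²)) has positive coefficients.  Its N-th coefficient is an alternating sum over n of numbers that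
-- are a polynomial in n up to a small error for n(n+1) ≤ N, and such a polynomial plus a multiple of 1/n for
-- n(n+1) ≤ 2N; Boole summation gives N²/16 + O(N^(3/2)), explicitly positive from N = 2211 on.  The smaller
-- coefficients are computed.

module Submission where

open import Defs
open import Data.Nat using (ℕ; _≤_)
open import Data.Integer using (_<_)

open import Data.Nat as ℕ using (zero; suc; _∸_; z≤n; s≤s)
import Data.Nat.Properties as ℕP
import Data.Nat.DivMod as ℕD
import Data.Nat.Tactic.RingSolver as ℕR
open import Data.Nat.Induction using (<-rec)
open import Data.Nat.ListAction using (sum)
open import Data.Integer as ℤ using (ℤ; +_; -[1+_]; _+_; _*_; _-_; -_; ∣_∣)
import Data.Integer.Properties as ℤP
open import Data.Integer.Tactic.RingSolver using (solve-∀)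
open import Data.Bool as 𝔹 using (Bool; true; false; _∧_; if_then_else_)
open import Data.Empty using (⊥-elim)
open import Data.List using (List; []; _∷_; _++_; map; concatMap; filter; length; replicate; upTo; foldr; applyUpTo)
open import Data.List.Properties using (filter-accept; filter-reject)
open import Data.List.Relation.Unary.All as All using (All; []; _∷_)
open import Data.Product using (_×_; _,_; proj₁; proj₂; ∃-syntax)
open import Data.Sum using (inj₁; inj₂)
open import Data.Unit using (tt)
open import Function using (_∘_; id)
open import Relation.Binary.Definitions using (tri<; tri≈; tri>)
open import Relation.Binary.PropositionalEquality using (_≡_; refl; sym; trans; cong; cong₂; subst; subst₂)
open import Relation.Nullary using (Dec; yes; no; ¬_)
open import Relation.Nullary.Decidable using (⌊_⌋)
open import Relation.Unary using (Decidable)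

-- Finite sums and power series

-- The coefficient of `q²` in `A(q) − 2 A(q²)` is -1, so positivity has to come from `P̄`. A few
-- factors of `P̄` suffice, and with few factors every row stays polynomial: its `n`-fold is a cubic
-- in `2N + 1 − n²`, up to an error `O(n³)`. The combined rows `u N k` reach the size `N^(5/2)`,
-- their alternating sum only `N²`, so everything depends on cancellation. Second differences of the
-- rows are of order `N^(3/2)`, and about `√N` of them would compete with the main term; third
-- differences are of order `N`. Hence the summation goes to third order. The approximating
-- expression changes where the lower row stops, at `n(n+1) > N`, and again where the upper row
-- stops. No jump arises: the cubic of a row that has just stopped has an argument `O(n)`, so its
-- value divided by `n` is `O(n²)`. Each expression therefore stays accurate for the few `n` past
-- its range that a window of four consecutive `n` touches. All series identities are proved
-- coefficientwise, with infinite sums cut off at a bound on the degree beyond which every term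
-- vanishes.

Series : Set
Series = ℕ → ℤ

interchange : ∀ a b c d → (a + b) + (c + d) ≡ (a + c) + (b + d)
interchange = solve-∀

Σ< : ℕ → (ℕ → ℤ) → ℤ
Σ< zero    f = + 0
Σ< (suc n) f = f 0 + Σ< n (f ∘ suc)

Σ<-cong : ∀ n {f g : ℕ → ℤ} → (∀ i → i ℕ.< n → f i ≡ g i) → Σ< n f ≡ Σ< n g
Σ<-cong zero    h = refl
Σ<-cong (suc n) h = cong₂ _+_ (h 0 (s≤s z≤n)) (Σ<-cong n (λ i i<n → h (suc i) (s≤s i<n)))

Σ<-cong′ : ∀ n {f g : ℕ → ℤ} → (∀ i → f i ≡ g i) → Σ< n f ≡ Σ< n g
Σ<-cong′ n h = Σ<-cong n (λ i _ → h i)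

Σ<-0 : ∀ n {f : ℕ → ℤ} → (∀ i → i ℕ.< n → f i ≡ + 0) → Σ< n f ≡ + 0
Σ<-0 zero    h = refl
Σ<-0 (suc n) h = cong₂ _+_ (h 0 (s≤s z≤n)) (Σ<-0 n (λ i i<n → h (suc i) (s≤s i<n)))

Σ<-+ : ∀ n (f g : ℕ → ℤ) → Σ< n (λ i → f i + g i) ≡ Σ< n f + Σ< n g
Σ<-+ zero    f g = refl
Σ<-+ (suc n) f g = trans (cong (_+_ (f 0 + g 0)) (Σ<-+ n (f ∘ suc) (g ∘ suc)))
                         (interchange (f 0) (g 0) _ _)

Σ<-* : ∀ n c (f : ℕ → ℤ) → Σ< n (λ i → c * f i) ≡ c * Σ< n f
Σ<-* zero    c f = sym (ℤP.*-zeroʳ c)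
Σ<-* (suc n) c f = trans (cong (_+_ (c * f 0)) (Σ<-* n c (f ∘ suc))) (sym (ℤP.*-distribˡ-+ c _ _))

neg-as-* : ∀ a → - a ≡ (- + 1) * a
neg-as-* = solve-∀

Σ<-neg : ∀ n (f : ℕ → ℤ) → Σ< n (λ i → - f i) ≡ - Σ< n f
Σ<-neg n f = trans (Σ<-cong′ n (λ i → neg-as-* (f i))) (trans (Σ<-* n (- + 1) f) (sym (neg-as-* _)))

Σ<-- : ∀ n (f g : ℕ → ℤ) → Σ< n (λ i → f i - g i) ≡ Σ< n f - Σ< n g
Σ<-- n f g = trans (Σ<-+ n f (λ i → - g i)) (cong (_+_ (Σ< n f)) (Σ<-neg n g))

Σ<-split : ∀ a b (f : ℕ → ℤ) → Σ< (a ℕ.+ b) f ≡ Σ< a f + Σ< b (λ i → f (a ℕ.+ i))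
Σ<-split zero    b f = sym (ℤP.+-identityˡ _)
Σ<-split (suc a) b f = trans (cong (_+_ (f 0)) (Σ<-split a b (f ∘ suc))) (sym (ℤP.+-assoc (f 0) _ _))

Σ<-snoc : ∀ n (f : ℕ → ℤ) → Σ< (suc n) f ≡ Σ< n f + f n
Σ<-snoc n f = trans (cong (λ k → Σ< k f) (ℕP.+-comm 1 n))
  (trans (Σ<-split n 1 f) (cong (_+_ (Σ< n f)) (trans (ℤP.+-identityʳ _) (cong f (ℕP.+-identityʳ n)))))

Σ<-extend : ∀ a b (f : ℕ → ℤ) → a ℕ.≤ b → (∀ i → a ℕ.≤ i → f i ≡ + 0) → Σ< b f ≡ Σ< a f
Σ<-extend a b f a≤b h =
  trans (cong (λ k → Σ< k f) (sym (ℕP.m+[n∸m]≡n a≤b)))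
  (trans (Σ<-split a (b ∸ a) f)
  (trans (cong (_+_ (Σ< a f)) (Σ<-0 (b ∸ a) (λ i _ → h (a ℕ.+ i) (ℕP.m≤m+n a i)))) (ℤP.+-identityʳ _)))

Σ<-swap : ∀ a b (f : ℕ → ℕ → ℤ) → Σ< a (λ i → Σ< b (f i)) ≡ Σ< b (λ j → Σ< a (λ i → f i j))
Σ<-swap zero    b f = sym (Σ<-0 b (λ _ _ → refl))
Σ<-swap (suc a) b f = trans (cong (_+_ (Σ< b (f 0))) (Σ<-swap a b (f ∘ suc)))
                            (sym (Σ<-+ b (f 0) (λ j → Σ< a (λ i → f (suc i) j))))

foldr-upTo : ∀ n (f : ℕ → ℕ) (φ : ℕ → ℤ) → foldr _+_ (+ 0) (map φ (applyUpTo f n)) ≡ Σ< n (φ ∘ f)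
foldr-upTo zero    f φ = refl
foldr-upTo (suc n) f φ = cong (_+_ (φ (f 0))) (foldr-upTo n (f ∘ suc) φ)

-- Multiplication by `q^k`. The double recursion, in place of a test `k ≤ n`, lets products with
-- `q^k` unfold by computation.
sh : ℕ → Series → Series
sh zero    f n       = f n
sh (suc k) f zero    = + 0
sh (suc k) f (suc n) = sh k f n

sh-at : ∀ k f n → sh k f (k ℕ.+ n) ≡ f n
sh-at zero    f n = refl
sh-at (suc k) f n = sh-at k f n

sh-< : ∀ k f n → n ℕ.< k → sh k f n ≡ + 0
sh-< (suc k) f zero    _         = refl
sh-< (suc k) f (suc n) (s≤s n<k) = sh-< k f n n<k

sh-cong-at : ∀ k {f g : Series} n → (∀ i → k ℕ.+ i ≡ n → f i ≡ g i) → sh k f n ≡ sh k g n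
sh-cong-at zero    n       h = h n refl
sh-cong-at (suc k) zero    h = refl
sh-cong-at (suc k) (suc n) h = sh-cong-at k n (λ i e → h i (cong suc e))

sh-cong : ∀ k {f g : Series} → (∀ i → f i ≡ g i) → ∀ n → sh k f n ≡ sh k g n
sh-cong k h n = sh-cong-at k n (λ i _ → h i)

sh-cong≤ : ∀ k {f g : Series} n → (∀ i → i ℕ.≤ n → f i ≡ g i) → sh k f n ≡ sh k g n
sh-cong≤ k n h = sh-cong-at k n (λ i e → h i (ℕP.≤-trans (ℕP.m≤n+m i k) (ℕP.≤-reflexive e)))

sh-cong< : ∀ k {f g : Series} n → (∀ i → i ℕ.< n → f i ≡ g i) → sh (suc k) f n ≡ sh (suc k) g n
sh-cong< k n h = sh-cong-at (suc k) n (λ i e → h i (ℕP.≤-trans (s≤s (ℕP.m≤n+m i k)) (ℕP.≤-reflexive e)))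

sh-0 : ∀ k {f : Series} n → (∀ i → k ℕ.+ i ≡ n → f i ≡ + 0) → sh k f n ≡ + 0
sh-0 zero    n       h = h n refl
sh-0 (suc k) zero    h = refl
sh-0 (suc k) (suc n) h = sh-0 k n (λ i e → h i (cong suc e))

sh-+ : ∀ k (f g : Series) n → sh k (λ i → f i + g i) n ≡ sh k f n + sh k g n
sh-+ zero    f g n       = refl
sh-+ (suc k) f g zero    = refl
sh-+ (suc k) f g (suc n) = sh-+ k f g n

sh-* : ∀ k c (f : Series) n → sh k (λ i → c * f i) n ≡ c * sh k f n
sh-* zero    c f n       = refl
sh-* (suc k) c f zero    = sym (ℤP.*-zeroʳ c)
sh-* (suc k) c f (suc n) = sh-* k c f n

sh-neg : ∀ k (f : Series) n → sh k (λ i → - f i) n ≡ - sh k f n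
sh-neg zero    f n       = refl
sh-neg (suc k) f zero    = refl
sh-neg (suc k) f (suc n) = sh-neg k f n

sh-- : ∀ k (f g : Series) n → sh k (λ i → f i - g i) n ≡ sh k f n - sh k g n
sh-- k f g n = trans (sh-+ k f (λ i → - g i) n) (cong (_+_ (sh k f n)) (sh-neg k g n))

sh-Σ : ∀ k b (F : ℕ → Series) n → sh k (λ i → Σ< b (λ j → F j i)) n ≡ Σ< b (λ j → sh k (F j) n)
sh-Σ k zero    F n = sh-0 k n (λ _ _ → refl)
sh-Σ k (suc b) F n = trans (sh-+ k (F 0) (λ i → Σ< b (λ j → F (suc j) i)) n)
                           (cong (_+_ (sh k (F 0) n)) (sh-Σ k b (F ∘ suc) n))

sh-sh : ∀ k l (f : Series) n → sh k (sh l f) n ≡ sh (k ℕ.+ l) f n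
sh-sh zero    l f n       = refl
sh-sh (suc k) l f zero    = refl
sh-sh (suc k) l f (suc n) = sh-sh k l f n

sh-comm : ∀ k l (f : Series) n → sh k (sh l f) n ≡ sh l (sh k f) n
sh-comm k l f n = trans (sh-sh k l f n)
  (trans (cong (λ m → sh m f n) (ℕP.+-comm k l)) (sym (sh-sh l k f n)))

-- f = a / (1 − q^(k+1)) is characterised by f = a + q^(k+1) f.
geometric-unique : ∀ k (a : Series) {f g : Series} →
  (∀ n → f n ≡ a n + sh (suc k) f n) → (∀ n → g n ≡ a n + sh (suc k) g n) → ∀ n → f n ≡ g n
geometric-unique k a {f} {g} hf hg = <-rec (λ n → f n ≡ g n) (λ n ih →
  trans (hf n) (trans (cong (_+_ (a n)) (sh-cong< k n (λ i i<n → ih i<n))) (sym (hg n))))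

-- The sum of `q^(jk) F j` over all `j`, for `k ≥ 1`. `F` may depend on `j` because a statistic on
-- partitions sees how many copies of a part were put in front.
geometric : ℕ → (ℕ → Series) → Series
geometric k F n = Σ< (suc n) (λ j → sh (j ℕ.* k) (F j) n)

geometric-rec : ∀ k F n → geometric (suc k) F n ≡ F 0 n + sh (suc k) (geometric (suc k) (F ∘ suc)) n
geometric-rec k F n = cong (_+_ (F 0 n)) (trans (Σ<-cong′ n (λ j → sym (sh-sh (suc k) (j ℕ.* suc k) (F (suc j)) n))) (tail n))
  where
  tail : ∀ n → Σ< n (λ j → sh (suc k) (sh (j ℕ.* suc k) (F (suc j))) n) ≡ sh (suc k) (geometric (suc k) (F ∘ suc)) n
  tail n with n ℕ.<? suc k
  ... | yes n<k = trans (Σ<-0 n (λ j _ → sh-< (suc k) _ n n<k)) (sym (sh-< (suc k) _ n n<k))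
  ... | no  n≮k = subst (λ m → Σ< m (λ j → sh (suc k) (sh (j ℕ.* suc k) (F (suc j))) m) ≡ sh (suc k) (geometric (suc k) (F ∘ suc)) m)
                    (ℕP.m+[n∸m]≡n (ℕP.≮⇒≥ n≮k)) (at (n ∸ suc k))
    where
    at : ∀ m → Σ< (suc k ℕ.+ m) (λ j → sh (suc k) (sh (j ℕ.* suc k) (F (suc j))) (suc k ℕ.+ m))
             ≡ sh (suc k) (geometric (suc k) (F ∘ suc)) (suc k ℕ.+ m)
    at m = trans (Σ<-cong′ (suc k ℕ.+ m) (λ j → sh-at (suc k) (sh (j ℕ.* suc k) (F (suc j))) m))
      (trans (Σ<-extend (suc m) (suc k ℕ.+ m) _ (s≤s (ℕP.m≤n+m m k))
               (λ j m<j → sh-< (j ℕ.* suc k) (F (suc j)) m (ℕP.≤-trans m<j (ℕP.m≤m*n j (suc k)))))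
             (sym (sh-at (suc k) (geometric (suc k) (F ∘ suc)) m)))

-- Division by `1 − q^k`, for `k ≥ 1`.
inv : ℕ → Series → Series
inv k f = geometric k (λ _ → f)

inv-rec : ∀ k f n → inv (suc k) f n ≡ f n + sh (suc k) (inv (suc k) f) n
inv-rec k f n = geometric-rec k (λ _ → f) n

inv-unique : ∀ k f {g : Series} → (∀ n → g n ≡ f n + sh (suc k) g n) → ∀ n → g n ≡ inv (suc k) f n
inv-unique k f h = geometric-unique k f h (inv-rec k f)

inv-cong : ∀ k {f g : Series} → (∀ n → f n ≡ g n) → ∀ n → inv k f n ≡ inv k g n
inv-cong k h n = Σ<-cong′ (suc n) (λ j → sh-cong (j ℕ.* k) h n)

inv-sh : ∀ k l f n → inv (suc k) (sh l f) n ≡ sh l (inv (suc k) f) n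
inv-sh k l f n = sym (inv-unique k (sh l f) (λ n → trans (sh-cong l (inv-rec k f) n)
  (trans (sh-+ l f (sh (suc k) (inv (suc k) f)) n) (cong (_+_ (sh l f n)) (sh-comm l (suc k) _ n)))) n)

inv-+ : ∀ k f g n → inv k (λ i → f i + g i) n ≡ inv k f n + inv k g n
inv-+ k f g n = trans (Σ<-cong′ (suc n) (λ j → sh-+ (j ℕ.* k) f g n))
                      (Σ<-+ (suc n) (λ j → sh (j ℕ.* k) f n) (λ j → sh (j ℕ.* k) g n))

-- Rows of the kernel

tri : ℕ → ℕ
tri zero    = 0
tri (suc n) = suc n ℕ.+ tri n

sgn : ℕ → ℤ
sgn zero    = + 1
sgn (suc n) = - sgn n

-- κ(n) = (n² + n + 2) / 2, the coefficients of (1 − q + q²) / (1 − q)³: smooth enough for its row sums to be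
-- estimated, and ∏_{k≤4} (1 + q^k) / (1 − q^k) = κ (1 + q⁴) / (1 − q³).
κ : Series
κ n = + suc (tri n)

private
  2tri-step : ∀ t n → + 2 * ((+ 1 + n) + t) ≡ + 2 * (+ 1 + n) + + 2 * t
  2tri-step = solve-∀
  2tri-alg : ∀ n → + 2 * (+ 1 + n) + (n * n + n) ≡ (+ 1 + n) * (+ 1 + n) + (+ 1 + n)
  2tri-alg = solve-∀
  2κ-alg : ∀ t → + 2 * (+ 1 + t) ≡ + 2 * t + + 2
  2κ-alg = solve-∀

2tri : ∀ n → + 2 * + tri n ≡ + n * + n + + n
2tri zero    = refl
2tri (suc n) = trans (2tri-step (+ tri n) (+ n))
  (trans (cong (_+_ (+ 2 * (+ 1 + + n))) (2tri n)) (2tri-alg (+ n)))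

2κ : ∀ n → + 2 * κ n ≡ + n * + n + + n + + 2
2κ n = trans (2κ-alg (+ tri n)) (cong (λ x → x + + 2) (2tri n))

-- 12 Σ_{j≤J} κ(r + jn)
rowPoly : ℤ → ℤ → ℤ → ℤ
rowPoly n r J = + 6 * (J + + 1) * (r * r + r + + 2) + + 3 * n * (+ 2 * r + + 1) * (J * (J + + 1))
              + n * n * (J * (J + + 1) * (+ 2 * J + + 1))

private
  row-base : ∀ n r → + 6 * (r * r + r + + 2) ≡ (+ 6 * ((+ 0) + + 1) * (r * r + r + + 2) + + 3 * n * (+ 2 * r + + 1) * ((+ 0) * ((+ 0) + + 1)) + n * n * ((+ 0) * ((+ 0) + + 1) * (+ 2 * (+ 0) + + 1)))
  row-base = solve-∀
  row-step : ∀ n r J → + 6 * ((n + (J * n + r)) * (n + (J * n + r)) + (n + (J * n + r)) + + 2) + (+ 6 * (J + + 1) * (r * r + r + + 2) + + 3 * n * (+ 2 * r + + 1) * (J * (J + + 1)) + n * n * (J * (J + + 1) * (+ 2 * J + + 1)))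
    ≡ (+ 6 * ((+ 1 + J) + + 1) * (r * r + r + + 2) + + 3 * n * (+ 2 * r + + 1) * ((+ 1 + J) * ((+ 1 + J) + + 1)) + n * n * ((+ 1 + J) * ((+ 1 + J) + + 1) * (+ 2 * (+ 1 + J) + + 1)))
  row-step = solve-∀
  12-as : ∀ a b → + 12 * (a + b) ≡ + 6 * (+ 2 * a) + + 12 * b
  12-as = solve-∀

-- Dividing by `1 − q^n` sums `κ` along a residue class mod `n`. The factor 12 clears the 2 in `κ`
-- and the 6 in the sum of squares.
inv-κ : ∀ k J r → r ℕ.< suc k → + 12 * inv (suc k) κ (J ℕ.* suc k ℕ.+ r) ≡ rowPoly (+ suc k) (+ r) (+ J)
inv-κ k zero r r<k =
  trans (cong (_*_ (+ 12)) (trans (inv-rec k κ r) (cong (_+_ (κ r)) (sh-< (suc k) _ r r<k))))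
  (trans (12-as (κ r) (+ 0)) (trans (ℤP.+-identityʳ _)
  (trans (cong (_*_ (+ 6)) (2κ r)) (row-base (+ suc k) (+ r)))))
inv-κ k (suc J) r r<k =
  trans (cong (λ m → + 12 * inv (suc k) κ m) (ℕP.+-assoc (suc k) (J ℕ.* suc k) r))
  (trans (cong (_*_ (+ 12)) (trans (inv-rec k κ (suc k ℕ.+ X)) (cong (_+_ (κ (suc k ℕ.+ X))) (sh-at (suc k) (inv (suc k) κ) X))))
  (trans (12-as (κ (suc k ℕ.+ X)) (inv (suc k) κ X))
  (trans (cong₂ _+_ (trans (cong (_*_ (+ 6)) (2κ (suc k ℕ.+ X))) (cong (λ x → + 6 * (x * x + x + + 2)) castX)) (inv-κ k J r r<k))
  (row-step (+ suc k) (+ r) (+ J)))))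
  where
  X = J ℕ.* suc k ℕ.+ r
  castX : + (suc k ℕ.+ X) ≡ + suc k + (+ J * + suc k + + r)
  castX = cong (λ x → + suc k + (x + + r)) (ℤP.pos-* J (suc k))

-- Evaluates a row by its closed form instead of summing `κ`, which makes the check of two thousand
-- coefficients feasible. The test guards the truncated subtraction.
12row : ℕ → ℕ → ℕ → ℤ
12row k e N = if e ℕ.≤ᵇ N
  then rowPoly (+ suc k) (+ ((N ∸ e) ℕ.% suc k)) (+ ((N ∸ e) ℕ./ suc k))
  else + 0

12W : ℕ → ℕ → ℤ
12W B N = Σ< B (λ n → sgn n * (12row n (tri (suc n)) N - + 2 * 12row (suc (2 ℕ.* n)) (2 ℕ.* tri (suc n)) N))

positiveᵇ : ℤ → Bool
positiveᵇ (+ suc _) = true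
positiveᵇ _         = false

allPositive : ℕ → ℕ → Bool
allPositive B zero    = true
allPositive B (suc n) = positiveᵇ (12W B (suc n)) ∧ allPositive B n

-- Rows as cubics with explicit errors

≤-by : ∀ {a b} d → a ℕ.+ d ≡ b → a ℕ.≤ b
≤-by {a} d e = subst (a ℕ.≤_) e (ℕP.m≤m+n a d)

∣-∣≤ : ∀ a b c → a ℕ.≤ b ℕ.+ c → b ℕ.≤ a ℕ.+ c → ∣ + a - + b ∣ ℕ.≤ c
∣-∣≤ a b c p q rewrite ℤP.m-n≡m⊖n a b with ℕP.≤-total a b
... | inj₁ a≤b = subst (ℕ._≤ c) (sym (ℤP.∣⊖∣-≤ a≤b)) (ℕP.m≤n+o⇒m∸n≤o b a q)
... | inj₂ b≤a = subst (ℕ._≤ c) (sym (trans (ℤP.∣m⊖n∣≡∣n⊖m∣ a b) (ℤP.∣⊖∣-≤ b≤a))) (ℕP.m≤n+o⇒m∸n≤o a b p)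

∣+∣≤ : ∀ i j {a b} → ∣ i ∣ ℕ.≤ a → ∣ j ∣ ℕ.≤ b → ∣ i + j ∣ ℕ.≤ a ℕ.+ b
∣+∣≤ i j p q = ℕP.≤-trans (ℤP.∣i+j∣≤∣i∣+∣j∣ i j) (ℕP.+-mono-≤ p q)

∣--∣≤ : ∀ i j {a b} → ∣ i ∣ ℕ.≤ a → ∣ j ∣ ℕ.≤ b → ∣ i - j ∣ ℕ.≤ a ℕ.+ b
∣--∣≤ i j p q = ℕP.≤-trans (ℤP.∣i-j∣≤∣i∣+∣j∣ i j) (ℕP.+-mono-≤ p q)

∣*∣≤ : ∀ i j {a b} → ∣ i ∣ ℕ.≤ a → ∣ j ∣ ℕ.≤ b → ∣ i * j ∣ ℕ.≤ a ℕ.* b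
∣*∣≤ i j p q = subst (ℕ._≤ _) (sym (ℤP.abs-* i j)) (ℕP.*-mono-≤ p q)

-- A summation polynomial for `κ` in steps of `n`: with `y = 2x + 1` one has `8 κ(x) = y² + 7`, and
-- `cube n (y + n) − cube n (y − n) = 48 n κ(x)`. The 21 is three times that 7.
cube : ℤ → ℤ → ℤ
cube n Z = Z * Z * Z - (n * n - + 21) * Z

private
  odd-product≤ : ∀ r q → (2 ℕ.* r ℕ.+ 1) ℕ.* (2 ℕ.* q ℕ.+ 1) ℕ.≤ (r ℕ.+ q ℕ.+ 1) ℕ.* (r ℕ.+ q ℕ.+ 1)
  odd-product≤ r q with ℕP.≤-total r q
  ... | inj₁ r≤q = subst (λ q → (2 ℕ.* r ℕ.+ 1) ℕ.* (2 ℕ.* q ℕ.+ 1) ℕ.≤ (r ℕ.+ q ℕ.+ 1) ℕ.* (r ℕ.+ q ℕ.+ 1))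
                     (ℕP.m+[n∸m]≡n r≤q) (≤-by ((q ∸ r) ℕ.* (q ∸ r)) (alg r (q ∸ r)))
    where
    alg : ∀ r d → (2 ℕ.* r ℕ.+ 1) ℕ.* (2 ℕ.* (r ℕ.+ d) ℕ.+ 1) ℕ.+ d ℕ.* d ≡ (r ℕ.+ (r ℕ.+ d) ℕ.+ 1) ℕ.* (r ℕ.+ (r ℕ.+ d) ℕ.+ 1)
    alg = ℕR.solve-∀
  ... | inj₂ q≤r = subst (λ r → (2 ℕ.* r ℕ.+ 1) ℕ.* (2 ℕ.* q ℕ.+ 1) ℕ.≤ (r ℕ.+ q ℕ.+ 1) ℕ.* (r ℕ.+ q ℕ.+ 1))
                     (ℕP.m+[n∸m]≡n q≤r) (≤-by ((r ∸ q) ℕ.* (r ∸ q)) (alg q (r ∸ q)))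
    where
    alg : ∀ q d → (2 ℕ.* (q ℕ.+ d) ℕ.+ 1) ℕ.* (2 ℕ.* q ℕ.+ 1) ℕ.+ d ℕ.* d ≡ (q ℕ.+ d ℕ.+ q ℕ.+ 1) ℕ.* (q ℕ.+ d ℕ.+ q ℕ.+ 1)
    alg = ℕR.solve-∀

  row-alg : ∀ r q J → let n = + 1 + (r + q); X = J * n + r; Z = + 2 * X + n + + 1 in
    + 4 * n * (+ 6 * (J + + 1) * (r * r + r + + 2) + + 3 * n * (+ 2 * r + + 1) * (J * (J + + 1)) + n * n * (J * (J + + 1) * (+ 2 * J + + 1)))
    ≡ Z * Z * Z - (n * n - + 21) * Z + (r - q) * ((+ 2 * r + + 1) * (+ 2 * q + + 1) - + 21)
  row-alg = solve-∀

-- Telescoping `cube` leaves the value at the lower end, `E = − cube n (r − q)`, where `r` is the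
-- remainder of `X` mod `n` and `q = n − 1 − r`. Since `n² − (r − q)² = (2r + 1)(2q + 1)`, it
-- factors, and the arithmetic-geometric mean inequality bounds the odd product by `n²`.
row-48 : ∀ k X → let n = + suc k in ∃[ E ]
  (+ 48 * n * inv (suc k) κ X ≡ cube n (+ 2 * + X + n + + 1) + E) × (∣ E ∣ ℕ.≤ suc k ℕ.* (suc k ℕ.* suc k ℕ.+ 21))
row-48 k X = E , eq , bound
  where
  c = X ℕ./ suc k
  r = X ℕ.% suc k
  r<n : r ℕ.< suc k
  r<n = ℕD.m%n<n X (suc k)
  q = k ∸ r
  r+q : r ℕ.+ q ≡ k
  r+q = ℕP.m+[n∸m]≡n (ℕP.≤-pred r<n)
  E = (+ r - + q) * ((+ 2 * + r + + 1) * (+ 2 * + q + + 1) - + 21)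
  X-eq : X ≡ c ℕ.* suc k ℕ.+ r
  X-eq = trans (ℕD.m≡m%n+[m/n]*n X (suc k)) (ℕP.+-comm r _)
  n-eq : + 1 + (+ r + + q) ≡ + suc k
  n-eq = cong (λ m → + suc m) r+q
  pull : ∀ n i → + 48 * n * i ≡ + 4 * n * (+ 12 * i)
  pull = solve-∀
  castX : + c * + suc k + + r ≡ + X
  castX = trans (cong (λ x → x + + r) (sym (ℤP.pos-* c (suc k)))) (cong +_ (sym X-eq))
  eq : + 48 * + suc k * inv (suc k) κ X ≡ cube (+ suc k) (+ 2 * + X + + suc k + + 1) + E
  eq = trans (pull (+ suc k) (inv (suc k) κ X))
    (trans (cong (λ i → + 4 * + suc k * i) (trans (cong (λ m → + 12 * inv (suc k) κ m) X-eq) (inv-κ k c r r<n)))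
    (trans (subst (λ n → + 4 * n * rowPoly n (+ r) (+ c) ≡ cube n (+ 2 * (+ c * n + + r) + n + + 1) + E) n-eq (row-alg (+ r) (+ q) (+ c)))
           (cong (λ x → cube (+ suc k) (+ 2 * x + + suc k + + 1) + E) castX)))
  bound : ∣ E ∣ ℕ.≤ suc k ℕ.* (suc k ℕ.* suc k ℕ.+ 21)
  bound = ∣*∣≤ (+ r - + q) ((+ 2 * + r + + 1) * (+ 2 * + q + + 1) - + 21)
    (∣-∣≤ r q (suc k) (ℕP.≤-trans (ℕP.≤-pred r<n) (ℕP.≤-trans (ℕP.n≤1+n k) (ℕP.m≤n+m (suc k) q)))
                      (ℕP.≤-trans (ℕP.m∸n≤m k r) (ℕP.≤-trans (ℕP.n≤1+n k) (ℕP.m≤n+m (suc k) r))))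
    (∣--∣≤ ((+ 2 * + r + + 1) * (+ 2 * + q + + 1)) (+ 21) inner ℕP.≤-refl)
    where
    cast : (+ 2 * + r + + 1) * (+ 2 * + q + + 1) ≡ + ((2 ℕ.* r ℕ.+ 1) ℕ.* (2 ℕ.* q ℕ.+ 1))
    cast = trans (cong₂ (λ x y → (x + + 1) * (y + + 1)) (sym (ℤP.pos-* 2 r)) (sym (ℤP.pos-* 2 q))) (sym (ℤP.pos-* (2 ℕ.* r ℕ.+ 1) (2 ℕ.* q ℕ.+ 1)))
    inner : ∣ (+ 2 * + r + + 1) * (+ 2 * + q + + 1) ∣ ℕ.≤ suc k ℕ.* suc k
    inner = subst₂ (λ x m → ∣ x ∣ ℕ.≤ m ℕ.* m) (sym cast) (trans (ℕP.+-comm (r ℕ.+ q) 1) (cong suc r+q)) (odd-product≤ r q)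

double : ℕ → ℕ
double k = suc (2 ℕ.* k)

+double : ∀ k → + suc (double k) ≡ + 2 * + suc k
+double k = trans (cong +_ (sym (ℕP.*-suc 2 k))) (ℤP.pos-* 2 (suc k))

-- The rows `n = k + 1` of `κ A(q)` and `κ A(q²)` without their signs, at `q^N`.
upper lower : ℕ → ℕ → ℤ
upper N k = sh (tri (suc k)) (inv (suc k) κ) N
lower N k = sh (2 ℕ.* tri (suc k)) (inv (suc (double k)) κ) N

u : ℕ → ℕ → ℤ
u N k = + 48 * (upper N k - + 2 * lower N k)

module _ (N : ℕ) where

  -- In this variable the cubes of the upper and the lower row have the arguments `L − n²` and
  -- `L − 2n²`: the triangular exponents absorb the terms linear in `n`.
  L = suc (2 ℕ.* N)

  private
    +L : ∀ a b → a ℕ.+ b ≡ N → + L ≡ + 2 * (+ a + + b) + + 1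
    +L a b refl = trans (ℤP.+-comm (+ 1) (+ (2 ℕ.* (a ℕ.+ b)))) (cong (λ x → x + + 1) (ℤP.pos-* 2 (a ℕ.+ b)))

    upper-arg : ∀ k x → tri (suc k) ℕ.+ x ≡ N → + 2 * + x + + suc k + + 1 ≡ + L - + suc k * + suc k
    upper-arg k x e = trans (alg₁ (+ x) (+ suc k))
      (trans (cong (λ t → + 2 * + x + t + + 1 - + suc k * + suc k) (sym (2tri (suc k))))
      (trans (alg₂ (+ x) (+ suc k) (+ tri (suc k))) (cong (λ x → x - + suc k * + suc k) (sym (+L (tri (suc k)) x e)))))
      where
      alg₁ : ∀ x n → + 2 * x + n + + 1 ≡ + 2 * x + (n * n + n) + + 1 - n * n
      alg₁ = solve-∀
      alg₂ : ∀ x n t → + 2 * x + + 2 * t + + 1 - n * n ≡ + 2 * (t + x) + + 1 - n * n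
      alg₂ = solve-∀

    lower-arg : ∀ k x → 2 ℕ.* tri (suc k) ℕ.+ x ≡ N →
                + 2 * + x + + 2 * + suc k + + 1 ≡ + L - + 2 * (+ suc k * + suc k)
    lower-arg k x e = trans (alg₁ (+ x) (+ suc k))
      (trans (cong (λ t → + 2 * + x + + 2 * t + + 1 - + 2 * (+ suc k * + suc k)) (sym (2tri (suc k))))
      (trans (alg₂ (+ x) (+ suc k) (+ tri (suc k)))
      (trans (cong (λ t → + 2 * (t + + x) + + 1 - + 2 * (+ suc k * + suc k)) (sym (ℤP.pos-* 2 (tri (suc k)))))
             (cong (λ x → x - + 2 * (+ suc k * + suc k)) (sym (+L (2 ℕ.* tri (suc k)) x e))))))
      where
      alg₁ : ∀ x n → + 2 * x + + 2 * n + + 1 ≡ + 2 * x + + 2 * (n * n + n) + + 1 - + 2 * (n * n)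
      alg₁ = solve-∀
      alg₂ : ∀ x n t → + 2 * x + + 2 * (+ 2 * t) + + 1 - + 2 * (n * n) ≡ + 2 * (+ 2 * t + x) + + 1 - + 2 * (n * n)
      alg₂ = solve-∀

  upper-48 : ∀ k → tri (suc k) ℕ.≤ N → ∃[ E ]
    (+ 48 * + suc k * upper N k ≡ cube (+ suc k) (+ L - + suc k * + suc k) + E) ×
    (∣ E ∣ ℕ.≤ suc k ℕ.* (suc k ℕ.* suc k ℕ.+ 21))
  upper-48 k t≤N = E , trans (cong (λ s → + 48 * + suc k * s) at)
                            (trans eq (cong (λ z → cube (+ suc k) z + E) (upper-arg k x e))) , bd
    where
    x = N ∸ tri (suc k)
    row = row-48 k x
    E = proj₁ row
    eq = proj₁ (proj₂ row)
    bd = proj₂ (proj₂ row)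
    e : tri (suc k) ℕ.+ x ≡ N
    e = ℕP.m+[n∸m]≡n t≤N
    at : upper N k ≡ inv (suc k) κ x
    at = trans (cong (sh (tri (suc k)) (inv (suc k) κ)) (sym e)) (sh-at (tri (suc k)) (inv (suc k) κ) x)

  lower-48 : ∀ k → 2 ℕ.* tri (suc k) ℕ.≤ N → ∃[ E ]
    (+ 96 * + suc k * lower N k ≡ cube (+ 2 * + suc k) (+ L - + 2 * (+ suc k * + suc k)) + E) ×
    (∣ E ∣ ℕ.≤ suc k ℕ.* (8 ℕ.* (suc k ℕ.* suc k) ℕ.+ 42))
  lower-48 k t≤N = E , trans (cong (λ s → + 96 * + suc k * s) at)
      (trans (pull (+ suc k) (inv (suc (double k)) κ x))
      (trans (subst (λ n → + 48 * n * inv (suc (double k)) κ x ≡ cube n (+ 2 * + x + n + + 1) + E) (+double k) eq)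
             (cong (λ z → cube (+ 2 * + suc k) z + E) (lower-arg k x e))))
      , ℕP.≤-trans bd (ℕP.≤-reflexive (trans (cong (λ n → n ℕ.* (n ℕ.* n ℕ.+ 21)) (sym (ℕP.*-suc 2 k))) (alg (suc k))))
    where
    x = N ∸ 2 ℕ.* tri (suc k)
    row = row-48 (double k) x
    E = proj₁ row
    eq = proj₁ (proj₂ row)
    bd = proj₂ (proj₂ row)
    e : 2 ℕ.* tri (suc k) ℕ.+ x ≡ N
    e = ℕP.m+[n∸m]≡n t≤N
    at : lower N k ≡ inv (suc (double k)) κ x
    at = trans (cong (sh (2 ℕ.* tri (suc k)) (inv (suc (double k)) κ)) (sym e)) (sh-at (2 ℕ.* tri (suc k)) (inv (suc (double k)) κ) x)
    pull : ∀ n i → + 96 * n * i ≡ + 48 * (+ 2 * n) * i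
    pull = solve-∀
    alg : ∀ n → 2 ℕ.* n ℕ.* (2 ℕ.* n ℕ.* (2 ℕ.* n) ℕ.+ 21) ≡ n ℕ.* (8 ℕ.* (n ℕ.* n) ℕ.+ 42)
    alg = ℕR.solve-∀

  -- With n = k + 1, u N k is close to p₁ n while both rows are present, and to p₂ n + pole / n while only
  -- the upper one is: cube-diff and cube-split are the exact expressions without the remainders E.
  p₁ p₂ : ℤ → ℤ
  p₁ n = n * (+ 3 * (+ L * + L) + + 3 * + L + + 21) - n * n * n * (+ 9 * + L + + 7) + + 7 * (n * n * n * n * n)
  p₂ n = n * n * n * (+ 3 * + L + + 1) - n * (+ 3 * (+ L * + L) + + L + + 21) - n * n * n * n * n

  pole : ℤ
  pole = + L * + L * + L + + 21 * + L

  private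
    cube-split : ∀ l n → (l - n * n) * (l - n * n) * (l - n * n) - (n * n - + 21) * (l - n * n)
      ≡ l * l * l + + 21 * l + n * (n * n * n * (+ 3 * l + + 1) - n * (+ 3 * (l * l) + l + + 21) - n * n * n * n * n)
    cube-split = solve-∀
    cube-diff : ∀ l n → (l - n * n) * (l - n * n) * (l - n * n) - (n * n - + 21) * (l - n * n)
      ≡ ((l - + 2 * (n * n)) * (l - + 2 * (n * n)) * (l - + 2 * (n * n)) - (+ 2 * n * (+ 2 * n) - + 21) * (l - + 2 * (n * n)))
        + n * (n * (+ 3 * (l * l) + + 3 * l + + 21) - n * n * n * (+ 9 * l + + 7) + + 7 * (n * n * n * n * n))
    cube-diff = solve-∀

    cancel : ∀ k x {b} → ∣ + suc k * x ∣ ℕ.≤ suc k ℕ.* b → ∣ x ∣ ℕ.≤ b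
    cancel k x {b} h = ℕP.*-cancelˡ-≤ (suc k) (subst (ℕ._≤ suc k ℕ.* b) (ℤP.abs-* (+ suc k) x) h)

    cube-bound : ∀ α n k z → n ≡ + α * + suc k → ∀ β → ∣ z ∣ ℕ.≤ β ℕ.* suc k →
      ∣ cube n z ∣ ℕ.≤ suc k ℕ.* (β ℕ.* β ℕ.* β ℕ.* (suc k ℕ.* suc k) ℕ.+ (α ℕ.* α ℕ.* (suc k ℕ.* suc k) ℕ.+ 21) ℕ.* β)
    cube-bound α n k z refl β h = ℕP.≤-trans
      (∣--∣≤ (z * z * z) ((n * n - + 21) * z) (∣*∣≤ (z * z) z (∣*∣≤ z z h h) h)
        (∣*∣≤ (n * n - + 21) z (∣--∣≤ (n * n) (+ 21) (∣*∣≤ n n abs-n abs-n) ℕP.≤-refl) h))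
      (ℕP.≤-reflexive (alg α β (suc k)))
      where
      abs-n : ∣ + α * + suc k ∣ ℕ.≤ α ℕ.* suc k
      abs-n = ℕP.≤-reflexive (ℤP.abs-* (+ α) (+ suc k))
      alg : ∀ α β m → β ℕ.* m ℕ.* (β ℕ.* m) ℕ.* (β ℕ.* m) ℕ.+ (α ℕ.* m ℕ.* (α ℕ.* m) ℕ.+ 21) ℕ.* (β ℕ.* m)
        ≡ m ℕ.* (β ℕ.* β ℕ.* β ℕ.* (m ℕ.* m) ℕ.+ (α ℕ.* α ℕ.* (m ℕ.* m) ℕ.+ 21) ℕ.* β)
      alg = ℕR.solve-∀

    scale : ∀ n a b → n * (+ 48 * (a - + 2 * b)) ≡ + 48 * n * a - + 96 * n * b
    scale = solve-∀
    n²-1 : ∀ k → + suc k ≡ + 1 * + suc k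
    n²-1 k = sym (ℤP.*-identityˡ (+ suc k))

  dev-both : ∀ k → 2 ℕ.* tri (suc k) ℕ.≤ N → ∣ u N k - p₁ (+ suc k) ∣ ℕ.≤ 9 ℕ.* (suc k ℕ.* suc k) ℕ.+ 63
  dev-both k h = cancel k (u N k - p₁ n) (subst (λ z → ∣ z ∣ ℕ.≤ suc k ℕ.* (9 ℕ.* (suc k ℕ.* suc k) ℕ.+ 63)) (sym main)
        (ℕP.≤-trans (∣--∣≤ E E′ bd bd′) (ℕP.≤-reflexive (alg (suc k)))))
    where
    up = upper-48 k (ℕP.≤-trans (ℕP.m≤n*m (tri (suc k)) 2) h)
    lo = lower-48 k h
    E = proj₁ up
    eq = proj₁ (proj₂ up)
    bd = proj₂ (proj₂ up)
    E′ = proj₁ lo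
    eq′ = proj₁ (proj₂ lo)
    bd′ = proj₂ (proj₂ lo)
    n = + suc k
    P = p₁ n
    C = cube (+ 2 * n) (+ L - + 2 * (n * n))
    alg : ∀ m → m ℕ.* (m ℕ.* m ℕ.+ 21) ℕ.+ m ℕ.* (8 ℕ.* (m ℕ.* m) ℕ.+ 42) ≡ m ℕ.* (9 ℕ.* (m ℕ.* m) ℕ.+ 63)
    alg = ℕR.solve-∀
    fin : ∀ C n P E E′ → (C + n * P + E) - (C + E′) - n * P ≡ E - E′
    fin = solve-∀
    dist : ∀ n U P → n * (U - P) ≡ n * U - n * P
    dist = solve-∀
    main : n * (u N k - P) ≡ E - E′
    main = trans (dist n (u N k) P) (trans (cong (λ x → x - n * P) (trans (scale n (upper N k) (lower N k))
      (cong₂ _-_ (trans eq (cong (λ x → x + E) (cube-diff (+ L) n))) eq′))) (fin C n P E E′))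

  lower-0 : ∀ k → N ℕ.< 2 ℕ.* tri (suc k) → lower N k ≡ + 0
  lower-0 k h = sh-< (2 ℕ.* tri (suc k)) (inv (suc (double k)) κ) N h

  private
    u-upper : ∀ k → N ℕ.< 2 ℕ.* tri (suc k) → + suc k * u N k ≡ + 48 * + suc k * upper N k
    u-upper k h = trans (cong (λ b → + suc k * (+ 48 * (upper N k - + 2 * b))) (lower-0 k h)) (alg (+ suc k) (upper N k))
      where
      alg : ∀ n a → n * (+ 48 * (a - + 2 * + 0)) ≡ + 48 * n * a
      alg = solve-∀

  dev-upper : ∀ k → tri (suc k) ℕ.≤ N → N ℕ.< 2 ℕ.* tri (suc k) →
    ∣ + suc k * (u N k - p₂ (+ suc k)) - pole ∣ ℕ.≤ suc k ℕ.* (suc k ℕ.* suc k ℕ.+ 21)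
  dev-upper k h h′ = subst (λ z → ∣ z ∣ ℕ.≤ suc k ℕ.* (suc k ℕ.* suc k ℕ.+ 21)) (sym main) bd
    where
    up = upper-48 k h
    E = proj₁ up
    eq = proj₁ (proj₂ up)
    bd = proj₂ (proj₂ up)
    n = + suc k
    fin : ∀ n U P c E → n * U ≡ c + n * P + E → n * (U - P) - c ≡ E
    fin n U P c E e = trans (alg₁ n U P c) (trans (cong (λ x → x - n * P - c) e) (alg₂ n P c E))
      where
      alg₁ : ∀ n U P c → n * (U - P) - c ≡ n * U - n * P - c
      alg₁ = solve-∀
      alg₂ : ∀ n P c E → c + n * P + E - n * P - c ≡ E
      alg₂ = solve-∀
    main : n * (u N k - p₂ n) - pole ≡ E
    main = fin n (u N k) (p₂ n) pole E (trans (u-upper k h′) (trans eq (cong (λ x → x + E) (cube-split (+ L) n))))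

  -- Once the lower row is gone, replacing it by its cube costs only `O(n²)` as long as `L − 2n²` is
  -- `O(n)`. Thus `p₁` may be continued slightly beyond its range.
  dev-cut₁ : ∀ k α → tri (suc k) ℕ.≤ N → N ℕ.< 2 ℕ.* tri (suc k) →
    ∣ + L - + 2 * (+ suc k * + suc k) ∣ ℕ.≤ α ℕ.* suc k →
    ∣ u N k - p₁ (+ suc k) ∣ ℕ.≤ (suc k ℕ.* suc k ℕ.+ 21) ℕ.+ (α ℕ.* α ℕ.* α ℕ.* (suc k ℕ.* suc k) ℕ.+ (4 ℕ.* (suc k ℕ.* suc k) ℕ.+ 21) ℕ.* α)
  dev-cut₁ k α h h′ hz = cancel k (u N k - p₁ n) (subst (λ z → ∣ z ∣ ℕ.≤ suc k ℕ.* B) (sym main)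
       (ℕP.≤-trans (∣+∣≤ E C bd (cube-bound 2 (+ 2 * n) k (+ L - + 2 * (n * n)) refl α hz))
         (ℕP.≤-reflexive (sym (ℕP.*-distribˡ-+ (suc k) (suc k ℕ.* suc k ℕ.+ 21) (α ℕ.* α ℕ.* α ℕ.* (suc k ℕ.* suc k) ℕ.+ (4 ℕ.* (suc k ℕ.* suc k) ℕ.+ 21) ℕ.* α))))))
    where
    up = upper-48 k h
    E = proj₁ up
    eq = proj₁ (proj₂ up)
    bd = proj₂ (proj₂ up)
    n = + suc k
    B = (suc k ℕ.* suc k ℕ.+ 21) ℕ.+ (α ℕ.* α ℕ.* α ℕ.* (suc k ℕ.* suc k) ℕ.+ (4 ℕ.* (suc k ℕ.* suc k) ℕ.+ 21) ℕ.* α)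
    C = cube (+ 2 * n) (+ L - + 2 * (n * n))
    alg₁ : ∀ n U P → n * (U - P) ≡ n * U - n * P
    alg₁ = solve-∀
    alg₂ : ∀ C n P E → C + n * P + E - n * P ≡ E + C
    alg₂ = solve-∀
    main : n * (u N k - p₁ n) ≡ E + C
    main = trans (alg₁ n (u N k) (p₁ n)) (trans (cong (λ x → x - n * p₁ n) (trans (u-upper k h′) (trans eq (cong (λ x → x + E) (cube-diff (+ L) n)))))
             (alg₂ C n (p₁ n) E))

  u-0 : ∀ k → N ℕ.< tri (suc k) → u N k ≡ + 0
  u-0 k h = cong₂ (λ a b → + 48 * (a - + 2 * b)) (sh-< (tri (suc k)) (inv (suc k) κ) N h)
                  (lower-0 k (ℕP.<-≤-trans h (ℕP.m≤n*m (tri (suc k)) 2)))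

  -- The same continuation past the end of the upper row, where `u` is zero and the cube in `L − n²`
  -- is the whole error.
  dev-cut₂ : ∀ k β → N ℕ.< tri (suc k) → ∣ + L - + suc k * + suc k ∣ ℕ.≤ β ℕ.* suc k →
    ∣ + suc k * (u N k - p₂ (+ suc k)) - pole ∣ ℕ.≤ suc k ℕ.* (β ℕ.* β ℕ.* β ℕ.* (suc k ℕ.* suc k) ℕ.+ (1 ℕ.* (suc k ℕ.* suc k) ℕ.+ 21) ℕ.* β)
  dev-cut₂ k β h hz = subst (λ z → ∣ z ∣ ℕ.≤ suc k ℕ.* B) (sym main)
      (subst (ℕ._≤ suc k ℕ.* B) (sym (ℤP.∣-i∣≡∣i∣ (cube n (+ L - n * n)))) (cube-bound 1 n k (+ L - n * n) (n²-1 k) β hz))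
    where
    n = + suc k
    B = β ℕ.* β ℕ.* β ℕ.* (suc k ℕ.* suc k) ℕ.+ (1 ℕ.* (suc k ℕ.* suc k) ℕ.+ 21) ℕ.* β
    alg : ∀ n P c → n * (+ 0 - P) - c ≡ - (c + n * P)
    alg = solve-∀
    main : n * (u N k - p₂ n) - pole ≡ - cube n (+ L - n * n)
    main = trans (cong (λ x → n * (x - p₂ n) - pole) (u-0 k h)) (trans (alg n (p₂ n) pole) (cong -_ (sym (cube-split (+ L) n))))

-- Third differences

Δ³ : ℤ → ℤ → ℤ → ℤ → ℤ
Δ³ a b c d = d - + 3 * c + + 3 * b - a

Δ³-bound : ∀ a b c d {α β γ δ} → ∣ a ∣ ℕ.≤ α → ∣ b ∣ ℕ.≤ β → ∣ c ∣ ℕ.≤ γ → ∣ d ∣ ℕ.≤ δ →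
           ∣ Δ³ a b c d ∣ ℕ.≤ δ ℕ.+ 3 ℕ.* γ ℕ.+ 3 ℕ.* β ℕ.+ α
Δ³-bound a b c d p q r s =
  ∣--∣≤ (d - + 3 * c + + 3 * b) a
    (∣+∣≤ (d - + 3 * c) (+ 3 * b) (∣--∣≤ d (+ 3 * c) s (∣*∣≤ (+ 3) c ℕP.≤-refl r)) (∣*∣≤ (+ 3) b ℕP.≤-refl q)) p

Δ³-shift : ∀ a b c d p q r s → Δ³ a b c d ≡ Δ³ p q r s + Δ³ (a - p) (b - q) (c - r) (d - s)
Δ³-shift = alg
  where
  alg : ∀ a b c d p q r s → d - + 3 * c + + 3 * b - a ≡
    (s - + 3 * r + + 3 * q - p) + ((d - s) - + 3 * (c - r) + + 3 * (b - q) - (a - p))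
  alg = solve-∀

Σ<-bound : ∀ m (f : ℕ → ℤ) T → (∀ i → i ℕ.< m → ∣ f i ∣ ℕ.≤ T) → ∣ Σ< m f ∣ ℕ.≤ m ℕ.* T
Σ<-bound zero    f T h = z≤n
Σ<-bound (suc m) f T h = ∣+∣≤ (f 0) (Σ< m (f ∘ suc)) (h 0 (s≤s z≤n)) (Σ<-bound m (f ∘ suc) T (λ i i<m → h (suc i) (s≤s i<m)))

∣sgn∣ : ∀ n x → ∣ sgn n * x ∣ ≡ ∣ x ∣
∣sgn∣ n x = trans (ℤP.abs-* (sgn n) x) (trans (cong (λ s → s ℕ.* ∣ x ∣) (one n)) (ℕP.*-identityˡ ∣ x ∣))
  where
  one : ∀ n → ∣ sgn n ∣ ≡ 1
  one zero    = refl
  one (suc n) = trans (ℤP.∣-i∣≡∣i∣ (sgn n)) (one n)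

-- Boole summation to third order: an alternating sum is determined by its first terms up to third differences.
boole : ∀ m (u : ℕ → ℤ) → + 8 * Σ< m (λ i → sgn i * u i) ≡
  (+ 7 * u 0 - + 4 * u 1 + u 2) - Σ< m (λ i → sgn i * Δ³ (u i) (u (1 ℕ.+ i)) (u (2 ℕ.+ i)) (u (3 ℕ.+ i)))
  - sgn m * (+ 7 * u m - + 4 * u (1 ℕ.+ m) + u (2 ℕ.+ m))
boole zero u = alg (+ 7 * u 0 - + 4 * u 1 + u 2)
  where
  alg : ∀ x → + 0 ≡ x - + 0 - + 1 * x
  alg = solve-∀
boole (suc m) u =
  trans (cong (_*_ (+ 8)) (Σ<-snoc m (λ i → sgn i * u i)))
  (trans (ℤP.*-distribˡ-+ (+ 8) (Σ< m (λ i → sgn i * u i)) (sgn m * u m))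
  (trans (cong (λ x → x + + 8 * (sgn m * u m)) (boole m u))
  (trans (alg (sgn m) (+ 7 * u 0 - + 4 * u 1 + u 2) tail (u m) (u (1 ℕ.+ m)) (u (2 ℕ.+ m)) (u (3 ℕ.+ m)))
         (cong (λ x → (+ 7 * u 0 - + 4 * u 1 + u 2) - x - (- sgn m) * (+ 7 * u (1 ℕ.+ m) - + 4 * u (2 ℕ.+ m) + u (3 ℕ.+ m)))
           (sym (Σ<-snoc m (λ i → sgn i * Δ³ (u i) (u (1 ℕ.+ i)) (u (2 ℕ.+ i)) (u (3 ℕ.+ i)))))))))
  where
  tail = Σ< m (λ i → sgn i * Δ³ (u i) (u (1 ℕ.+ i)) (u (2 ℕ.+ i)) (u (3 ℕ.+ i)))
  alg : ∀ s X D a b c d → X - D - s * (+ 7 * a - + 4 * b + c) + + 8 * (s * a) ≡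
    X - (D + s * (d - + 3 * c + + 3 * b - a)) - (- s) * (+ 7 * b - + 4 * c + d)
  alg = solve-∀

-- Δ³ (c / n) = −6c / (n(n+1)(n+2)(n+3)), cleared of denominators since v is only close to c / n.
pole-window : ∀ k c (v₀ v₁ v₂ v₃ : ℤ) {b₀ b₁ b₂ b₃ γ} →
  let n = suc k in
  ∣ + n * v₀ - c ∣ ℕ.≤ n ℕ.* b₀ → ∣ + suc n * v₁ - c ∣ ℕ.≤ suc n ℕ.* b₁ →
  ∣ + suc (suc n) * v₂ - c ∣ ℕ.≤ suc (suc n) ℕ.* b₂ → ∣ + suc (suc (suc n)) * v₃ - c ∣ ℕ.≤ suc (suc (suc n)) ℕ.* b₃ →
  ∣ + 6 * c ∣ ℕ.≤ (n ℕ.* suc n ℕ.* (suc (suc n) ℕ.* suc (suc (suc n)))) ℕ.* γ →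
  ∣ Δ³ v₀ v₁ v₂ v₃ ∣ ℕ.≤ γ ℕ.+ (b₃ ℕ.+ 3 ℕ.* b₂ ℕ.+ 3 ℕ.* b₁ ℕ.+ b₀)
pole-window k c v₀ v₁ v₂ v₃ {b₀} {b₁} {b₂} {b₃} {γ} h₀ h₁ h₂ h₃ hc =
  ℕP.*-cancelˡ-≤ (n₀ ℕ.* n₁ ℕ.* (n₂ ℕ.* n₃))
    (subst (ℕ._≤ _) (trans (cong ∣_∣ (sym key)) (ℤP.abs-* (+ (n₀ ℕ.* n₁ ℕ.* (n₂ ℕ.* n₃))) (Δ³ v₀ v₁ v₂ v₃))) bound)
  where
  n₀ = suc k
  n₁ = suc n₀
  n₂ = suc n₁
  n₃ = suc n₂
  A₀ = + n₁ * (+ n₂ * + n₃)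
  A₁ = + n₀ * (+ n₂ * + n₃)
  A₂ = + n₀ * + n₁ * + n₃
  A₃ = + n₀ * + n₁ * + n₂
  R : ℤ
  R = Δ³ (A₀ * (+ n₀ * v₀ - c)) (A₁ * (+ n₁ * v₁ - c)) (A₂ * (+ n₂ * v₂ - c)) (A₃ * (+ n₃ * v₃ - c))
  alg : ∀ n c v₀ v₁ v₂ v₃ → let n₁ = + 1 + n; n₂ = + 1 + n₁; n₃ = + 1 + n₂ in
    n * n₁ * (n₂ * n₃) * (v₃ - + 3 * v₂ + + 3 * v₁ - v₀) ≡
    (n * n₁ * n₂ * (n₃ * v₃ - c) - + 3 * (n * n₁ * n₃ * (n₂ * v₂ - c)) + + 3 * (n * (n₂ * n₃) * (n₁ * v₁ - c))
      - n₁ * (n₂ * n₃) * (n * v₀ - c)) - + 6 * c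
  alg = solve-∀
  cast : + (n₀ ℕ.* n₁ ℕ.* (n₂ ℕ.* n₃)) ≡ + n₀ * + n₁ * (+ n₂ * + n₃)
  cast = trans (ℤP.pos-* (n₀ ℕ.* n₁) (n₂ ℕ.* n₃)) (cong₂ _*_ (ℤP.pos-* n₀ n₁) (ℤP.pos-* n₂ n₃))
  key : + (n₀ ℕ.* n₁ ℕ.* (n₂ ℕ.* n₃)) * Δ³ v₀ v₁ v₂ v₃ ≡ R - + 6 * c
  key = trans (cong (λ x → x * Δ³ v₀ v₁ v₂ v₃) cast) (alg (+ n₀) c v₀ v₁ v₂ v₃)
  abs₂ : ∀ a b → ∣ + a * + b ∣ ℕ.≤ a ℕ.* b
  abs₂ a b = ∣*∣≤ (+ a) (+ b) ℕP.≤-refl ℕP.≤-refl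
  fin : ∀ n₀ n₁ n₂ n₃ b₀ b₁ b₂ b₃ γ →
    n₀ ℕ.* n₁ ℕ.* n₂ ℕ.* (n₃ ℕ.* b₃) ℕ.+ 3 ℕ.* (n₀ ℕ.* n₁ ℕ.* n₃ ℕ.* (n₂ ℕ.* b₂)) ℕ.+ 3 ℕ.* (n₀ ℕ.* (n₂ ℕ.* n₃) ℕ.* (n₁ ℕ.* b₁))
      ℕ.+ n₁ ℕ.* (n₂ ℕ.* n₃) ℕ.* (n₀ ℕ.* b₀) ℕ.+ n₀ ℕ.* n₁ ℕ.* (n₂ ℕ.* n₃) ℕ.* γ
    ≡ n₀ ℕ.* n₁ ℕ.* (n₂ ℕ.* n₃) ℕ.* (γ ℕ.+ (b₃ ℕ.+ 3 ℕ.* b₂ ℕ.+ 3 ℕ.* b₁ ℕ.+ b₀))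
  fin = ℕR.solve-∀
  bound : ∣ R - + 6 * c ∣ ℕ.≤ n₀ ℕ.* n₁ ℕ.* (n₂ ℕ.* n₃) ℕ.* (γ ℕ.+ (b₃ ℕ.+ 3 ℕ.* b₂ ℕ.+ 3 ℕ.* b₁ ℕ.+ b₀))
  bound = ℕP.≤-trans (∣--∣≤ R (+ 6 * c)
    (Δ³-bound (A₀ * (+ n₀ * v₀ - c)) (A₁ * (+ n₁ * v₁ - c)) (A₂ * (+ n₂ * v₂ - c)) (A₃ * (+ n₃ * v₃ - c))
      (∣*∣≤ A₀ (+ n₀ * v₀ - c) (∣*∣≤ (+ n₁) (+ n₂ * + n₃) ℕP.≤-refl (abs₂ n₂ n₃)) h₀)
      (∣*∣≤ A₁ (+ n₁ * v₁ - c) (∣*∣≤ (+ n₀) (+ n₂ * + n₃) ℕP.≤-refl (abs₂ n₂ n₃)) h₁)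
      (∣*∣≤ A₂ (+ n₂ * v₂ - c) (∣*∣≤ (+ n₀ * + n₁) (+ n₃) (abs₂ n₀ n₁) ℕP.≤-refl) h₂)
      (∣*∣≤ A₃ (+ n₃ * v₃ - c) (∣*∣≤ (+ n₀ * + n₁) (+ n₂) (abs₂ n₀ n₁) ℕP.≤-refl) h₃)) hc)
    (ℕP.≤-reflexive (fin n₀ n₁ n₂ n₃ b₀ b₁ b₂ b₃ γ))

-- Positivity of the alternating sum for large N

≤-cast : ∀ {a a′ b b′} → a ≡ a′ → a′ ℕ.≤ b′ → b′ ≡ b → a ℕ.≤ b
≤-cast refl h refl = h

2triℕ : ∀ n → 2 ℕ.* tri n ≡ n ℕ.* n ℕ.+ n
2triℕ n = ℤP.+-injective (trans (ℤP.pos-* 2 (tri n)) (trans (2tri n) (cong (λ x → x + + n) (sym (ℤP.pos-* n n)))))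

tri-mono : ∀ {m n} → m ℕ.≤ n → tri m ℕ.≤ tri n
tri-mono z≤n       = z≤n
tri-mono (s≤s m≤n) = ℕP.+-mono-≤ (s≤s m≤n) (tri-mono m≤n)

-- The constants are those of Large.Err; 66 is the least M at which the main term 6 l² wins.
polynomial-bound : ∀ M q l x → M ≡ x ℕ.+ 66 → q ≡ (M ℕ.+ 3) ℕ.* (M ℕ.+ 3) → M ℕ.* M ℕ.+ M ℕ.+ 1 ℕ.≤ l → l ℕ.≤ q →
  M ℕ.* (300 ℕ.* q ℕ.+ 1260 ℕ.* M ℕ.+ 1596) ℕ.+ (3576 ℕ.* q ℕ.+ 4320 ℕ.* M ℕ.+ 6516) ℕ.+ 12 ℕ.* l ℕ.+ 1926 ℕ.< 6 ℕ.* (l ℕ.* l)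
polynomial-bound M q l x refl refl l≥ l≤q = ℕP.≤-trans (ℕP.≤-reflexive (sym (ℕP.+-suc (A ℕ.+ 12 ℕ.* l) 1926)))
  (ℕP.≤-trans (ℕP.+-monoˡ-≤ 1927 (ℕP.+-monoʳ-≤ A (ℕP.*-monoʳ-≤ 12 l≤q)))
  (ℕP.≤-trans (≤-by {A ℕ.+ 12 ℕ.* q ℕ.+ 1927} {6 ℕ.* (s ℕ.* s)} gap (alg x)) (ℕP.*-monoʳ-≤ 6 (ℕP.*-mono-≤ l≥ l≥))))
  where
  A = M ℕ.* (300 ℕ.* q ℕ.+ 1260 ℕ.* M ℕ.+ 1596) ℕ.+ (3576 ℕ.* q ℕ.+ 4320 ℕ.* M ℕ.+ 6516)
  s = M ℕ.* M ℕ.+ M ℕ.+ 1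
  gap = 6 ℕ.* (x ℕ.* x ℕ.* x ℕ.* x) ℕ.+ 1296 ℕ.* (x ℕ.* x ℕ.* x) ℕ.+ 93162 ℕ.* (x ℕ.* x) ℕ.+ 2231028 ℕ.* x ℕ.+ 139847
  alg : ∀ x → let M = x ℕ.+ 66; q = (M ℕ.+ 3) ℕ.* (M ℕ.+ 3) in
    (M ℕ.* (300 ℕ.* q ℕ.+ 1260 ℕ.* M ℕ.+ 1596) ℕ.+ (3576 ℕ.* q ℕ.+ 4320 ℕ.* M ℕ.+ 6516) ℕ.+ 12 ℕ.* q ℕ.+ 1927)
      ℕ.+ (6 ℕ.* (x ℕ.* x ℕ.* x ℕ.* x) ℕ.+ 1296 ℕ.* (x ℕ.* x ℕ.* x) ℕ.+ 93162 ℕ.* (x ℕ.* x) ℕ.+ 2231028 ℕ.* x ℕ.+ 139847)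
    ≡ 6 ℕ.* ((M ℕ.* M ℕ.+ M ℕ.+ 1) ℕ.* (M ℕ.* M ℕ.+ M ℕ.+ 1))
  alg = ℕR.solve-∀

positive-from : ∀ S B C → + C ℤ.≤ + 8 * S + + B → B ℕ.< C → + 0 ℤ.< S
positive-from S B C C≤ B<C = ℤP.*-cancelˡ-<-nonNeg (+ 8) (subst (ℤ._< + 8 * S) (sym (ℤP.*-zeroʳ (+ 8)))
  (ℤP.≰⇒> λ 8S≤0 → ℤP.<-irrefl refl (ℤP.<-≤-trans (ℤ.+<+ B<C) (ℤP.≤-trans C≤ (ℤP.+-monoˡ-≤ (+ B) 8S≤0)))))

-- K and M are the last n at which both rows, respectively the upper row, are present.
module Large (N K M : ℕ) (K+3≤M : K ℕ.+ 3 ℕ.≤ M)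
  (K≤ : 2 ℕ.* tri K ℕ.≤ N) (<K : N ℕ.< 2 ℕ.* tri (suc K))
  (M≤ : tri M ℕ.≤ N) (<M : N ℕ.< tri (suc M)) where

  private
    l = suc (2 ℕ.* N)
    q = (M ℕ.+ 3) ℕ.* (M ℕ.+ 3)
    sq : ℕ → ℕ
    sq k = suc k ℕ.* suc k

    double≤ : ∀ {x y} → x ℕ.≤ y → 2 ℕ.* x ℕ.≤ 2 ℕ.* y
    double≤ = ℕP.*-monoʳ-≤ 2

    l>M : M ℕ.* M ℕ.+ M ℕ.< l
    l>M = s≤s (subst (ℕ._≤ 2 ℕ.* N) (2triℕ M) (double≤ M≤))

    l<M : l ℕ.< suc M ℕ.* suc M ℕ.+ suc M
    l<M = subst₂ ℕ._≤_ (alg N) (2triℕ (suc M)) (double≤ <M) where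
      alg : ∀ N → 2 ℕ.* suc N ≡ suc (suc (2 ℕ.* N))
      alg = ℕR.solve-∀

    l>K : 2 ℕ.* (K ℕ.* K ℕ.+ K) ℕ.< l
    l>K = s≤s (double≤ (subst (ℕ._≤ N) (2triℕ K) K≤))

    l<2 : ∀ k → N ℕ.< 2 ℕ.* tri (suc k) → suc l ℕ.≤ 2 ℕ.* (sq k ℕ.+ suc k)
    l<2 k h = subst₂ ℕ._≤_ (alg N) (cong (2 ℕ.*_) (2triℕ (suc k))) (double≤ h) where
      alg : ∀ N → 2 ℕ.* suc N ≡ suc (suc (2 ℕ.* N))
      alg = ℕR.solve-∀

    l≤q : l ℕ.≤ q
    l≤q = ℕP.≤-trans (ℕP.≤-trans (ℕP.n≤1+n l) l<M) (≤-by (3 ℕ.* M ℕ.+ 7) (alg M)) where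
      alg : ∀ M → suc M ℕ.* suc M ℕ.+ suc M ℕ.+ (3 ℕ.* M ℕ.+ 7) ≡ (M ℕ.+ 3) ℕ.* (M ℕ.+ 3)
      alg = ℕR.solve-∀

    sq≤q : ∀ k → suc k ℕ.≤ M ℕ.+ 3 → sq k ℕ.≤ q
    sq≤q k h = ℕP.*-mono-≤ h h

    2KK≤q : 2 ℕ.* (K ℕ.* K) ℕ.≤ q
    2KK≤q = ℕP.≤-trans (ℕP.≤-trans (double≤ (ℕP.m≤m+n (K ℕ.* K) K)) (ℕP.<⇒≤ l>K)) l≤q

    both : ∀ k → suc k ℕ.≤ K → 2 ℕ.* tri (suc k) ℕ.≤ N
    both k h = ℕP.≤-trans (double≤ (tri-mono h)) K≤
    one : ∀ k → suc k ℕ.≤ M → tri (suc k) ℕ.≤ N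
    one k h = ℕP.≤-trans (tri-mono h) M≤
    not-both : ∀ k → K ℕ.≤ k → N ℕ.< 2 ℕ.* tri (suc k)
    not-both k h = ℕP.<-≤-trans <K (double≤ (tri-mono (s≤s h)))
    none : ∀ k → M ℕ.≤ k → N ℕ.< tri (suc k)
    none k h = ℕP.<-≤-trans <M (tri-mono (s≤s h))

    near₁ : ∀ k → suc k ℕ.≤ K → ∣ u N k - p₁ N (+ suc k) ∣ ℕ.≤ 9 ℕ.* (K ℕ.* K) ℕ.+ 63
    near₁ k h = ℕP.≤-trans (dev-both N k (both k h)) (ℕP.+-monoˡ-≤ 63 (ℕP.*-monoʳ-≤ 9 (ℕP.*-mono-≤ h h)))

    near₁q : ∀ k → suc k ℕ.≤ K → ∣ u N k - p₁ N (+ suc k) ∣ ℕ.≤ 5 ℕ.* q ℕ.+ 63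
    near₁q k h = ℕP.≤-trans (near₁ k h) (ℕP.+-monoˡ-≤ 63
      (ℕP.*-cancelˡ-≤ 2 (≤-cast (alg (K ℕ.* K)) (ℕP.*-mono-≤ {9} {10} {2 ℕ.* (K ℕ.* K)} {q} (ℕP.n≤1+n 9) 2KK≤q) (alg′ q))))
      where
      alg : ∀ x → 2 ℕ.* (9 ℕ.* x) ≡ 9 ℕ.* (2 ℕ.* x)
      alg = ℕR.solve-∀
      alg′ : ∀ x → 10 ℕ.* x ≡ 2 ℕ.* (5 ℕ.* x)
      alg′ = ℕR.solve-∀

    -- For `n = K + 1 + i` the bracketing of `l` between `2K(K + 1)` and `2(K + 1)(K + 2)` gives
    -- `|l − 2n²| ≤ (4i + 2) n`. The upper row is still present because `K + 3 ≤ M`. The equation in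
    -- the last argument lets `c` and `d` be the evaluated constants.
    cut₁ : ∀ i → i ℕ.< 3 → ∀ {c d} → (sq (K ℕ.+ i) ℕ.+ 21) ℕ.+ ((4 ℕ.* i ℕ.+ 2) ℕ.* (4 ℕ.* i ℕ.+ 2) ℕ.* (4 ℕ.* i ℕ.+ 2) ℕ.* sq (K ℕ.+ i) ℕ.+ (4 ℕ.* sq (K ℕ.+ i) ℕ.+ 21) ℕ.* (4 ℕ.* i ℕ.+ 2)) ≡ c ℕ.* sq (K ℕ.+ i) ℕ.+ d →
           ∣ u N (K ℕ.+ i) - p₁ N (+ suc (K ℕ.+ i)) ∣ ℕ.≤ c ℕ.* q ℕ.+ d
    cut₁ i i<3 {c} {d} e = ℕP.≤-trans
      (dev-cut₁ N (K ℕ.+ i) (4 ℕ.* i ℕ.+ 2) (one (K ℕ.+ i) k<M) (not-both (K ℕ.+ i) (ℕP.m≤m+n K i)) z-bound)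
      (≤-cast e (ℕP.+-monoˡ-≤ d (ℕP.*-monoʳ-≤ c (sq≤q (K ℕ.+ i) (ℕP.≤-trans k<M (ℕP.m≤m+n M 3))))) refl)
      where
      k<M : suc (K ℕ.+ i) ℕ.≤ M
      k<M = ℕP.≤-trans (ℕP.≤-trans (ℕP.≤-reflexive (sym (ℕP.+-suc K i))) (ℕP.+-monoʳ-≤ K i<3)) K+3≤M
      n = suc (K ℕ.+ i)
      cast : + 2 * (+ n * + n) ≡ + (2 ℕ.* (n ℕ.* n))
      cast = trans (cong (_*_ (+ 2)) (sym (ℤP.pos-* n n))) (sym (ℤP.pos-* 2 (n ℕ.* n)))
      hi : ∀ x i → 2 ℕ.* (suc x ℕ.* suc x ℕ.+ suc x) ℕ.+ (4 ℕ.* i ℕ.* x ℕ.+ 4 ℕ.* i ℕ.* x ℕ.+ 6 ℕ.* i ℕ.* i ℕ.+ 10 ℕ.* i)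
           ≡ 2 ℕ.* (suc (x ℕ.+ i) ℕ.* suc (x ℕ.+ i)) ℕ.+ (4 ℕ.* i ℕ.+ 2) ℕ.* suc (x ℕ.+ i)
      hi = ℕR.solve-∀
      lo : ∀ x i → 2 ℕ.* (suc (x ℕ.+ i) ℕ.* suc (x ℕ.+ i)) ℕ.+ (2 ℕ.* i ℕ.* i ℕ.+ 2 ℕ.* i)
           ≡ 2 ℕ.* (x ℕ.* x ℕ.+ x) ℕ.+ (4 ℕ.* i ℕ.+ 2) ℕ.* suc (x ℕ.+ i)
      lo = ℕR.solve-∀
      z-bound : ∣ + l - + 2 * (+ n * + n) ∣ ℕ.≤ (4 ℕ.* i ℕ.+ 2) ℕ.* n
      z-bound = subst (λ z → ∣ + l - z ∣ ℕ.≤ (4 ℕ.* i ℕ.+ 2) ℕ.* n) (sym cast)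
        (∣-∣≤ l (2 ℕ.* (n ℕ.* n)) ((4 ℕ.* i ℕ.+ 2) ℕ.* n)
          (ℕP.≤-trans (ℕP.≤-trans (ℕP.n≤1+n l) (l<2 K <K)) (≤-by _ (hi K i)))
          (ℕP.≤-trans (≤-by _ (lo K i)) (ℕP.+-monoˡ-≤ ((4 ℕ.* i ℕ.+ 2) ℕ.* n) (ℕP.<⇒≤ l>K))))

    v : ℕ → ℤ
    v k = u N k - p₂ N (+ suc k)

    near₂ : ∀ k → K ℕ.≤ k → suc k ℕ.≤ M → ∣ + suc k * v k - pole N ∣ ℕ.≤ suc k ℕ.* (q ℕ.+ 21)
    near₂ k h h′ = ℕP.≤-trans (dev-upper N k (one k h′) (not-both k h))
      (ℕP.*-monoʳ-≤ (suc k) (ℕP.+-monoˡ-≤ 21 (sq≤q k (ℕP.≤-trans h′ (ℕP.m≤m+n M 3)))))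

    -- As `cut₁`, now for `n = M + 1 + i`: `l` lies between `M(M + 1)` and `(M + 1)(M + 2)`, whence
    -- `|l − n²| ≤ (2i + 1) n`.
    cut₂ : ∀ i → i ℕ.< 3 → ∀ {c d} → (2 ℕ.* i ℕ.+ 1) ℕ.* (2 ℕ.* i ℕ.+ 1) ℕ.* (2 ℕ.* i ℕ.+ 1) ℕ.* sq (M ℕ.+ i) ℕ.+ (1 ℕ.* sq (M ℕ.+ i) ℕ.+ 21) ℕ.* (2 ℕ.* i ℕ.+ 1) ≡ c ℕ.* sq (M ℕ.+ i) ℕ.+ d →
           ∣ + suc (M ℕ.+ i) * v (M ℕ.+ i) - pole N ∣ ℕ.≤ suc (M ℕ.+ i) ℕ.* (c ℕ.* q ℕ.+ d)
    cut₂ i i<3 {c} {d} e = ℕP.≤-trans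
      (dev-cut₂ N (M ℕ.+ i) (2 ℕ.* i ℕ.+ 1) (none (M ℕ.+ i) (ℕP.m≤m+n M i)) z-bound)
      (ℕP.*-monoʳ-≤ n (≤-cast e (ℕP.+-monoˡ-≤ d (ℕP.*-monoʳ-≤ c (sq≤q (M ℕ.+ i)
        (ℕP.≤-trans (ℕP.≤-reflexive (sym (ℕP.+-suc M i))) (ℕP.+-monoʳ-≤ M i<3))))) refl))
      where
      n = suc (M ℕ.+ i)
      hi : ∀ x i → suc x ℕ.* suc x ℕ.+ suc x ℕ.+ (2 ℕ.* i ℕ.* x ℕ.+ 2 ℕ.* i ℕ.* x ℕ.+ 3 ℕ.* i ℕ.* i ℕ.+ 5 ℕ.* i)
           ≡ suc (x ℕ.+ i) ℕ.* suc (x ℕ.+ i) ℕ.+ (2 ℕ.* i ℕ.+ 1) ℕ.* suc (x ℕ.+ i)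
      hi = ℕR.solve-∀
      lo : ∀ x i → suc (x ℕ.+ i) ℕ.* suc (x ℕ.+ i) ℕ.+ (i ℕ.* i ℕ.+ i)
           ≡ x ℕ.* x ℕ.+ x ℕ.+ (2 ℕ.* i ℕ.+ 1) ℕ.* suc (x ℕ.+ i)
      lo = ℕR.solve-∀
      z-bound : ∣ + l - + n * + n ∣ ℕ.≤ (2 ℕ.* i ℕ.+ 1) ℕ.* n
      z-bound = subst (λ z → ∣ + l - z ∣ ℕ.≤ (2 ℕ.* i ℕ.+ 1) ℕ.* n) (ℤP.pos-* n n)
        (∣-∣≤ l (n ℕ.* n) ((2 ℕ.* i ℕ.+ 1) ℕ.* n)
          (ℕP.≤-trans (ℕP.≤-trans (ℕP.n≤1+n l) l<M) (≤-by _ (hi M i)))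
          (ℕP.≤-trans (≤-by _ (lo M i)) (ℕP.+-monoˡ-≤ ((2 ℕ.* i ℕ.+ 1) ℕ.* n) (ℕP.<⇒≤ l>M))))

    d : ℕ → ℤ
    d k = Δ³ (u N k) (u N (1 ℕ.+ k)) (u N (2 ℕ.+ k)) (u N (3 ℕ.+ k))

    K≤M : K ℕ.≤ M
    K≤M = ℕP.≤-trans (ℕP.m≤m+n K 3) K+3≤M

    Δp₁ Δp₂ : ℕ → ℤ
    Δp₁ k = Δ³ (p₁ N (+ suc k)) (p₁ N (+ suc (suc k))) (p₁ N (+ suc (suc (suc k)))) (p₁ N (+ suc (suc (suc (suc k)))))
    Δp₂ k = Δ³ (p₂ N (+ suc k)) (p₂ N (+ suc (suc k))) (p₂ N (+ suc (suc (suc k)))) (p₂ N (+ suc (suc (suc (suc k)))))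

    -- The third difference of `n⁵` at `n = k + 1`.
    quad : ℕ → ℤ
    quad k = + 60 * (+ suc k * + suc k) + + 180 * + suc k + + 150

    ∣quad∣ : ∀ k → ∣ quad k ∣ ℕ.≤ 60 ℕ.* sq k ℕ.+ 180 ℕ.* suc k ℕ.+ 150
    ∣quad∣ k = ∣+∣≤ (+ 60 * (+ suc k * + suc k) + + 180 * + suc k) (+ 150)
      (∣+∣≤ (+ 60 * (+ suc k * + suc k)) (+ 180 * + suc k)
        (∣*∣≤ (+ 60) (+ suc k * + suc k) ℕP.≤-refl (∣*∣≤ (+ suc k) (+ suc k) ℕP.≤-refl ℕP.≤-refl))
        (∣*∣≤ (+ 180) (+ suc k) ℕP.≤-refl ℕP.≤-refl)) ℕP.≤-refl

    ∣lin∣ : ∀ x y → ∣ + x * + l + + y ∣ ℕ.≤ x ℕ.* l ℕ.+ y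
    ∣lin∣ x y = ∣+∣≤ (+ x * + l) (+ y) (∣*∣≤ (+ x) (+ l) ℕP.≤-refl ℕP.≤-refl) ℕP.≤-refl

    -- The third difference kills the term of `p₁` linear in `n`, the only one that carries `l²`;
    -- what remains is of order `l`.
    Δp₁-bound : ∀ k → suc k ℕ.≤ K → ∣ Δp₁ k ∣ ℕ.≤ 264 ℕ.* q ℕ.+ 1260 ℕ.* M ℕ.+ 1092
    Δp₁-bound k h = subst (λ z → ∣ z ∣ ℕ.≤ 264 ℕ.* q ℕ.+ 1260 ℕ.* M ℕ.+ 1092) (sym (alg (+ l) (+ suc k)))
      (ℕP.≤-trans (∣--∣≤ (+ 7 * quad k) (+ 6 * (+ 9 * + l + + 7))
          (∣*∣≤ (+ 7) (quad k) ℕP.≤-refl (∣quad∣ k)) (∣*∣≤ (+ 6) (+ 9 * + l + + 7) ℕP.≤-refl (∣lin∣ 9 7)))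
        (≤-cast (alg₁ (sq k) (suc k) l)
          (ℕP.+-mono-≤ (ℕP.+-mono-≤ (ℕP.+-mono-≤ (ℕP.*-monoʳ-≤ 210 2sq≤q) (ℕP.*-monoʳ-≤ 1260 (ℕP.≤-trans h K≤M))) (ℕP.*-monoʳ-≤ 54 l≤q)) ℕP.≤-refl)
          (alg₂ q M)))
      where
      2sq≤q : 2 ℕ.* sq k ℕ.≤ q
      2sq≤q = ℕP.≤-trans (double≤ (ℕP.*-mono-≤ h h)) 2KK≤q
      alg₁ : ∀ s n l → 7 ℕ.* (60 ℕ.* s ℕ.+ 180 ℕ.* n ℕ.+ 150) ℕ.+ 6 ℕ.* (9 ℕ.* l ℕ.+ 7) ≡ 210 ℕ.* (2 ℕ.* s) ℕ.+ 1260 ℕ.* n ℕ.+ 54 ℕ.* l ℕ.+ 1092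
      alg₁ = ℕR.solve-∀
      alg₂ : ∀ q M → 210 ℕ.* q ℕ.+ 1260 ℕ.* M ℕ.+ 54 ℕ.* q ℕ.+ 1092 ≡ 264 ℕ.* q ℕ.+ 1260 ℕ.* M ℕ.+ 1092
      alg₂ = ℕR.solve-∀
      alg : ∀ l n → let P = λ n → n * (+ 3 * (l * l) + + 3 * l + + 21) - n * n * n * (+ 9 * l + + 7) + + 7 * (n * n * n * n * n) in
        P (+ 3 + n) - + 3 * P (+ 2 + n) + + 3 * P (+ 1 + n) - P n ≡ + 7 * (+ 60 * (n * n) + + 180 * n + + 150) - + 6 * (+ 9 * l + + 7)
      alg = solve-∀

    Δp₂-bound : ∀ k → suc k ℕ.≤ M → ∣ Δp₂ k ∣ ℕ.≤ 78 ℕ.* q ℕ.+ 180 ℕ.* M ℕ.+ 156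
    Δp₂-bound k h = subst (λ z → ∣ z ∣ ℕ.≤ 78 ℕ.* q ℕ.+ 180 ℕ.* M ℕ.+ 156) (sym (alg (+ l) (+ suc k)))
      (ℕP.≤-trans (∣--∣≤ (+ 6 * (+ 3 * + l + + 1)) (quad k)
          (∣*∣≤ (+ 6) (+ 3 * + l + + 1) ℕP.≤-refl (∣lin∣ 3 1)) (∣quad∣ k))
        (≤-cast (alg₁ (sq k) (suc k) l)
          (ℕP.+-mono-≤ (ℕP.+-mono-≤ (ℕP.+-mono-≤ (ℕP.*-monoʳ-≤ 60 (sq≤q k (ℕP.≤-trans h (ℕP.m≤m+n M 3)))) (ℕP.*-monoʳ-≤ 180 h)) (ℕP.*-monoʳ-≤ 18 l≤q)) ℕP.≤-refl)
          (alg₂ q M)))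
      where
      alg₁ : ∀ s n l → 6 ℕ.* (3 ℕ.* l ℕ.+ 1) ℕ.+ (60 ℕ.* s ℕ.+ 180 ℕ.* n ℕ.+ 150) ≡ 60 ℕ.* s ℕ.+ 180 ℕ.* n ℕ.+ 18 ℕ.* l ℕ.+ 156
      alg₁ = ℕR.solve-∀
      alg₂ : ∀ q M → 60 ℕ.* q ℕ.+ 180 ℕ.* M ℕ.+ 18 ℕ.* q ℕ.+ 156 ≡ 78 ℕ.* q ℕ.+ 180 ℕ.* M ℕ.+ 156
      alg₂ = ℕR.solve-∀
      alg : ∀ l n → let P = λ n → n * n * n * (+ 3 * l + + 1) - n * (+ 3 * (l * l) + l + + 21) - n * n * n * n * n in
        P (+ 3 + n) - + 3 * P (+ 2 + n) + + 3 * P (+ 1 + n) - P n ≡ + 6 * (+ 3 * l + + 1) - (+ 60 * (n * n) + + 180 * n + + 150)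
      alg = solve-∀

    window₁ : ∀ k {b₀ b₁ b₂ b₃} → suc k ℕ.≤ K →
      ∣ u N k - p₁ N (+ suc k) ∣ ℕ.≤ b₀ → ∣ u N (1 ℕ.+ k) - p₁ N (+ suc (suc k)) ∣ ℕ.≤ b₁ →
      ∣ u N (2 ℕ.+ k) - p₁ N (+ suc (suc (suc k))) ∣ ℕ.≤ b₂ → ∣ u N (3 ℕ.+ k) - p₁ N (+ suc (suc (suc (suc k)))) ∣ ℕ.≤ b₃ →
      ∣ d k ∣ ℕ.≤ (264 ℕ.* q ℕ.+ 1260 ℕ.* M ℕ.+ 1092) ℕ.+ (b₃ ℕ.+ 3 ℕ.* b₂ ℕ.+ 3 ℕ.* b₁ ℕ.+ b₀)
    window₁ k {b₀} {b₁} {b₂} {b₃} h h₀ h₁ h₂ h₃ = subst (λ z → ∣ z ∣ ℕ.≤ (264 ℕ.* q ℕ.+ 1260 ℕ.* M ℕ.+ 1092) ℕ.+ (b₃ ℕ.+ 3 ℕ.* b₂ ℕ.+ 3 ℕ.* b₁ ℕ.+ b₀))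
      (sym (Δ³-shift (u N k) (u N (1 ℕ.+ k)) (u N (2 ℕ.+ k)) (u N (3 ℕ.+ k))
        (p₁ N (+ suc k)) (p₁ N (+ suc (suc k))) (p₁ N (+ suc (suc (suc k)))) (p₁ N (+ suc (suc (suc (suc k)))))))
      (∣+∣≤ (Δp₁ k) (Δ³ (u N k - p₁ N (+ suc k)) (u N (1 ℕ.+ k) - p₁ N (+ suc (suc k)))
                       (u N (2 ℕ.+ k) - p₁ N (+ suc (suc (suc k)))) (u N (3 ℕ.+ k) - p₁ N (+ suc (suc (suc (suc k))))))
        (Δp₁-bound k h) (Δ³-bound (u N k - p₁ N (+ suc k)) (u N (1 ℕ.+ k) - p₁ N (+ suc (suc k)))
                   (u N (2 ℕ.+ k) - p₁ N (+ suc (suc (suc k)))) (u N (3 ℕ.+ k) - p₁ N (+ suc (suc (suc (suc k))))) {b₀} {b₁} {b₂} {b₃} h₀ h₁ h₂ h₃))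

    -- For `n > K` one has `l ≤ 2n(n + 1)`, so `l²` is at most four times `n(n + 1)(n + 2)(n + 3)`.
    -- That product is at least 24 and absorbs the 21 once more, which gives `6 · (4 + 1) = 30`.
    pole-bound : ∀ k → K ℕ.≤ k → ∣ + 6 * pole N ∣ ℕ.≤ suc k ℕ.* suc (suc k) ℕ.* (suc (suc (suc k)) ℕ.* suc (suc (suc (suc k)))) ℕ.* (30 ℕ.* l)
    pole-bound k h = ℕP.≤-trans
      (∣*∣≤ (+ 6) (pole N) ℕP.≤-refl (∣+∣≤ (+ l * + l * + l) (+ 21 * + l)
        (∣*∣≤ (+ l * + l) (+ l) (∣*∣≤ (+ l) (+ l) ℕP.≤-refl ℕP.≤-refl) ℕP.≤-refl) (∣*∣≤ (+ 21) (+ l) ℕP.≤-refl ℕP.≤-refl)))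
      (≤-cast (alg₁ l) (ℕP.*-monoʳ-≤ (6 ℕ.* l) (ℕP.+-mono-≤ ll≤ 21≤)) (alg₂ l n⁴))
      where
      A = suc k ℕ.* suc (suc k)
      n⁴ = A ℕ.* (suc (suc (suc k)) ℕ.* suc (suc (suc (suc k))))
      alg₁ : ∀ l → 6 ℕ.* (l ℕ.* l ℕ.* l ℕ.+ 21 ℕ.* l) ≡ 6 ℕ.* l ℕ.* (l ℕ.* l ℕ.+ 21)
      alg₁ = ℕR.solve-∀
      alg₂ : ∀ l n⁴ → 6 ℕ.* l ℕ.* (4 ℕ.* n⁴ ℕ.+ n⁴) ≡ n⁴ ℕ.* (30 ℕ.* l)
      alg₂ = ℕR.solve-∀
      alg₃ : ∀ A → (2 ℕ.* A) ℕ.* (2 ℕ.* A) ≡ 4 ℕ.* (A ℕ.* A)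
      alg₃ = ℕR.solve-∀
      alg₄ : ∀ n → 2 ℕ.* (n ℕ.* n ℕ.+ n) ≡ 2 ℕ.* (n ℕ.* suc n)
      alg₄ = ℕR.solve-∀
      l≤2A : l ℕ.≤ 2 ℕ.* A
      l≤2A = ℕP.≤-trans (ℕP.≤-trans (ℕP.n≤1+n l) (l<2 k (not-both k h))) (ℕP.≤-reflexive (alg₄ (suc k)))
      ll≤ : l ℕ.* l ℕ.≤ 4 ℕ.* n⁴
      ll≤ = ℕP.≤-trans (ℕP.*-mono-≤ l≤2A l≤2A) (ℕP.≤-trans (ℕP.≤-reflexive (alg₃ A))
        (ℕP.*-monoʳ-≤ 4 (ℕP.*-monoʳ-≤ A (ℕP.*-mono-≤ {suc k} {suc (suc (suc k))} (ℕP.m≤n+m (suc k) 2) (ℕP.m≤n+m (suc (suc k)) 2)))))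
      21≤ : 21 ℕ.≤ n⁴
      21≤ = ℕP.≤-trans (≤-by {21} {24} 3 refl)
        (ℕP.*-mono-≤ {2} {A} {12} (ℕP.*-mono-≤ {1} {suc k} {2} {suc (suc k)} (s≤s z≤n) (s≤s (s≤s z≤n)))
                     (ℕP.*-mono-≤ {3} {suc (suc (suc k))} {4} (s≤s (s≤s (s≤s z≤n))) (s≤s (s≤s (s≤s (s≤s z≤n))))))

    window₂ : ∀ k {b₀ b₁ b₂ b₃} → K ℕ.≤ k → suc k ℕ.≤ M →
      ∣ + suc k * v k - pole N ∣ ℕ.≤ suc k ℕ.* b₀ → ∣ + suc (suc k) * v (1 ℕ.+ k) - pole N ∣ ℕ.≤ suc (suc k) ℕ.* b₁ →
      ∣ + suc (suc (suc k)) * v (2 ℕ.+ k) - pole N ∣ ℕ.≤ suc (suc (suc k)) ℕ.* b₂ →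
      ∣ + suc (suc (suc (suc k))) * v (3 ℕ.+ k) - pole N ∣ ℕ.≤ suc (suc (suc (suc k))) ℕ.* b₃ →
      ∣ d k ∣ ℕ.≤ (108 ℕ.* q ℕ.+ 180 ℕ.* M ℕ.+ 156) ℕ.+ (b₃ ℕ.+ 3 ℕ.* b₂ ℕ.+ 3 ℕ.* b₁ ℕ.+ b₀)
    window₂ k {b₀} {b₁} {b₂} {b₃} h h′ h₀ h₁ h₂ h₃ = ℕP.≤-trans (subst (λ z → ∣ z ∣ ℕ.≤ (78 ℕ.* q ℕ.+ 180 ℕ.* M ℕ.+ 156) ℕ.+ (30 ℕ.* l ℕ.+ B))
      (sym (Δ³-shift (u N k) (u N (1 ℕ.+ k)) (u N (2 ℕ.+ k)) (u N (3 ℕ.+ k))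
        (p₂ N (+ suc k)) (p₂ N (+ suc (suc k))) (p₂ N (+ suc (suc (suc k)))) (p₂ N (+ suc (suc (suc (suc k)))))))
      (∣+∣≤ (Δp₂ k) (Δ³ (v k) (v (1 ℕ.+ k)) (v (2 ℕ.+ k)) (v (3 ℕ.+ k)))
        (Δp₂-bound k h′) (pole-window k (pole N) (v k) (v (1 ℕ.+ k)) (v (2 ℕ.+ k)) (v (3 ℕ.+ k)) {b₀} {b₁} {b₂} {b₃} {30 ℕ.* l} h₀ h₁ h₂ h₃ (pole-bound k h))))
      (≤-cast refl (ℕP.+-monoʳ-≤ (78 ℕ.* q ℕ.+ 180 ℕ.* M ℕ.+ 156) (ℕP.+-monoˡ-≤ B (ℕP.*-monoʳ-≤ 30 l≤q))) (alg q M B))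
      where
      B = b₃ ℕ.+ 3 ℕ.* b₂ ℕ.+ 3 ℕ.* b₁ ℕ.+ b₀
      alg : ∀ q M B → 78 ℕ.* q ℕ.+ 180 ℕ.* M ℕ.+ 156 ℕ.+ (30 ℕ.* q ℕ.+ B) ≡ 108 ℕ.* q ℕ.+ 180 ℕ.* M ℕ.+ 156 ℕ.+ B
      alg = ℕR.solve-∀

  -- `T` serves every window that crosses neither `K` nor `M`. Below `K` the error `9K² + 63` enters
  -- with the weights 1, 3, 3, 1, which with `2K² ≤ q` raises 264 to 300 and 1092 to 1596. The last
  -- bracket of `Err` is `B₁ + B₂`, the six windows that cross `K` or `M`.
  T Err : ℕ
  T = 300 ℕ.* q ℕ.+ 1260 ℕ.* M ℕ.+ 1596
  Err = M ℕ.* T ℕ.+ (3576 ℕ.* q ℕ.+ 4320 ℕ.* M ℕ.+ 6516)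

  private
    near₁-at : ∀ k i → K ≡ i ℕ.+ suc k → ∣ u N k - p₁ N (+ suc k) ∣ ℕ.≤ 5 ℕ.* q ℕ.+ 63
    near₁-at k i e = near₁q k (ℕP.≤-trans (ℕP.m≤n+m (suc k) i) (ℕP.≤-reflexive (sym e)))

    cut₁-at : ∀ k i → k ≡ K ℕ.+ i → i ℕ.< 3 → ∀ c d → (sq (K ℕ.+ i) ℕ.+ 21) ℕ.+ ((4 ℕ.* i ℕ.+ 2) ℕ.* (4 ℕ.* i ℕ.+ 2) ℕ.* (4 ℕ.* i ℕ.+ 2) ℕ.* sq (K ℕ.+ i) ℕ.+ (4 ℕ.* sq (K ℕ.+ i) ℕ.+ 21) ℕ.* (4 ℕ.* i ℕ.+ 2)) ≡ c ℕ.* sq (K ℕ.+ i) ℕ.+ d →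
           ∣ u N k - p₁ N (+ suc k) ∣ ℕ.≤ c ℕ.* q ℕ.+ d
    cut₁-at _ i refl i<3 c d e = cut₁ i i<3 {c} {d} e

    cut₂-at : ∀ k i → k ≡ M ℕ.+ i → i ℕ.< 3 → ∀ c d → (2 ℕ.* i ℕ.+ 1) ℕ.* (2 ℕ.* i ℕ.+ 1) ℕ.* (2 ℕ.* i ℕ.+ 1) ℕ.* sq (M ℕ.+ i) ℕ.+ (1 ℕ.* sq (M ℕ.+ i) ℕ.+ 21) ℕ.* (2 ℕ.* i ℕ.+ 1) ≡ c ℕ.* sq (M ℕ.+ i) ℕ.+ d →
           ∣ + suc k * v k - pole N ∣ ℕ.≤ suc k ℕ.* (c ℕ.* q ℕ.+ d)
    cut₂-at _ i refl i<3 c d e = cut₂ i i<3 {c} {d} e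

    c₁₀ : ∀ s → (s ℕ.+ 21) ℕ.+ (8 ℕ.* s ℕ.+ (4 ℕ.* s ℕ.+ 21) ℕ.* 2) ≡ 17 ℕ.* s ℕ.+ 63
    c₁₀ = ℕR.solve-∀
    c₁₁ : ∀ s → (s ℕ.+ 21) ℕ.+ (216 ℕ.* s ℕ.+ (4 ℕ.* s ℕ.+ 21) ℕ.* 6) ≡ 241 ℕ.* s ℕ.+ 147
    c₁₁ = ℕR.solve-∀
    c₁₂ : ∀ s → (s ℕ.+ 21) ℕ.+ (1000 ℕ.* s ℕ.+ (4 ℕ.* s ℕ.+ 21) ℕ.* 10) ≡ 1041 ℕ.* s ℕ.+ 231
    c₁₂ = ℕR.solve-∀
    c₂₀ : ∀ s → 1 ℕ.* s ℕ.+ (1 ℕ.* s ℕ.+ 21) ℕ.* 1 ≡ 2 ℕ.* s ℕ.+ 21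
    c₂₀ = ℕR.solve-∀
    c₂₁ : ∀ s → 27 ℕ.* s ℕ.+ (1 ℕ.* s ℕ.+ 21) ℕ.* 3 ≡ 30 ℕ.* s ℕ.+ 63
    c₂₁ = ℕR.solve-∀
    c₂₂ : ∀ s → 125 ℕ.* s ℕ.+ (1 ℕ.* s ℕ.+ 21) ℕ.* 5 ≡ 130 ℕ.* s ℕ.+ 105
    c₂₂ = ℕR.solve-∀

    -- Bounds within a window of four consecutive n: m for the third difference of the main term, i, x, y, z for the
    -- errors at an interior n and at the first, second and third n beyond K (index 1) or M (index 2).
    m₁ m₂ i₁ x₁ y₁ z₁ i₂ x₂ y₂ z₂ : ℕ
    m₁ = 264 ℕ.* q ℕ.+ 1260 ℕ.* M ℕ.+ 1092
    m₂ = 108 ℕ.* q ℕ.+ 180 ℕ.* M ℕ.+ 156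
    i₁ = 5 ℕ.* q ℕ.+ 63
    x₁ = 17 ℕ.* q ℕ.+ 63
    y₁ = 241 ℕ.* q ℕ.+ 147
    z₁ = 1041 ℕ.* q ℕ.+ 231
    i₂ = q ℕ.+ 21
    x₂ = 2 ℕ.* q ℕ.+ 21
    y₂ = 30 ℕ.* q ℕ.+ 63
    z₂ = 130 ℕ.* q ℕ.+ 105

    B₁ B₂ : ℕ
    B₁ = (m₁ ℕ.+ (x₁ ℕ.+ 3 ℕ.* i₁ ℕ.+ 3 ℕ.* i₁ ℕ.+ i₁)) ℕ.+ ((m₁ ℕ.+ (y₁ ℕ.+ 3 ℕ.* x₁ ℕ.+ 3 ℕ.* i₁ ℕ.+ i₁)) ℕ.+ ((m₁ ℕ.+ (z₁ ℕ.+ 3 ℕ.* y₁ ℕ.+ 3 ℕ.* x₁ ℕ.+ i₁)) ℕ.+ 0))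
    B₂ = (m₂ ℕ.+ (x₂ ℕ.+ 3 ℕ.* i₂ ℕ.+ 3 ℕ.* i₂ ℕ.+ i₂)) ℕ.+ ((m₂ ℕ.+ (y₂ ℕ.+ 3 ℕ.* x₂ ℕ.+ 3 ℕ.* i₂ ℕ.+ i₂)) ℕ.+ ((m₂ ℕ.+ (z₂ ℕ.+ 3 ℕ.* y₂ ℕ.+ 3 ℕ.* x₂ ℕ.+ i₂)) ℕ.+ 0))

    f : ℕ → ℤ
    f i = sgn i * d i

    ∣f∣ : ∀ i {b} → ∣ d i ∣ ℕ.≤ b → ∣ f i ∣ ℕ.≤ b
    ∣f∣ i {b} h = subst (ℕ._≤ b) (sym (∣sgn∣ i (d i))) h

    ∣Σ₃∣ : ∀ (g : ℕ → ℤ) {a b c} → ∣ g 0 ∣ ℕ.≤ a → ∣ g 1 ∣ ℕ.≤ b → ∣ g 2 ∣ ℕ.≤ c → ∣ Σ< 3 g ∣ ℕ.≤ a ℕ.+ (b ℕ.+ (c ℕ.+ 0))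
    ∣Σ₃∣ g p q r = ∣+∣≤ (g 0) (g 1 + (g 2 + + 0)) p (∣+∣≤ (g 1) (g 2 + + 0) q (∣+∣≤ (g 2) (+ 0) r ℕP.≤-refl))

    -- The window at index `i` involves `n = i + 1, …, i + 4`. So the first `a = K − 3` windows stay
    -- below `K`, the next three cross it, `m` windows lie between `K` and `M`, and the last three
    -- cross `M`. A crossing window keeps the approximation valid at its left end.
    module Blocks (a m : ℕ) (K≡ : K ≡ 3 ℕ.+ a) (M≡ : M ≡ a ℕ.+ (3 ℕ.+ (m ℕ.+ 3))) where

      block₁ : ∀ i → i ℕ.< a → ∣ f i ∣ ℕ.≤ T
      block₁ i i<a = ∣f∣ i (ℕP.≤-trans
        (window₁ i {9 ℕ.* (K ℕ.* K) ℕ.+ 63} {9 ℕ.* (K ℕ.* K) ℕ.+ 63} {9 ℕ.* (K ℕ.* K) ℕ.+ 63} {9 ℕ.* (K ℕ.* K) ℕ.+ 63} (i≤ 0 z≤n) (near₁ i (i≤ 0 z≤n)) (near₁ (1 ℕ.+ i) (i≤ 1 (s≤s z≤n)))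
                   (near₁ (2 ℕ.+ i) (i≤ 2 (s≤s (s≤s z≤n)))) (near₁ (3 ℕ.+ i) (i≤ 3 ℕP.≤-refl)))
        (≤-cast (alg (264 ℕ.* q ℕ.+ 1260 ℕ.* M ℕ.+ 1092) (K ℕ.* K))
          (ℕP.+-monoʳ-≤ (264 ℕ.* q ℕ.+ 1260 ℕ.* M ℕ.+ 1092) (ℕP.+-monoˡ-≤ 504 (ℕP.*-monoʳ-≤ 36 2KK≤q))) (alg′ q M)))
        where
        i≤ : ∀ j → j ℕ.≤ 3 → suc (j ℕ.+ i) ℕ.≤ K
        i≤ j j≤3 = subst (suc (j ℕ.+ i) ℕ.≤_) (sym K≡) (ℕP.≤-trans (ℕP.≤-reflexive (sym (ℕP.+-suc j i))) (ℕP.+-mono-≤ j≤3 i<a))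
        alg : ∀ c x → c ℕ.+ (9 ℕ.* x ℕ.+ 63 ℕ.+ 3 ℕ.* (9 ℕ.* x ℕ.+ 63) ℕ.+ 3 ℕ.* (9 ℕ.* x ℕ.+ 63) ℕ.+ (9 ℕ.* x ℕ.+ 63)) ≡ c ℕ.+ (36 ℕ.* (2 ℕ.* x) ℕ.+ 504)
        alg = ℕR.solve-∀
        alg′ : ∀ q M → 264 ℕ.* q ℕ.+ 1260 ℕ.* M ℕ.+ 1092 ℕ.+ (36 ℕ.* q ℕ.+ 504) ≡ 300 ℕ.* q ℕ.+ 1260 ℕ.* M ℕ.+ 1596
        alg′ = ℕR.solve-∀

      block₂ : ∣ Σ< 3 (λ j → f (a ℕ.+ j)) ∣ ℕ.≤ B₁
      block₂ = ∣Σ₃∣ (λ j → f (a ℕ.+ j))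
        (∣f∣ (a ℕ.+ 0) (window₁ (a ℕ.+ 0) {i₁} {i₁} {i₁} {x₁} (inside 2 0 refl) (in₁ 2 0 0 refl) (in₁ 1 1 0 refl) (in₁ 0 2 0 refl) (c₀ 3 0 refl)))
        (∣f∣ (a ℕ.+ 1) (window₁ (a ℕ.+ 1) {i₁} {i₁} {x₁} {y₁} (inside 1 1 refl) (in₁ 1 0 1 refl) (in₁ 0 1 1 refl) (c₀ 2 1 refl) (c₁ 3 1 refl)))
        (∣f∣ (a ℕ.+ 2) (window₁ (a ℕ.+ 2) {i₁} {x₁} {y₁} {z₁} (inside 0 2 refl) (in₁ 0 0 2 refl) (c₀ 1 2 refl) (c₁ 2 2 refl) (c₂ 3 2 refl)))
        where
        at : ∀ i j j′ → i ℕ.+ suc (j ℕ.+ j′) ≡ 3 → K ≡ i ℕ.+ suc (j ℕ.+ (a ℕ.+ j′))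
        at i j j′ e = trans K≡ (trans (cong (λ x → x ℕ.+ a) (sym e)) (alg a i j j′)) where
          alg : ∀ a i j j′ → i ℕ.+ suc (j ℕ.+ j′) ℕ.+ a ≡ i ℕ.+ suc (j ℕ.+ (a ℕ.+ j′))
          alg = ℕR.solve-∀
        inside : ∀ i j′ → i ℕ.+ suc j′ ≡ 3 → suc (a ℕ.+ j′) ℕ.≤ K
        inside i j′ e = ℕP.≤-trans (ℕP.m≤n+m (suc (a ℕ.+ j′)) i) (ℕP.≤-reflexive (sym (at i 0 j′ e)))
        in₁ : ∀ i j j′ → i ℕ.+ suc (j ℕ.+ j′) ≡ 3 → ∣ u N (j ℕ.+ (a ℕ.+ j′)) - p₁ N (+ suc (j ℕ.+ (a ℕ.+ j′))) ∣ ℕ.≤ i₁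
        in₁ i j j′ e = near₁-at (j ℕ.+ (a ℕ.+ j′)) i (at i j j′ e)
        past : ∀ j j′ i → j ℕ.+ j′ ≡ 3 ℕ.+ i → j ℕ.+ (a ℕ.+ j′) ≡ K ℕ.+ i
        past j j′ i e = trans (alg a j j′) (trans (cong (λ x → x ℕ.+ a) e) (trans (alg′ a i) (cong (λ x → x ℕ.+ i) (sym K≡)))) where
          alg : ∀ a j j′ → j ℕ.+ (a ℕ.+ j′) ≡ j ℕ.+ j′ ℕ.+ a
          alg = ℕR.solve-∀
          alg′ : ∀ a i → 3 ℕ.+ i ℕ.+ a ≡ 3 ℕ.+ a ℕ.+ i
          alg′ = ℕR.solve-∀
        c₀ : ∀ j j′ → j ℕ.+ j′ ≡ 3 → ∣ u N (j ℕ.+ (a ℕ.+ j′)) - p₁ N (+ suc (j ℕ.+ (a ℕ.+ j′))) ∣ ℕ.≤ x₁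
        c₀ j j′ e = cut₁-at (j ℕ.+ (a ℕ.+ j′)) 0 (past j j′ 0 e) (s≤s z≤n) 17 63 (c₁₀ (sq (K ℕ.+ 0)))
        c₁ : ∀ j j′ → j ℕ.+ j′ ≡ 4 → ∣ u N (j ℕ.+ (a ℕ.+ j′)) - p₁ N (+ suc (j ℕ.+ (a ℕ.+ j′))) ∣ ℕ.≤ y₁
        c₁ j j′ e = cut₁-at (j ℕ.+ (a ℕ.+ j′)) 1 (past j j′ 1 e) (s≤s (s≤s z≤n)) 241 147 (c₁₁ (sq (K ℕ.+ 1)))
        c₂ : ∀ j j′ → j ℕ.+ j′ ≡ 5 → ∣ u N (j ℕ.+ (a ℕ.+ j′)) - p₁ N (+ suc (j ℕ.+ (a ℕ.+ j′))) ∣ ℕ.≤ z₁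
        c₂ j j′ e = cut₁-at (j ℕ.+ (a ℕ.+ j′)) 2 (past j j′ 2 e) ℕP.≤-refl 1041 231 (c₁₂ (sq (K ℕ.+ 2)))

      private
        shape : ∀ j → j ℕ.≤ m ℕ.+ 3 → a ℕ.+ (3 ℕ.+ j) ℕ.≤ M
        shape j h = subst (a ℕ.+ (3 ℕ.+ j) ℕ.≤_) (sym M≡) (ℕP.+-monoʳ-≤ a (ℕP.+-monoʳ-≤ 3 h))
        late : ∀ j → K ℕ.≤ a ℕ.+ (3 ℕ.+ j)
        late j = subst (ℕ._≤ a ℕ.+ (3 ℕ.+ j)) (sym K≡) (≤-by j (alg a j)) where
          alg : ∀ a j → 3 ℕ.+ a ℕ.+ j ≡ a ℕ.+ (3 ℕ.+ j)
          alg = ℕR.solve-∀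
        in₂ : ∀ i j → suc (i ℕ.+ j) ℕ.≤ m ℕ.+ 3 → ∣ + suc (i ℕ.+ (a ℕ.+ (3 ℕ.+ j))) * v (i ℕ.+ (a ℕ.+ (3 ℕ.+ j))) - pole N ∣ ℕ.≤ suc (i ℕ.+ (a ℕ.+ (3 ℕ.+ j))) ℕ.* i₂
        in₂ i j h = near₂ (i ℕ.+ (a ℕ.+ (3 ℕ.+ j))) (ℕP.≤-trans (late j) (ℕP.m≤n+m (a ℕ.+ (3 ℕ.+ j)) i))
          (ℕP.≤-trans (ℕP.≤-reflexive (alg a i j)) (shape (suc (i ℕ.+ j)) h)) where
          alg : ∀ a i j → suc (i ℕ.+ (a ℕ.+ (3 ℕ.+ j))) ≡ a ℕ.+ (3 ℕ.+ suc (i ℕ.+ j))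
          alg = ℕR.solve-∀

      block₃ : ∀ j → j ℕ.< m → ∣ f (a ℕ.+ (3 ℕ.+ j)) ∣ ℕ.≤ T
      block₃ j j<m = ∣f∣ (a ℕ.+ (3 ℕ.+ j)) (ℕP.≤-trans
        (window₂ (a ℕ.+ (3 ℕ.+ j)) {i₂} {i₂} {i₂} {i₂} (late j) (ℕP.≤-trans (ℕP.≤-reflexive (alg a j)) (shape (suc j) (le 0 z≤n)))
          (in₂ 0 j (le 0 z≤n)) (in₂ 1 j (le 1 (s≤s z≤n))) (in₂ 2 j (le 2 (s≤s (s≤s z≤n)))) (in₂ 3 j (le 3 ℕP.≤-refl)))
        (≤-by (184 ℕ.* q ℕ.+ 1080 ℕ.* M ℕ.+ 1272) (alg′ q M)))
        where
        le : ∀ i → i ℕ.≤ 3 → suc (i ℕ.+ j) ℕ.≤ m ℕ.+ 3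
        le i h = ℕP.≤-trans (ℕP.≤-reflexive (trans (sym (ℕP.+-suc i j)) (ℕP.+-comm i (suc j)))) (ℕP.+-mono-≤ j<m h)
        alg : ∀ a j → suc (a ℕ.+ (3 ℕ.+ j)) ≡ a ℕ.+ (3 ℕ.+ suc j)
        alg = ℕR.solve-∀
        alg′ : ∀ q M → 108 ℕ.* q ℕ.+ 180 ℕ.* M ℕ.+ 156 ℕ.+ (q ℕ.+ 21 ℕ.+ 3 ℕ.* (q ℕ.+ 21) ℕ.+ 3 ℕ.* (q ℕ.+ 21) ℕ.+ (q ℕ.+ 21)) ℕ.+ (184 ℕ.* q ℕ.+ 1080 ℕ.* M ℕ.+ 1272)
          ≡ 300 ℕ.* q ℕ.+ 1260 ℕ.* M ℕ.+ 1596
        alg′ = ℕR.solve-∀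

      block₄ : ∣ Σ< 3 (λ j → f (a ℕ.+ (3 ℕ.+ (m ℕ.+ j)))) ∣ ℕ.≤ B₂
      block₄ = ∣Σ₃∣ (λ j → f (a ℕ.+ (3 ℕ.+ (m ℕ.+ j))))
        (∣f∣ (k 0) (window₂ (k 0) {i₂} {i₂} {i₂} {x₂} (late (m ℕ.+ 0)) (last 0 (s≤s z≤n)) (in₀ 0 0 (s≤s z≤n)) (in₀ 1 0 (s≤s (s≤s z≤n))) (in₀ 2 0 ℕP.≤-refl) (c₀ 3 0 refl)))
        (∣f∣ (k 1) (window₂ (k 1) {i₂} {i₂} {x₂} {y₂} (late (m ℕ.+ 1)) (last 1 (s≤s (s≤s z≤n))) (in₀ 0 1 (s≤s (s≤s z≤n))) (in₀ 1 1 ℕP.≤-refl) (c₀ 2 1 refl) (c₁ 3 1 refl)))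
        (∣f∣ (k 2) (window₂ (k 2) {i₂} {x₂} {y₂} {z₂} (late (m ℕ.+ 2)) (last 2 ℕP.≤-refl) (in₀ 0 2 ℕP.≤-refl) (c₀ 1 2 refl) (c₁ 2 2 refl) (c₂ 3 2 refl)))
        where
        k : ℕ → ℕ
        k j = a ℕ.+ (3 ℕ.+ (m ℕ.+ j))
        last : ∀ j → suc j ℕ.≤ 3 → suc (k j) ℕ.≤ M
        last j h = ℕP.≤-trans (ℕP.≤-reflexive (alg a m j)) (shape (m ℕ.+ suc j) (ℕP.+-monoʳ-≤ m h)) where
          alg : ∀ a m j → suc (a ℕ.+ (3 ℕ.+ (m ℕ.+ j))) ≡ a ℕ.+ (3 ℕ.+ (m ℕ.+ suc j))
          alg = ℕR.solve-∀
        in₀ : ∀ i j → suc (i ℕ.+ j) ℕ.≤ 3 → ∣ + suc (i ℕ.+ k j) * v (i ℕ.+ k j) - pole N ∣ ℕ.≤ suc (i ℕ.+ k j) ℕ.* i₂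
        in₀ i j h = in₂ i (m ℕ.+ j) (ℕP.≤-trans (ℕP.≤-reflexive (alg m i j)) (ℕP.+-monoʳ-≤ m h)) where
          alg : ∀ m i j → suc (i ℕ.+ (m ℕ.+ j)) ≡ m ℕ.+ suc (i ℕ.+ j)
          alg = ℕR.solve-∀
        past : ∀ i j l → i ℕ.+ j ≡ 3 ℕ.+ l → i ℕ.+ k j ≡ M ℕ.+ l
        past i j l e = trans (alg a m i j) (trans (cong (λ x → a ℕ.+ (3 ℕ.+ (m ℕ.+ x))) e) (trans (alg′ a m l) (cong (λ x → x ℕ.+ l) (sym M≡)))) where
          alg : ∀ a m i j → i ℕ.+ (a ℕ.+ (3 ℕ.+ (m ℕ.+ j))) ≡ a ℕ.+ (3 ℕ.+ (m ℕ.+ (i ℕ.+ j)))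
          alg = ℕR.solve-∀
          alg′ : ∀ a m l → a ℕ.+ (3 ℕ.+ (m ℕ.+ (3 ℕ.+ l))) ≡ a ℕ.+ (3 ℕ.+ (m ℕ.+ 3)) ℕ.+ l
          alg′ = ℕR.solve-∀
        c₀ : ∀ i j → i ℕ.+ j ≡ 3 → ∣ + suc (i ℕ.+ k j) * v (i ℕ.+ k j) - pole N ∣ ℕ.≤ suc (i ℕ.+ k j) ℕ.* x₂
        c₀ i j e = cut₂-at (i ℕ.+ k j) 0 (past i j 0 e) (s≤s z≤n) 2 21 (c₂₀ (sq (M ℕ.+ 0)))
        c₁ : ∀ i j → i ℕ.+ j ≡ 4 → ∣ + suc (i ℕ.+ k j) * v (i ℕ.+ k j) - pole N ∣ ℕ.≤ suc (i ℕ.+ k j) ℕ.* y₂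
        c₁ i j e = cut₂-at (i ℕ.+ k j) 1 (past i j 1 e) (s≤s (s≤s z≤n)) 30 63 (c₂₁ (sq (M ℕ.+ 1)))
        c₂ : ∀ i j → i ℕ.+ j ≡ 5 → ∣ + suc (i ℕ.+ k j) * v (i ℕ.+ k j) - pole N ∣ ℕ.≤ suc (i ℕ.+ k j) ℕ.* z₂
        c₂ i j e = cut₂-at (i ℕ.+ k j) 2 (past i j 2 e) ℕP.≤-refl 130 105 (c₂₂ (sq (M ℕ.+ 2)))

      total : ∣ Σ< M f ∣ ℕ.≤ Err
      total = subst (λ z → ∣ z ∣ ℕ.≤ Err) (sym split)
        (ℕP.≤-trans
          (∣+∣≤ (Σ< a f) (Σ< 3 (λ j → f (a ℕ.+ j)) + (Σ< m (λ j → f (a ℕ.+ (3 ℕ.+ j))) + Σ< 3 (λ j → f (a ℕ.+ (3 ℕ.+ (m ℕ.+ j))))))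
            (Σ<-bound a f T block₁)
            (∣+∣≤ (Σ< 3 (λ j → f (a ℕ.+ j))) (Σ< m (λ j → f (a ℕ.+ (3 ℕ.+ j))) + Σ< 3 (λ j → f (a ℕ.+ (3 ℕ.+ (m ℕ.+ j))))) block₂
              (∣+∣≤ (Σ< m (λ j → f (a ℕ.+ (3 ℕ.+ j)))) (Σ< 3 (λ j → f (a ℕ.+ (3 ℕ.+ (m ℕ.+ j)))))
                (Σ<-bound m (λ j → f (a ℕ.+ (3 ℕ.+ j))) T block₃) block₄)))
          (≤-cast (alg a m q M T) (ℕP.+-monoˡ-≤ (3576 ℕ.* q ℕ.+ 4320 ℕ.* M ℕ.+ 6516) (ℕP.*-monoˡ-≤ T am≤M)) refl))
        where
        split : Σ< M f ≡ Σ< a f + (Σ< 3 (λ j → f (a ℕ.+ j)) + (Σ< m (λ j → f (a ℕ.+ (3 ℕ.+ j))) + Σ< 3 (λ j → f (a ℕ.+ (3 ℕ.+ (m ℕ.+ j))))))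
        split = trans (cong (λ n → Σ< n f) M≡) (trans (Σ<-split a (3 ℕ.+ (m ℕ.+ 3)) f)
          (cong (_+_ (Σ< a f)) (trans (Σ<-split 3 (m ℕ.+ 3) (λ j → f (a ℕ.+ j)))
            (cong (_+_ (Σ< 3 (λ j → f (a ℕ.+ j)))) (Σ<-split m 3 (λ j → f (a ℕ.+ (3 ℕ.+ j))))))))
        am≤M : a ℕ.+ m ℕ.≤ M
        am≤M = subst (a ℕ.+ m ℕ.≤_) (sym M≡) (≤-by 6 (alg a m)) where
          alg : ∀ a m → a ℕ.+ m ℕ.+ 6 ≡ a ℕ.+ (3 ℕ.+ (m ℕ.+ 3))
          alg = ℕR.solve-∀
        alg : ∀ a m q M T → let
            m₁ = 264 ℕ.* q ℕ.+ 1260 ℕ.* M ℕ.+ 1092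
            m₂ = 108 ℕ.* q ℕ.+ 180 ℕ.* M ℕ.+ 156
            i₁ = 5 ℕ.* q ℕ.+ 63
            x₁ = 17 ℕ.* q ℕ.+ 63
            y₁ = 241 ℕ.* q ℕ.+ 147
            z₁ = 1041 ℕ.* q ℕ.+ 231
            i₂ = q ℕ.+ 21
            x₂ = 2 ℕ.* q ℕ.+ 21
            y₂ = 30 ℕ.* q ℕ.+ 63
            z₂ = 130 ℕ.* q ℕ.+ 105
            B₁ = (m₁ ℕ.+ (x₁ ℕ.+ 3 ℕ.* i₁ ℕ.+ 3 ℕ.* i₁ ℕ.+ i₁)) ℕ.+ ((m₁ ℕ.+ (y₁ ℕ.+ 3 ℕ.* x₁ ℕ.+ 3 ℕ.* i₁ ℕ.+ i₁)) ℕ.+ ((m₁ ℕ.+ (z₁ ℕ.+ 3 ℕ.* y₁ ℕ.+ 3 ℕ.* x₁ ℕ.+ i₁)) ℕ.+ 0))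
            B₂ = (m₂ ℕ.+ (x₂ ℕ.+ 3 ℕ.* i₂ ℕ.+ 3 ℕ.* i₂ ℕ.+ i₂)) ℕ.+ ((m₂ ℕ.+ (y₂ ℕ.+ 3 ℕ.* x₂ ℕ.+ 3 ℕ.* i₂ ℕ.+ i₂)) ℕ.+ ((m₂ ℕ.+ (z₂ ℕ.+ 3 ℕ.* y₂ ℕ.+ 3 ℕ.* x₂ ℕ.+ i₂)) ℕ.+ 0))
          in a ℕ.* T ℕ.+ (B₁ ℕ.+ (m ℕ.* T ℕ.+ B₂)) ≡ (a ℕ.+ m) ℕ.* T ℕ.+ (3576 ℕ.* q ℕ.+ 4320 ℕ.* M ℕ.+ 6516)
        alg = ℕR.solve-∀

  module _ (3≤K : 3 ℕ.≤ K) where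

    private
      -- The weights 7, -4, 1 are those of `4 − 2Δ + Δ²`, the start of `8 / (2 + Δ)`. On `n`, `n³`,
      -- `n⁵` at 1, 2, 3 they give 2, 2, 122, hence `6l² − 12l + 882`. The errors `9n² + 63` add up
      -- to `7 · 72 + 4 · 99 + 144 = 1044`.
      lead : ∣ + 7 * u N 0 - + 4 * u N 1 + u N 2 - (+ 6 * (+ l * + l) - + 12 * + l + + 882) ∣ ℕ.≤ 1044
      lead = subst (λ z → ∣ z ∣ ℕ.≤ 1044) (sym (alg (+ l) (u N 0) (u N 1) (u N 2)))
        (ℕP.≤-trans (∣+∣≤ (+ 7 * e 0 - + 4 * e 1) (e 2) (∣--∣≤ (+ 7 * e 0) (+ 4 * e 1)
            (∣*∣≤ (+ 7) (e 0) ℕP.≤-refl (dev-both N 0 (both 0 (ℕP.≤-trans (s≤s z≤n) 3≤K))))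
            (∣*∣≤ (+ 4) (e 1) ℕP.≤-refl (dev-both N 1 (both 1 (ℕP.≤-trans (s≤s (s≤s z≤n)) 3≤K)))))
            (dev-both N 2 (both 2 3≤K))) ℕP.≤-refl)
        where
        e : ℕ → ℤ
        e k = u N k - p₁ N (+ suc k)
        alg : ∀ l x y z → let P = λ n → n * (+ 3 * (l * l) + + 3 * l + + 21) - n * n * n * (+ 9 * l + + 7) + + 7 * (n * n * n * n * n) in
          + 7 * x - + 4 * y + z - (+ 6 * (l * l) - + 12 * l + + 882) ≡ + 7 * (x - P (+ 1)) - + 4 * (y - P (+ 2)) + (z - P (+ 3))
        alg = solve-∀

      a = K ∸ 3
      m = M ∸ (K ℕ.+ 3)
      K≡ : K ≡ 3 ℕ.+ a
      K≡ = sym (ℕP.m+[n∸m]≡n 3≤K)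
      M≡ : M ≡ a ℕ.+ (3 ℕ.+ (m ℕ.+ 3))
      M≡ = trans (sym (ℕP.m+[n∸m]≡n K+3≤M)) (trans (cong (λ k → k ℕ.+ 3 ℕ.+ m) K≡) (alg a m)) where
        alg : ∀ a m → 3 ℕ.+ a ℕ.+ 3 ℕ.+ m ≡ a ℕ.+ (3 ℕ.+ (m ℕ.+ 3))
        alg = ℕR.solve-∀

    Σu-lower : + (6 ℕ.* (l ℕ.* l)) ℤ.≤ + 8 * Σ< M (λ i → sgn i * u N i) + + (Err ℕ.+ 12 ℕ.* l ℕ.+ 1926)
    Σu-lower = subst (ℤ._≤ + 8 * S + + B) (sym eq)
      (ℤP.+-monoʳ-≤ (+ 8 * S) (ℤP.≤-trans (i≤∣i∣ R) (ℤ.+≤+ ∣R∣≤)))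
      where
      S = Σ< M (λ i → sgn i * u N i)
      Dᵤ = Σ< M f
      X = + 7 * u N 0 - + 4 * u N 1 + u N 2
      e = X - (+ 6 * (+ l * + l) - + 12 * + l + + 882)
      B = Err ℕ.+ 12 ℕ.* l ℕ.+ 1926
      R = Dᵤ + + 12 * + l - (e + + 882)
      i≤∣i∣ : ∀ i → i ℤ.≤ + ∣ i ∣
      i≤∣i∣ (+ n)    = ℤP.≤-refl
      i≤∣i∣ -[1+ n ] = ℤ.-≤+
      ∣R∣≤ : ∣ R ∣ ℕ.≤ B
      ∣R∣≤ = ∣--∣≤ (Dᵤ + + 12 * + l) (e + + 882) {Err ℕ.+ 12 ℕ.* l} {1926} (∣+∣≤ Dᵤ (+ 12 * + l) (Blocks.total a m K≡ M≡) (∣*∣≤ (+ 12) (+ l) ℕP.≤-refl ℕP.≤-refl))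
               (∣+∣≤ e (+ 882) {1044} {882} lead ℕP.≤-refl)
      tail-0 : sgn M * (+ 7 * u N M - + 4 * u N (1 ℕ.+ M) + u N (2 ℕ.+ M)) ≡ + 0
      tail-0 = trans (cong (_*_ (sgn M)) (cong₂ (λ x y → x + y)
          (cong₂ (λ x y → + 7 * x - + 4 * y) (u-0 N M (none M ℕP.≤-refl)) (u-0 N (1 ℕ.+ M) (none (1 ℕ.+ M) (ℕP.n≤1+n M))))
          (u-0 N (2 ℕ.+ M) (none (2 ℕ.+ M) (ℕP.m≤n+m M 2))))) (ℤP.*-zeroʳ (sgn M))
      8S : + 8 * S ≡ X - Dᵤ
      8S = trans (boole M (u N)) (trans (cong (λ z → X - Dᵤ - z) tail-0) (ℤP.+-identityʳ (X - Dᵤ)))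
      eq : + (6 ℕ.* (l ℕ.* l)) ≡ + 8 * S + R
      eq = trans (trans (ℤP.pos-* 6 (l ℕ.* l)) (cong (_*_ (+ 6)) (ℤP.pos-* l l)))
        (trans (alg (+ l) X Dᵤ) (cong (λ z → z + R) (sym 8S)))
        where
        alg : ∀ l X D → + 6 * (l * l) ≡ X - D + (D + + 12 * l - (X - (+ 6 * (l * l) - + 12 * l + + 882) + + 882))
        alg = solve-∀

  Σu>0 : 3 ℕ.≤ K → 66 ℕ.≤ M → + 0 ℤ.< Σ< M (λ i → sgn i * u N i)
  Σu>0 3≤K h = positive-from (Σ< M (λ i → sgn i * u N i)) (Err ℕ.+ 12 ℕ.* l ℕ.+ 1926) (6 ℕ.* (l ℕ.* l)) (Σu-lower 3≤K) (polynomial-bound M q l (M ∸ 66) (sym (ℕP.m∸n+n≡m h)) refl l≥ l≤q)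
    where
    l≥ : M ℕ.* M ℕ.+ M ℕ.+ 1 ℕ.≤ l
    l≥ = ℕP.≤-trans (ℕP.≤-reflexive (ℕP.+-comm (M ℕ.* M ℕ.+ M) 1)) l>M

-- The operator `H` and its positivity on `κ`

pairTerm : ℕ → Series → ℕ → ℤ
pairTerm k f N = sh (tri (suc k)) (inv (suc k) f) N - + 2 * sh (2 ℕ.* tri (suc k)) (inv (suc (double k)) f) N

-- Multiplication by A(q) − 2 A(q²), with the alternating sum A truncated after B terms.
H : ℕ → Series → Series
H B f N = Σ< B (λ k → sgn k * pairTerm k f N)

n≤tri : ∀ n → n ℕ.≤ tri n
n≤tri zero    = z≤n
n≤tri (suc n) = ℕP.m≤m+n (suc n) (tri n)

pairTerm-0 : ∀ k f N → N ℕ.< tri (suc k) → pairTerm k f N ≡ + 0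
pairTerm-0 k f N h = cong₂ (λ a b → a - + 2 * b) (sh-< (tri (suc k)) (inv (suc k) f) N h)
  (sh-< (2 ℕ.* tri (suc k)) (inv (suc (double k)) f) N (ℕP.<-≤-trans h (ℕP.m≤n*m (tri (suc k)) 2)))

-- Reconciles three cut-offs: the last present row in the estimate, 66 in the computation, and the
-- degree bound in the final argument.
H-truncate : ∀ A B f N → N ℕ.< tri (suc A) → N ℕ.< tri (suc B) → H A f N ≡ H B f N
H-truncate A B f N hA hB = trans (sym (Σ<-extend A (A ℕ.+ B) g (ℕP.m≤m+n A B) (zeros A hA)))
                                 (Σ<-extend B (A ℕ.+ B) g (ℕP.m≤n+m B A) (zeros B hB))
  where
  g : ℕ → ℤ
  g k = sgn k * pairTerm k f N
  zeros : ∀ A → N ℕ.< tri (suc A) → ∀ i → A ℕ.≤ i → g i ≡ + 0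
  zeros A h i A≤i = trans (cong (_*_ (sgn i)) (pairTerm-0 i f N (ℕP.<-≤-trans h (tri-mono (s≤s A≤i))))) (ℤP.*-zeroʳ (sgn i))

bracket : ∀ (g : ℕ → ℕ) N b → g 0 ℕ.≤ N → N ℕ.< g b → ∃[ k ] (g k ℕ.≤ N × N ℕ.< g (suc k))
bracket g N zero    h₀ hb = ⊥-elim (ℕP.<-irrefl refl (ℕP.<-≤-trans hb h₀))
bracket g N (suc b) h₀ hb with N ℕ.<? g b
... | yes N<gb = bracket g N b h₀ N<gb
... | no  N≮gb = b , ℕP.≮⇒≥ N≮gb , hb

tri-cancel-< : ∀ m n → tri m ℕ.< tri n → m ℕ.< n
tri-cancel-< m n h = ℕP.≰⇒> (λ n≤m → ℕP.<-irrefl refl (ℕP.<-≤-trans h (tri-mono n≤m)))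

module _ (N : ℕ) where

  private
    K-bracket : ∃[ k ] (2 ℕ.* tri k ℕ.≤ N × N ℕ.< 2 ℕ.* tri (suc k))
    K-bracket = bracket (λ k → 2 ℕ.* tri k) N (suc N) z≤n
      (ℕP.≤-trans (n≤tri (suc N)) (ℕP.m≤n*m (tri (suc N)) 2))
    M-bracket : ∃[ k ] (tri k ℕ.≤ N × N ℕ.< tri (suc k))
    M-bracket = bracket tri N (suc N) z≤n (n≤tri (suc N))
    K₀ = proj₁ K-bracket
    M₀ = proj₁ M-bracket
    K≤ = proj₁ (proj₂ K-bracket)
    <K = proj₂ (proj₂ K-bracket)
    M≤ = proj₁ (proj₂ M-bracket)
    <M = proj₂ (proj₂ M-bracket)

    -- If `M < K + 3`, then `tri (suc M) ≤ tri (K + 3) ≤ 2 tri K ≤ N`. The middle inequality,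
    -- `(K + 3)(K + 4) ≤ 2K(K + 1)`, holds from `K = 7` on.
    gap : ∀ K M → 7 ℕ.≤ K → M ℕ.< K ℕ.+ 3 → 2 ℕ.* tri K ℕ.≤ N → ¬ (N ℕ.< tri (suc M))
    gap K M 7≤K M<K+3 K≤ <M = ℕP.<-irrefl refl (ℕP.<-≤-trans
      (ℕP.≤-<-trans K≤ (ℕP.<-≤-trans <M (tri-mono M<K+3)))
      (ℕP.*-cancelˡ-≤ 2 (≤-cast (2triℕ (K ℕ.+ 3)) compare (cong (ℕ._*_ 2) (sym (2triℕ K))))))
      where
      alg : ∀ x → (x ℕ.+ 7 ℕ.+ 3) ℕ.* (x ℕ.+ 7 ℕ.+ 3) ℕ.+ (x ℕ.+ 7 ℕ.+ 3) ℕ.+ (x ℕ.* x ℕ.+ 9 ℕ.* x ℕ.+ 2) ≡ 2 ℕ.* ((x ℕ.+ 7) ℕ.* (x ℕ.+ 7) ℕ.+ (x ℕ.+ 7))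
      alg = ℕR.solve-∀
      compare : (K ℕ.+ 3) ℕ.* (K ℕ.+ 3) ℕ.+ (K ℕ.+ 3) ℕ.≤ 2 ℕ.* (K ℕ.* K ℕ.+ K)
      compare = subst (λ K → (K ℕ.+ 3) ℕ.* (K ℕ.+ 3) ℕ.+ (K ℕ.+ 3) ℕ.≤ 2 ℕ.* (K ℕ.* K ℕ.+ K)) (ℕP.m∸n+n≡m 7≤K) (≤-by _ (alg (K ∸ 7)))

    Σu≡48H : ∀ m → Σ< m (λ i → sgn i * u N i) ≡ + 48 * H m κ N
    Σu≡48H m = trans (Σ<-cong′ m (λ i → alg (sgn i) (pairTerm i κ N))) (Σ<-* m (+ 48) (λ i → sgn i * pairTerm i κ N))
      where
      alg : ∀ s x → s * (+ 48 * x) ≡ + 48 * (s * x)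
      alg = solve-∀

  Hκ>0-large : ∀ B → N ℕ.< B → tri 66 ℕ.≤ N → + 0 ℤ.< H B κ N
  Hκ>0-large B N<B large = subst (λ z → + 0 ℤ.< z) (H-truncate M₀ B κ N <M (ℕP.<-trans N<B (n≤tri (suc B))))
    (ℤP.*-cancelˡ-<-nonNeg (+ 48) (subst₂ ℤ._<_ (sym (ℤP.*-zeroʳ (+ 48))) (Σu≡48H M₀) (Large.Σu>0 N K₀ M₀ K+3≤M K≤ <K M≤ <M 3≤K 66≤M)))
    where
    66≤M : 66 ℕ.≤ M₀
    66≤M = ℕP.≤-pred (tri-cancel-< 66 (suc M₀) (ℕP.≤-<-trans large <M))
    7≤K : 7 ℕ.≤ K₀
    7≤K = ℕP.≤-pred (tri-cancel-< 7 (suc K₀) (ℕP.*-cancelˡ-< 2 (tri 7) (tri (suc K₀)) (ℕP.≤-<-trans (ℕP.≤-trans (≤-by 2155 refl) large) <K)))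
    3≤K : 3 ℕ.≤ K₀
    3≤K = ℕP.≤-trans (≤-by 4 refl) 7≤K
    K+3≤M : K₀ ℕ.+ 3 ℕ.≤ M₀
    K+3≤M = ℕP.≮⇒≥ (λ M<K+3 → gap K₀ M₀ 7≤K M<K+3 K≤ <M)

  private
    12row-sound : ∀ k e → + 12 * sh e (inv (suc k) κ) N ≡ 12row k e N
    12row-sound k e with e ℕ.≤ᵇ N in eq
    ... | false = cong (_*_ (+ 12)) (sh-< e (inv (suc k) κ) N (ℕP.≰⇒> (λ e≤N → subst 𝔹.T eq (ℕP.≤⇒≤ᵇ e≤N))))
    ... | true  = trans (cong (_*_ (+ 12)) at) (inv-κ k (x ℕ./ suc k) (x ℕ.% suc k) (ℕD.m%n<n x (suc k)))
      where
      x = N ∸ e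
      at : sh e (inv (suc k) κ) N ≡ inv (suc k) κ (x ℕ./ suc k ℕ.* suc k ℕ.+ x ℕ.% suc k)
      at = trans (cong (sh e (inv (suc k) κ)) (sym (ℕP.m+[n∸m]≡n (ℕP.≤ᵇ⇒≤ e N (subst 𝔹.T (sym eq) tt)))))
        (trans (sh-at e (inv (suc k) κ) x)
        (cong (inv (suc k) κ) (trans (ℕD.m≡m%n+[m/n]*n x (suc k)) (ℕP.+-comm (x ℕ.% suc k) _))))

  12W-sound : ∀ B → + 12 * H B κ N ≡ 12W B N
  12W-sound B = trans (sym (Σ<-* B (+ 12) (λ k → sgn k * pairTerm k κ N))) (Σ<-cong′ B (λ k →
    trans (alg (sgn k) (sh (tri (suc k)) (inv (suc k) κ) N) (sh (2 ℕ.* tri (suc k)) (inv (suc (double k)) κ) N))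
      (cong₂ (λ a b → sgn k * (a - + 2 * b)) (12row-sound k (tri (suc k))) (12row-sound (double k) (2 ℕ.* tri (suc k))))))
    where
    alg : ∀ s a b → + 12 * (s * (a - + 2 * b)) ≡ s * (+ 12 * a - + 2 * (+ 12 * b))
    alg = solve-∀

allPositive-sound : ∀ B n → allPositive B n ≡ true → ∀ N → 1 ℕ.≤ N → N ℕ.≤ n → + 0 ℤ.< 12W B N
allPositive-sound B zero    h N 1≤N N≤0 = ⊥-elim (ℕP.<-irrefl refl (ℕP.≤-trans 1≤N N≤0))
allPositive-sound B (suc n) h N 1≤N N≤n with N ℕ.≟ suc n | positiveᵇ (12W B (suc n)) in eq
... | yes refl | true  = sound (12W B (suc n)) eq
  where
  sound : ∀ z → positiveᵇ z ≡ true → + 0 ℤ.< z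
  sound (+ suc n) _ = ℤ.+<+ (s≤s z≤n)
... | no  N≢   | true  = allPositive-sound B n h N 1≤N (ℕP.≤-pred (ℕP.≤∧≢⇒< N≤n N≢))

-- 2210 = tri 66 − 1
allPositive-2210 : allPositive 66 2210 ≡ true
allPositive-2210 = refl

Hκ>0 : ∀ B N → 1 ℕ.≤ N → N ℕ.< B → + 0 ℤ.< H B κ N
Hκ>0 B N 1≤N N<B with N ℕ.≤? 2210
... | no  N≰ = Hκ>0-large N B N<B (ℕP.≰⇒> N≰)
... | yes N≤ = subst (λ z → + 0 ℤ.< z) (H-truncate 66 B κ N (ℕP.≤-<-trans N≤ (≤-by 67 refl)) (ℕP.<-trans N<B (n≤tri (suc B))))
  (ℤP.*-cancelˡ-<-nonNeg (+ 12) (subst₂ ℤ._<_ (sym (ℤP.*-zeroʳ (+ 12))) (sym (12W-sound N 66)) (allPositive-sound 66 2210 allPositive-2210 N 1≤N N≤)))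

-- From `κ` to the overpartition product

δ : Series
δ zero    = + 1
δ (suc n) = + 0

-- The product of `(1 + q^j) / (1 − q^j)` over `1 ≤ j ≤ k`.
overSeries : ℕ → Series
overSeries zero    = δ
overSeries (suc k) = inv (suc k) (λ n → overSeries k n + sh (suc k) (overSeries k) n)

module _ (B : ℕ) where

  private
    pairTerm-+ : ∀ k f g N → pairTerm k (λ i → f i + g i) N ≡ pairTerm k f N + pairTerm k g N
    pairTerm-+ k f g N = trans (cong₂ (λ a b → a - + 2 * b) (part (suc k) (tri (suc k))) (part (suc (double k)) (2 ℕ.* tri (suc k))))
      (alg (sh (tri (suc k)) (inv (suc k) f) N) (sh (tri (suc k)) (inv (suc k) g) N)
           (sh (2 ℕ.* tri (suc k)) (inv (suc (double k)) f) N) (sh (2 ℕ.* tri (suc k)) (inv (suc (double k)) g) N))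
      where
      part : ∀ k e → sh e (inv k (λ i → f i + g i)) N ≡ sh e (inv k f) N + sh e (inv k g) N
      part k e = trans (sh-cong e (inv-+ k f g) N) (sh-+ e (inv k f) (inv k g) N)
      alg : ∀ a b c d → a + b - + 2 * (c + d) ≡ (a - + 2 * c) + (b - + 2 * d)
      alg = solve-∀

    pairTerm-sh : ∀ k l f N → pairTerm k (sh l f) N ≡ sh l (pairTerm k f) N
    pairTerm-sh k l f N = sym (trans (sh-- l (sh (tri (suc k)) (inv (suc k) f)) (λ n → + 2 * sh (2 ℕ.* tri (suc k)) (inv (suc (double k)) f) n) N)
      (cong₂ (λ a b → a - b) (part k (tri (suc k)))
        (trans (sh-* l (+ 2) (sh (2 ℕ.* tri (suc k)) (inv (suc (double k)) f)) N) (cong (_*_ (+ 2)) (part (double k) (2 ℕ.* tri (suc k)))))))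
      where
      part : ∀ k e → sh l (sh e (inv (suc k) f)) N ≡ sh e (inv (suc k) (sh l f)) N
      part k e = trans (sh-comm l e (inv (suc k) f) N) (sh-cong e (λ n → sym (inv-sh k l f n)) N)

  H-+ : ∀ f g N → H B (λ i → f i + g i) N ≡ H B f N + H B g N
  H-+ f g N = trans (Σ<-cong′ B (λ k → trans (cong (_*_ (sgn k)) (pairTerm-+ k f g N)) (ℤP.*-distribˡ-+ (sgn k) _ _)))
    (Σ<-+ B (λ k → sgn k * pairTerm k f N) (λ k → sgn k * pairTerm k g N))

  H-sh : ∀ l f N → H B (sh l f) N ≡ sh l (H B f) N
  H-sh l f N = trans (Σ<-cong′ B (λ k → trans (cong (_*_ (sgn k)) (pairTerm-sh k l f N)) (sym (sh-* l (sgn k) (pairTerm k f) N))))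
    (sym (sh-Σ l B (λ k n → sgn k * pairTerm k f n) N))

  H-cong : ∀ {f g : Series} → (∀ n → f n ≡ g n) → ∀ N → H B f N ≡ H B g N
  H-cong h N = Σ<-cong′ B (λ k → cong₂ (λ a b → sgn k * (a - + 2 * b))
    (sh-cong (tri (suc k)) (inv-cong (suc k) h) N) (sh-cong (2 ℕ.* tri (suc k)) (inv-cong (suc (double k)) h) N))

  -- `H` is linear and commutes with powers of `q`, so it inherits a factor `1 / (1 − q^l)`.
  H-rec : ∀ l f g → (∀ n → f n ≡ g n + sh l f n) → ∀ N → H B f N ≡ H B g N + sh l (H B f) N
  H-rec l f g h N = trans (H-cong h N) (trans (H-+ g (sh l f) N) (cong (_+_ (H B g N)) (H-sh l f N)))

private
  -- The first two products in closed form: `(1 + q) / (1 − q)` and `(1 + q²) / (1 − q)²`.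
  o₁ o₂ : Series
  o₁ zero    = + 1
  o₁ (suc n) = + 2
  o₂ zero    = + 1
  o₂ (suc n) = + 2 * + suc n

  overSeries-1 : ∀ n → overSeries 1 n ≡ o₁ n
  overSeries-1 n = sym (inv-unique 0 (λ n → δ n + sh 1 δ n) {o₁} (λ { zero → refl ; (suc zero) → refl ; (suc (suc n)) → refl }) n)

  overSeries-2 : ∀ n → overSeries 2 n ≡ o₂ n
  overSeries-2 n = trans (inv-cong 2 (λ n → cong₂ _+_ (overSeries-1 n) (sh-cong 2 overSeries-1 n)) n)
    (sym (inv-unique 1 (λ n → o₁ n + sh 2 o₁ n) {o₂}
      (λ { zero → refl ; (suc zero) → refl ; (suc (suc zero)) → refl ; (suc (suc (suc n))) → alg (+ n) }) n))
    where
    alg : ∀ n → + 2 * (+ 3 + n) ≡ + 2 + + 2 + + 2 * (+ 1 + n)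
    alg = solve-∀

  -- That is, `(1 − q⁴) κ = (1 + q³) o₂`. Both sides equal `(1 + q)(1 + q²)(1 − q + q²) / (1 − q)²`,
  -- as `1 + q³ = (1 + q)(1 − q + q²)`.
  κ-rec : ∀ n → κ n ≡ (o₂ n + sh 3 o₂ n) + sh 4 κ n
  κ-rec zero                      = refl
  κ-rec (suc zero)                = refl
  κ-rec (suc (suc zero))          = refl
  κ-rec (suc (suc (suc zero)))    = refl
  κ-rec (suc (suc (suc (suc n)))) = alg (+ n) (+ tri n)
    where
    alg : ∀ n t → + 1 + ((+ 4 + n) + ((+ 3 + n) + ((+ 2 + n) + ((+ 1 + n) + t)))) ≡ (+ 2 * (+ 4 + n) + + 2 * (+ 1 + n)) + (+ 1 + t)
    alg = solve-∀

  Q : Series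
  Q = inv 3 κ

  overSeries-3 : ∀ n → Q n ≡ overSeries 3 n + sh 4 Q n
  overSeries-3 n = trans (inv-cong 3 κ-rec n) (trans (inv-+ 3 (λ n → o₂ n + sh 3 o₂ n) (sh 4 κ) n)
    (cong₂ _+_ (inv-cong 3 (λ n → sym (cong₂ _+_ (overSeries-2 n) (sh-cong 3 overSeries-2 n))) n) (inv-sh 2 4 κ n)))

  overSeries-4 : ∀ n → overSeries 4 n ≡ Q n + sh 4 Q n
  overSeries-4 n = trans (inv-+ 4 (overSeries 3) (sh 4 (overSeries 3)) n) (cong₂ _+_ (Q≡ n) (trans (inv-sh 3 4 (overSeries 3) n) (sh-cong 4 Q≡ n)))
    where
    Q≡ : ∀ n → inv 4 (overSeries 3) n ≡ Q n
    Q≡ n = sym (inv-unique 3 (overSeries 3) overSeries-3 n)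

  -- The product of four factors as `(1 + q⁴) κ / (1 − q³)`, in the shape that `dominates` takes.
  overSeries-4-rec : ∀ n → overSeries 4 n ≡ (κ n + sh 4 κ n) + sh 3 (overSeries 4) n
  overSeries-4-rec n = trans (overSeries-4 n) (trans (cong₂ _+_ (inv-rec 2 κ n) (trans (sh-cong 4 (inv-rec 2 κ) n) (sh-+ 4 κ (sh 3 Q) n)))
    (trans (interchange (κ n) (sh 3 Q n) (sh 4 κ n) (sh 4 (sh 3 Q) n))
      (cong (_+_ (κ n + sh 4 κ n)) (trans (cong (_+_ (sh 3 Q n)) (sh-comm 4 3 Q n))
        (trans (sym (sh-+ 3 Q (sh 4 Q) n)) (sh-cong 3 (λ n → sym (overSeries-4 n)) n))))))

sh-nonneg : ∀ k f n → (∀ i → i ℕ.≤ n → + 0 ℤ.≤ f i) → + 0 ℤ.≤ sh k f n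
sh-nonneg zero    f n       h = h n ℕP.≤-refl
sh-nonneg (suc k) f zero    h = ℤP.≤-refl
sh-nonneg (suc k) f (suc n) h = sh-nonneg k f n (λ i i≤n → h i (ℕP.m≤n⇒m≤1+n i≤n))

sh-nonneg< : ∀ k f n → (∀ i → i ℕ.< n → + 0 ℤ.≤ f i) → + 0 ℤ.≤ sh (suc k) f n
sh-nonneg< k f zero    h = ℤP.≤-refl
sh-nonneg< k f (suc n) h = sh-nonneg k f n (λ i i≤n → h i (s≤s i≤n))

-- Here `f = g (1 + q^a) / (1 − q^(b+1))`, and this factor has nonnegative coefficients and constant
-- term 1. The bound `B` is carried along because `H B κ` is controlled only below `B`.
dominates : ∀ B a b (f g : Series) → (∀ n → f n ≡ (g n + sh a g n) + sh (suc b) f n) →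
  (∀ n → n ℕ.< B → + 0 ℤ.≤ g n) → ∀ n → n ℕ.< B → g n ℤ.≤ f n
dominates B a b f g rec g≥0 = <-rec (λ n → n ℕ.< B → g n ℤ.≤ f n) step
  where
  step : ∀ n → (∀ {i} → i ℕ.< n → i ℕ.< B → g i ℤ.≤ f i) → n ℕ.< B → g n ℤ.≤ f n
  step n ih n<B = subst (ℤ._≤ f n) (trans (ℤP.+-identityʳ (g n + + 0)) (ℤP.+-identityʳ (g n)))
    (subst (λ z → (g n + + 0) + + 0 ℤ.≤ z) (sym (rec n))
      (ℤP.+-mono-≤ (ℤP.+-monoʳ-≤ (g n) (sh-nonneg a g n (λ i i≤n → g≥0 i (ℕP.≤-<-trans i≤n n<B))))
        (sh-nonneg< b f n (λ i i<n → ℤP.≤-trans (g≥0 i (ℕP.<-trans i<n n<B)) (ih i<n (ℕP.<-trans i<n n<B))))))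

Hκ≥0 : ∀ B N → N ℕ.< B → + 0 ℤ.≤ H B κ N
Hκ≥0 B zero    N<B = ℤP.≤-reflexive (sym (Σ<-0 B (λ k _ → trans (cong (_*_ (sgn k)) (pairTerm-0 k κ 0 (s≤s z≤n))) (ℤP.*-zeroʳ (sgn k)))))
Hκ≥0 B (suc N) N<B = ℤP.<⇒≤ (Hκ>0 B (suc N) (s≤s z≤n) N<B)

-- The base case brings in `(1 + q⁴) / (1 − q³)`, each further step one factor
-- `(1 + q^k) / (1 − q^k)` with `k ≥ 5`.
Hκ≤HoverSeries : ∀ B K N → N ℕ.< B → H B κ N ℤ.≤ H B (overSeries (K ℕ.+ 4)) N
Hκ≤HoverSeries B zero = dominates B 4 2 (H B (overSeries 4)) (H B κ)
  (λ n → trans (H-rec B 3 (overSeries 4) (λ n → κ n + sh 4 κ n) overSeries-4-rec n)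
    (cong (λ z → z + sh 3 (H B (overSeries 4)) n) (trans (H-+ B κ (sh 4 κ) n) (cong (_+_ (H B κ n)) (H-sh B 4 κ n))))) (Hκ≥0 B)
Hκ≤HoverSeries B (suc K) N N<B = ℤP.≤-trans (Hκ≤HoverSeries B K N N<B)
  (dominates B k (K ℕ.+ 4) (H B (overSeries k)) (H B g)
    (λ n → trans (H-rec B k (overSeries k) (λ n → g n + sh k g n) (inv-rec (K ℕ.+ 4) (λ n → g n + sh k g n)) n)
      (cong (λ z → z + sh k (H B (overSeries k)) n) (trans (H-+ B g (sh k g) n) (cong (_+_ (H B g n)) (H-sh B k g n)))))
    (λ n n<B → ℤP.≤-trans (Hκ≥0 B n n<B) (Hκ≤HoverSeries B K n n<B)) N N<B)
  where
  g = overSeries (K ℕ.+ 4)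
  k = suc (K ℕ.+ 4)

HoverSeries>0 : ∀ B K N → 1 ℕ.≤ N → N ℕ.< B → + 0 ℤ.< H B (overSeries (K ℕ.+ 4)) N
HoverSeries>0 B K N 1≤N N<B = ℤP.<-≤-trans (Hκ>0 B N 1≤N N<B) (Hκ≤HoverSeries B K N N<B)

-- Partitions

sumL : {A : Set} → (A → ℤ) → List A → ℤ
sumL φ []       = + 0
sumL φ (x ∷ xs) = φ x + sumL φ xs

module _ {A : Set} where

  sumL-++ : ∀ (φ : A → ℤ) xs ys → sumL φ (xs ++ ys) ≡ sumL φ xs + sumL φ ys
  sumL-++ φ []       ys = sym (ℤP.+-identityˡ _)
  sumL-++ φ (x ∷ xs) ys = trans (cong (_+_ (φ x)) (sumL-++ φ xs ys)) (sym (ℤP.+-assoc (φ x) _ _))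

  sumL-cong : ∀ {φ ψ : A → ℤ} → (∀ x → φ x ≡ ψ x) → ∀ xs → sumL φ xs ≡ sumL ψ xs
  sumL-cong h []       = refl
  sumL-cong h (x ∷ xs) = cong₂ _+_ (h x) (sumL-cong h xs)

  sumL-map : ∀ {B : Set} (φ : A → ℤ) (g : B → A) xs → sumL φ (map g xs) ≡ sumL (φ ∘ g) xs
  sumL-map φ g []       = refl
  sumL-map φ g (x ∷ xs) = cong (_+_ (φ (g x))) (sumL-map φ g xs)

  sumL-concatMap : ∀ {B : Set} (φ : A → ℤ) (g : B → List A) xs → sumL φ (concatMap g xs) ≡ sumL (λ x → sumL φ (g x)) xs
  sumL-concatMap φ g []       = refl
  sumL-concatMap φ g (x ∷ xs) = trans (sumL-++ φ (g x) (concatMap g xs)) (cong (_+_ (sumL φ (g x))) (sumL-concatMap φ g xs))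

  sumL-+ : ∀ (φ ψ : A → ℤ) xs → sumL (λ x → φ x + ψ x) xs ≡ sumL φ xs + sumL ψ xs
  sumL-+ φ ψ []       = refl
  sumL-+ φ ψ (x ∷ xs) = trans (cong (_+_ (φ x + ψ x)) (sumL-+ φ ψ xs)) (interchange (φ x) (ψ x) _ _)

  sumL-* : ∀ c (φ : A → ℤ) xs → sumL (λ x → c * φ x) xs ≡ c * sumL φ xs
  sumL-* c φ []       = sym (ℤP.*-zeroʳ c)
  sumL-* c φ (x ∷ xs) = trans (cong (_+_ (c * φ x)) (sumL-* c φ xs)) (sym (ℤP.*-distribˡ-+ c _ _))

  sumL-Σ : ∀ m (F : ℕ → A → ℤ) xs → sumL (λ x → Σ< m (λ i → F i x)) xs ≡ Σ< m (λ i → sumL (F i) xs)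
  sumL-Σ zero    F xs = sumL-0 xs
    where
    sumL-0 : ∀ xs → sumL (λ (_ : A) → + 0) xs ≡ + 0
    sumL-0 []       = refl
    sumL-0 (x ∷ xs) = trans (ℤP.+-identityˡ _) (sumL-0 xs)
  sumL-Σ (suc m) F xs = trans (sumL-+ (F 0) (λ x → Σ< m (λ i → F (suc i) x)) xs) (cong (_+_ (sumL (F 0) xs)) (sumL-Σ m (F ∘ suc) xs))

ind : {P : Set} → Dec P → ℤ
ind (yes _) = + 1
ind (no  _) = + 0

ind-yes : {P : Set} (d : Dec P) → P → ind d ≡ + 1
ind-yes (yes _) p = refl
ind-yes (no ¬p) p = ⊥-elim (¬p p)

ind-no : {P : Set} (d : Dec P) → ¬ P → ind d ≡ + 0
ind-no (yes p) ¬p = ⊥-elim (¬p p)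
ind-no (no _)  ¬p = refl

ind-iff : {P Q : Set} (d : Dec P) (e : Dec Q) → (P → Q) → (Q → P) → ind d ≡ ind e
ind-iff (yes p) e f g = sym (ind-yes e (f p))
ind-iff (no ¬p) e f g = sym (ind-no e (¬p ∘ g))

length-filter : ∀ {A : Set} {P : A → Set} (P? : Decidable P) xs → + length (filter P? xs) ≡ sumL (λ x → ind (P? x)) xs
length-filter P? []       = refl
length-filter P? (x ∷ xs) with P? x
... | yes _ = cong (_+_ (+ 1)) (length-filter P? xs)
... | no  _ = trans (length-filter P? xs) (sym (ℤP.+-identityˡ _))

sh-∸ : ∀ c f n → c ℕ.≤ n → sh c f n ≡ f (n ∸ c)
sh-∸ c f n c≤n = trans (cong (sh c f) (sym (ℕP.m+[n∸m]≡n c≤n))) (sh-at c f (n ∸ c))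

sel : {P : Set} → Dec P → ℤ → ℤ
sel (yes _) z = z
sel (no  _) z = + 0

sumL-filter : ∀ {A : Set} {P : A → Set} (P? : Decidable P) (φ : A → ℤ) xs → sumL φ (filter P? xs) ≡ sumL (λ x → sel (P? x) (φ x)) xs
sumL-filter P? φ []       = refl
sumL-filter P? φ (x ∷ xs) with P? x
... | yes _ = cong (_+_ (φ x)) (sumL-filter P? φ xs)
... | no  _ = trans (sumL-filter P? φ xs) (sym (ℤP.+-identityˡ _))

sumL-applyUpTo : ∀ (φ : ℕ → ℤ) m (f : ℕ → ℕ) → sumL φ (applyUpTo f m) ≡ Σ< m (φ ∘ f)
sumL-applyUpTo φ zero    f = refl
sumL-applyUpTo φ (suc m) f = cong (_+_ (φ (f 0))) (sumL-applyUpTo φ m (f ∘ suc))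

sel-sh : ∀ c f n (d : Dec (c ℕ.≤ n)) → sel d (f (n ∸ c)) ≡ sh c f n
sel-sh c f n (yes h) = sym (sh-∸ c f n h)
sel-sh c f n (no ¬h) = sym (sh-< c f n (ℕP.≰⇒> ¬h))

sumL-filter-upTo : ∀ c (F : ℕ → Series) n m →
  sumL (λ j → F j (n ∸ j ℕ.* c)) (filter (λ j → j ℕ.* c ℕ.≤? n) (upTo m)) ≡ Σ< m (λ i → sh (i ℕ.* c) (F i) n)
sumL-filter-upTo c F n m = trans (sumL-filter (λ j → j ℕ.* c ℕ.≤? n) (λ j → F j (n ∸ j ℕ.* c)) (upTo m))
  (trans (sumL-applyUpTo (λ j → sel (j ℕ.* c ℕ.≤? n) (F j (n ∸ j ℕ.* c))) m id)
         (Σ<-cong′ m (λ j → sel-sh (j ℕ.* c) (F j) n (j ℕ.* c ℕ.≤? n))))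

isYes-true : {P : Set} (d : Dec P) → P → ⌊ d ⌋ ≡ true
isYes-true (yes _) p = refl
isYes-true (no ¬p) p = ⊥-elim (¬p p)

isYes-false : {P : Set} (d : Dec P) → ¬ P → ⌊ d ⌋ ≡ false
isYes-false (yes p) ¬p = ⊥-elim (¬p p)
isYes-false (no _)  ¬p = refl

E : ℕ → (List ℕ → ℤ) → Series
E k φ n = sumL φ (partitionsLE k n)

-- The lists are generated by the multiplicity of `suc k`; this recursion takes off one copy at a
-- time. A statistic on partitions is then understood through its behaviour under adding a largest
-- part.
E-rec : ∀ k φ n → E (suc k) φ n ≡ E k φ n + sh (suc k) (E (suc k) (λ r → φ (suc k ∷ r))) n
E-rec k φ n = trans (unfold φ n) (trans (geometric-rec k (F φ) n)
  (cong (_+_ (E k φ n)) (sh-cong (suc k) (λ i → sym (unfold (λ r → φ (suc k ∷ r)) i)) n)))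
  where
  F : (List ℕ → ℤ) → ℕ → Series
  F φ j = E k (λ r → φ (replicate j (suc k) ++ r))
  unfold : ∀ φ n → E (suc k) φ n ≡ geometric (suc k) (F φ) n
  unfold φ n = trans (sumL-concatMap φ (λ j → map (λ rest → replicate j (suc k) ++ rest) (partitionsLE k (n ∸ j ℕ.* suc k))) js)
    (trans (sumL-cong (λ j → sumL-map φ (λ rest → replicate j (suc k) ++ rest) (partitionsLE k (n ∸ j ℕ.* suc k))) js)
           (sumL-filter-upTo (suc k) (F φ) n (suc n)))
    where js = filter (λ j → j ℕ.* suc k ℕ.≤? n) (upTo (suc n))

-- Two facts about listed partitions, the bound on parts and the sum, replace membership in the
-- list. For fixed `k` the induction is on `n`, with `φ` and `ψ` general because each removal of a
-- part changes them.
E-cong : ∀ k n {φ ψ : List ℕ → ℤ} → (∀ r → All (ℕ._≤ k) r → sum r ≡ n → φ r ≡ ψ r) → E k φ n ≡ E k ψ n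
E-cong zero    zero    h = cong (λ z → z + + 0) (h [] [] refl)
E-cong zero    (suc n) h = refl
E-cong (suc k) n {φ} {ψ} h = <-rec (λ n → ∀ φ ψ → (∀ r → All (ℕ._≤ suc k) r → sum r ≡ n → φ r ≡ ψ r) → E (suc k) φ n ≡ E (suc k) ψ n) step n φ ψ h
  where
  step : ∀ n → (∀ {i} → i ℕ.< n → ∀ φ ψ → (∀ r → All (ℕ._≤ suc k) r → sum r ≡ i → φ r ≡ ψ r) → E (suc k) φ i ≡ E (suc k) ψ i) →
    ∀ φ ψ → (∀ r → All (ℕ._≤ suc k) r → sum r ≡ n → φ r ≡ ψ r) → E (suc k) φ n ≡ E (suc k) ψ n
  step n ih φ ψ h = trans (E-rec k φ n) (trans (cong₂ _+_ (E-cong k n (λ r r≤k e → h r (All.map ℕP.m≤n⇒m≤1+n r≤k) e))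
    (sh-cong-at (suc k) n (λ i e → ih (ℕP.≤-trans (s≤s (ℕP.m≤n+m i k)) (ℕP.≤-reflexive e)) (λ r → φ (suc k ∷ r)) (λ r → ψ (suc k ∷ r))
      (λ r r≤ e′ → h (suc k ∷ r) (ℕP.≤-refl ∷ r≤) (trans (cong (ℕ._+_ (suc k)) e′) e))))) (sym (E-rec k ψ n)))

E-0 : ∀ k n {φ : List ℕ → ℤ} → (∀ r → All (ℕ._≤ k) r → sum r ≡ n → φ r ≡ + 0) → E k φ n ≡ + 0
E-0 k n h = trans (E-cong k n h) (sumL-* (+ 0) (λ _ → + 0) (partitionsLE k n))

E-stable : ∀ d φ n → E (n ℕ.+ d) φ n ≡ E n φ n
E-stable zero    φ n = cong (λ k → E k φ n) (ℕP.+-identityʳ n)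
E-stable (suc d) φ n = trans (cong (λ k → E k φ n) (ℕP.+-suc n d)) (trans (E-rec (n ℕ.+ d) φ n)
  (trans (cong (_+_ (E (n ℕ.+ d) φ n)) (sh-< (suc (n ℕ.+ d)) (E (suc (n ℕ.+ d)) (λ r → φ (suc (n ℕ.+ d) ∷ r))) n (s≤s (ℕP.m≤m+n n d)))) (trans (ℤP.+-identityʳ _) (E-stable d φ n))))

E-stable≤ : ∀ k φ n → n ℕ.≤ k → E k φ n ≡ E n φ n
E-stable≤ k φ n n≤k = trans (cong (λ k → E k φ n) (sym (ℕP.m+[n∸m]≡n n≤k))) (E-stable (k ∸ n) φ n)

p : ℕ → Series
p k = E k (λ _ → + 1)

p-rec : ∀ k n → p (suc k) n ≡ p k n + sh (suc k) (p (suc k)) n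
p-rec k n = E-rec k (λ _ → + 1) n

p-0 : ∀ n → p 0 n ≡ δ n
p-0 zero    = refl
p-0 (suc n) = refl

-- 1 / (q;q)_∞
P : Series
P n = p n n

distinct : List ℕ → ℤ
distinct r = ind (distinctParts r 𝔹.≟ true)

distinctLE : ℕ → Series
distinctLE k = E k distinct

+D : ∀ n → + D n ≡ distinctLE n n
+D n = length-filter (λ r → distinctParts r 𝔹.≟ true) (partitions n)

distinctLE-rec : ∀ k n → distinctLE (suc k) n ≡ distinctLE k n + sh (suc k) (distinctLE k) n
distinctLE-rec k n = trans (E-rec k distinct n) (cong (_+_ (distinctLE k n)) (sh-cong (suc k) inner n))
  where
  repeated : ∀ r → distinct (suc k ∷ suc k ∷ r) ≡ + 0
  repeated r = cong (λ b → ind ((b ∧ distinctParts (suc k ∷ r)) 𝔹.≟ true)) (isYes-false (suc (suc k) ℕ.≤? suc k) (ℕP.<-irrefl refl))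
  smaller : ∀ r → All (ℕ._≤ k) r → distinct (suc k ∷ r) ≡ distinct r
  smaller []       _        = refl
  smaller (b ∷ r) (b≤k ∷ _) = cong (λ c → ind ((c ∧ distinctParts (b ∷ r)) 𝔹.≟ true)) (isYes-true (suc b ℕ.≤? suc k) (s≤s b≤k))
  inner : ∀ i → E (suc k) (λ r → distinct (suc k ∷ r)) i ≡ distinctLE k i
  inner i = trans (E-rec k (λ r → distinct (suc k ∷ r)) i)
    (trans (cong₂ _+_ (E-cong k i (λ r r≤k _ → smaller r r≤k))
      (sh-0 (suc k) i (λ j _ → E-0 (suc k) j (λ r _ _ → repeated r)))) (ℤP.+-identityʳ _))

-- Cauchy products

conv : Series → Series → Series
conv f g n = Σ< (suc n) (λ i → f i * g (n ∸ i))

conv-cong≤ : ∀ {f f′ g g′ : Series} n → (∀ i → i ℕ.≤ n → f i ≡ f′ i) → (∀ i → i ℕ.≤ n → g i ≡ g′ i) → conv f g n ≡ conv f′ g′ n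
conv-cong≤ n hf hg = Σ<-cong (suc n) (λ i i<n → cong₂ _*_ (hf i (ℕP.≤-pred i<n)) (hg (n ∸ i) (ℕP.m∸n≤m n i)))

conv-+ˡ : ∀ f g h n → conv (λ i → f i + g i) h n ≡ conv f h n + conv g h n
conv-+ˡ f g h n = trans (Σ<-cong′ (suc n) (λ i → ℤP.*-distribʳ-+ (h (n ∸ i)) (f i) (g i)))
  (Σ<-+ (suc n) (λ i → f i * h (n ∸ i)) (λ i → g i * h (n ∸ i)))

conv-+ʳ : ∀ f g h n → conv f (λ i → g i + h i) n ≡ conv f g n + conv f h n
conv-+ʳ f g h n = trans (Σ<-cong′ (suc n) (λ i → ℤP.*-distribˡ-+ (f i) (g (n ∸ i)) (h (n ∸ i))))
  (Σ<-+ (suc n) (λ i → f i * g (n ∸ i)) (λ i → f i * h (n ∸ i)))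

conv--ʳ : ∀ f g h n → conv f (λ i → g i - h i) n ≡ conv f g n - conv f h n
conv--ʳ f g h n = trans (Σ<-cong′ (suc n) (λ i → alg (f i) (g (n ∸ i)) (h (n ∸ i))))
  (Σ<-- (suc n) (λ i → f i * g (n ∸ i)) (λ i → f i * h (n ∸ i)))
  where
  alg : ∀ a b c → a * (b - c) ≡ a * b - a * c
  alg = solve-∀

conv-shˡ : ∀ k f g n → conv (sh k f) g n ≡ sh k (conv f g) n
conv-shˡ zero    f g n       = refl
conv-shˡ (suc k) f g zero    = refl
conv-shˡ (suc k) f g (suc n) = trans (ℤP.+-identityˡ _) (conv-shˡ k f g n)

conv-shʳ : ∀ k f g n → conv f (sh k g) n ≡ sh k (conv f g) n
conv-shʳ zero    f g n       = refl
conv-shʳ (suc k) f g zero    = trans (ℤP.+-identityʳ _) (ℤP.*-zeroʳ (f 0))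
conv-shʳ (suc k) f g (suc n) = trans (Σ<-snoc (suc n) (λ i → f i * sh (suc k) g (suc n ∸ i)))
  (trans (cong₂ _+_
    (trans (Σ<-cong (suc n) (λ i i<n → cong (λ m → f i * sh (suc k) g m) (ℕP.+-∸-assoc 1 (ℕP.≤-pred i<n)))) (conv-shʳ k f g n))
    (trans (cong (λ m → f (suc n) * sh (suc k) g m) (ℕP.n∸n≡0 n)) (ℤP.*-zeroʳ (f (suc n))))) (ℤP.+-identityʳ _))

conv-δ : ∀ n → conv δ δ n ≡ δ n
conv-δ zero    = refl
conv-δ (suc n) = trans (ℤP.+-identityˡ _) (Σ<-0 (suc n) (λ i _ → refl))

distinct*p≡overSeries : ∀ k n → conv (distinctLE k) (p k) n ≡ overSeries k n
distinct*p≡overSeries zero n = trans (conv-cong≤ n (λ i _ → d₀ i) (λ i _ → p-0 i)) (conv-δ n)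
  where
  d₀ : ∀ i → distinctLE 0 i ≡ δ i
  d₀ zero    = refl
  d₀ (suc i) = refl
distinct*p≡overSeries (suc k) n = inv-unique k (λ n → overSeries k n + sh (suc k) (overSeries k) n) {conv d′ (p (suc k))} (λ n →
  trans (conv-cong≤ {d′} {d′} n (λ _ _ → refl) (λ i _ → p-rec k i))
  (trans (conv-+ʳ d′ (p k) (sh (suc k) (p (suc k))) n)
    (cong₂ _+_ (trans (conv-cong≤ {g = p k} {g′ = p k} n (λ i _ → distinctLE-rec k i) (λ _ _ → refl))
        (trans (conv-+ˡ d (sh (suc k) d) (p k) n) (cong₂ _+_ (distinct*p≡overSeries k n)
          (trans (conv-shˡ (suc k) d (p k) n) (sh-cong (suc k) (distinct*p≡overSeries k) n)))))
      (conv-shʳ (suc k) d′ (p (suc k)) n)))) n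
  where
  d = distinctLE k
  d′ = distinctLE (suc k)

Dₛ : Series
Dₛ k = + D k

-- (−q;q)_∞ / (q;q)_∞
P̄ : Series
P̄ n = overSeries n n

Dₛ*P : ∀ n → conv Dₛ P n ≡ P̄ n
Dₛ*P n = trans (conv-cong≤ {Dₛ} {distinctLE n} {P} {p n} n
    (λ i i≤n → trans (+D i) (sym (E-stable≤ n distinct i i≤n))) (λ i i≤n → sym (E-stable≤ n (λ _ → + 1) i i≤n)))
  (distinct*p≡overSeries n n)

-- Durfee rectangles

U : ℕ → ℕ → Series
U w zero    = p w
U w (suc t) = inv (suc t) (U w t)

-- `U w t` is `1 / ((q;q)_w (q;q)_t)`. It is built by dividing in the second index; this is the
-- matching recursion in the first.
U-rec₁ : ∀ w t n → U (suc w) t n ≡ U w t n + sh (suc w) (U (suc w) t) n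
U-rec₁ w zero    n = p-rec w n
U-rec₁ w (suc t) n = trans (inv-cong (suc t) (U-rec₁ w t) n)
  (trans (inv-+ (suc t) (U w t) (sh (suc w) (U (suc w) t)) n) (cong (_+_ (U w (suc t) n)) (inv-sh t (suc w) (U (suc w) t) n)))

U-rec₂ : ∀ w t n → U w (suc t) n ≡ U w t n + sh (suc t) (U w (suc t)) n
U-rec₂ w t n = inv-rec t (U w t) n

U-0 : ∀ t n → U 0 t n ≡ p t n
U-0 zero    n = refl
U-0 (suc t) n = trans (inv-cong (suc t) (U-0 t) n) (sym (inv-unique t (p t) (p-rec t) n))

-- V a m is Σ_w q^(w(w+m+a)) / ((q)_w (q)_{w+m}), truncated at w ≤ b.
module Durfee (b : ℕ) where

  term : ℕ → ℕ → ℕ → Series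
  term a m w = sh (w ℕ.* (w ℕ.+ m ℕ.+ a)) (U w (w ℕ.+ m))

  V : ℕ → ℕ → Series
  V a m n = Σ< (suc b) (λ w → term a m w n)

  -- Each term splits by `1/(q;q)_(w+1) = 1/(q;q)_w +
  -- q^(w+1)/(q;q)_(w+1)`. The second part raises `a`; the first is the term `w` of `V (suc a) (suc
  -- m)` times `q^(m+a+1)`. Lowering `w` leaves one surplus term at `w =
  -- b`, whose exponent exceeds `n`.
  V-rec₁ : ∀ a m n → n ℕ.≤ b → V a m n ≡ V (suc a) m n + sh (suc (m ℕ.+ a)) (V (suc a) (suc m)) n
  V-rec₁ a m n n≤b = trans (cong (_+_ (term a m 0 n)) (trans (Σ<-cong′ b step) (Σ<-+ b (λ w → term (suc a) m (suc w) n) shifted)))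
    (trans (sym (ℤP.+-assoc (term a m 0 n) (Σ< b (λ w → term (suc a) m (suc w) n)) (Σ< b shifted)))
    (cong (_+_ (V (suc a) m n)) (sym (trans (sh-Σ (suc (m ℕ.+ a)) (suc b) (term (suc a) (suc m)) n)
      (trans (Σ<-snoc b shifted) (trans (cong (_+_ (Σ< b shifted)) last) (ℤP.+-identityʳ _)))))))
    where
    shifted : ℕ → ℤ
    shifted w = sh (suc (m ℕ.+ a)) (term (suc a) (suc m) w) n
    exp₁ : ∀ w m a → suc w ℕ.* (suc w ℕ.+ m ℕ.+ a) ≡ suc (m ℕ.+ a) ℕ.+ w ℕ.* (w ℕ.+ suc m ℕ.+ suc a)
    exp₁ = ℕR.solve-∀
    exp₂ : ∀ w m a → suc w ℕ.* (suc w ℕ.+ m ℕ.+ a) ℕ.+ suc w ≡ suc w ℕ.* (suc w ℕ.+ m ℕ.+ suc a)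
    exp₂ = ℕR.solve-∀
    step : ∀ w → term a m (suc w) n ≡ term (suc a) m (suc w) n + shifted w
    step w = trans (sh-cong e (U-rec₁ w (suc w ℕ.+ m)) n)
      (trans (sh-+ e (U w (suc w ℕ.+ m)) (sh (suc w) (U (suc w) (suc w ℕ.+ m))) n)
      (trans (ℤP.+-comm (sh e (U w (suc w ℕ.+ m)) n) (sh e (sh (suc w) (U (suc w) (suc w ℕ.+ m))) n))
      (cong₂ _+_ (trans (sh-sh e (suc w) (U (suc w) (suc w ℕ.+ m)) n) (cong (λ e → sh e (U (suc w) (suc w ℕ.+ m)) n) (exp₂ w m a)))
        (trans (cong₂ (λ e t → sh e (U w t) n) (exp₁ w m a) (sym (ℕP.+-suc w m)))
          (sym (sh-sh (suc (m ℕ.+ a)) (w ℕ.* (w ℕ.+ suc m ℕ.+ suc a)) (U w (w ℕ.+ suc m)) n))))))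
      where e = suc w ℕ.* (suc w ℕ.+ m ℕ.+ a)
    last : shifted b ≡ + 0
    last = trans (sh-sh (suc (m ℕ.+ a)) (b ℕ.* (b ℕ.+ suc m ℕ.+ suc a)) (U b (b ℕ.+ suc m)) n)
      (sh-< (suc (m ℕ.+ a) ℕ.+ b ℕ.* (b ℕ.+ suc m ℕ.+ suc a)) (U b (b ℕ.+ suc m)) n
        (s≤s (ℕP.≤-trans n≤b (ℕP.≤-trans big (ℕP.m≤n+m (b ℕ.* (b ℕ.+ suc m ℕ.+ suc a)) (m ℕ.+ a))))))
      where
      big : b ℕ.≤ b ℕ.* (b ℕ.+ suc m ℕ.+ suc a)
      big = subst (b ℕ.≤_) (cong (b ℕ.*_) (sym (ℕP.+-suc (b ℕ.+ suc m) a))) (ℕP.m≤m*n b (suc (b ℕ.+ suc m ℕ.+ a)))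

  -- The same splitting of the factor `1/(q;q)_(w+m+1)`. At `a = 0` the right-hand side is that of
  -- `V-rec₁`, so `V 0 (suc m)` and `V 0 m` agree.
  V-rec₂ : ∀ a m n → V a (suc m) n ≡ V (suc a) m n + sh (suc m) (V (suc a) (suc m)) n
  V-rec₂ a m n = trans (Σ<-cong′ (suc b) step) (trans (Σ<-+ (suc b) (λ w → term (suc a) m w n) shifted)
    (cong (_+_ (V (suc a) m n)) (sym (sh-Σ (suc m) (suc b) (term (suc a) (suc m)) n))))
    where
    shifted : ℕ → ℤ
    shifted w = sh (suc m) (term (suc a) (suc m) w) n
    exp₁ : ∀ w m a → w ℕ.* (w ℕ.+ suc m ℕ.+ a) ≡ w ℕ.* (w ℕ.+ m ℕ.+ suc a)
    exp₁ = ℕR.solve-∀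
    exp₂ : ∀ w m a → w ℕ.* (w ℕ.+ suc m ℕ.+ a) ℕ.+ suc (w ℕ.+ m) ≡ suc m ℕ.+ w ℕ.* (w ℕ.+ suc m ℕ.+ suc a)
    exp₂ = ℕR.solve-∀
    step : ∀ w → term a (suc m) w n ≡ term (suc a) m w n + shifted w
    step w = trans (cong (λ t → sh e (U w t) n) (ℕP.+-suc w m))
      (trans (sh-cong e (U-rec₂ w (w ℕ.+ m)) n)
      (trans (sh-+ e (U w (w ℕ.+ m)) (sh (suc (w ℕ.+ m)) (U w (suc (w ℕ.+ m)))) n)
      (cong₂ _+_ (cong (λ e → sh e (U w (w ℕ.+ m)) n) (exp₁ w m a))
        (trans (sh-sh e (suc (w ℕ.+ m)) (U w (suc (w ℕ.+ m))) n)
        (trans (cong₂ (λ e t → sh e (U w t) n) (exp₂ w m a) (sym (ℕP.+-suc w m)))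
          (sym (sh-sh (suc m) (w ℕ.* (w ℕ.+ suc m ℕ.+ suc a)) (U w (w ℕ.+ suc m)) n)))))))
      where e = w ℕ.* (w ℕ.+ suc m ℕ.+ a)

  -- Durfee rectangles: V 0 m does not depend on m, and only its term w = 0 survives for m > n.
  V₀≡P : ∀ m n → n ℕ.≤ b → V 0 m n ≡ P n
  V₀≡P m n n≤b = trans (up (suc n)) (trans (cong₂ _+_ first (Σ<-0 b (λ w _ → rest w))) (ℤP.+-identityʳ (P n)))
    where
    step : ∀ m → V 0 m n ≡ V 0 (suc m) n
    step m = trans (V-rec₁ 0 m n n≤b) (trans (cong (λ k → V 1 m n + sh (suc k) (V 1 (suc m)) n) (ℕP.+-identityʳ m)) (sym (V-rec₂ 0 m n)))
    up : ∀ d → V 0 m n ≡ V 0 (d ℕ.+ m) n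
    up zero    = refl
    up (suc d) = trans (up d) (step (d ℕ.+ m))
    first : U 0 (suc n ℕ.+ m) n ≡ P n
    first = trans (U-0 (suc n ℕ.+ m) n) (E-stable≤ (suc n ℕ.+ m) (λ _ → + 1) n (ℕP.≤-trans (ℕP.n≤1+n n) (ℕP.m≤m+n (suc n) m)))
    rest : ∀ w → term 0 (suc n ℕ.+ m) (suc w) n ≡ + 0
    rest w = sh-< (suc w ℕ.* (suc w ℕ.+ (suc n ℕ.+ m) ℕ.+ 0)) (U (suc w) (suc w ℕ.+ (suc n ℕ.+ m))) n
      (ℕP.≤-trans (ℕP.≤-trans (ℕP.m≤m+n (suc n) m) (ℕP.≤-trans (ℕP.m≤n+m (suc n ℕ.+ m) (suc w)) (ℕP.m≤m+n (suc w ℕ.+ (suc n ℕ.+ m)) 0)))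
        (ℕP.m≤n*m (suc w ℕ.+ (suc n ℕ.+ m) ℕ.+ 0) (suc w)))

  -- generating functions of the partitions with crank ≥ m and crank = m
  X C : ℕ → Series
  X m = sh m (V 1 m)
  C m = sh m (λ i → V 2 m i - sh 1 (V 2 m) i)

  -- `V-rec₁` at `a = 0` with `V 0 m = P` reads `V 1 m = P − q^(m+1) V 1 (m+1)`, and the subtracted
  -- series is `X (suc m)`.
  X-rec : ∀ m n → n ℕ.≤ b → X m n ≡ sh m (λ i → P i - X (suc m) i) n
  X-rec m n n≤b = sh-cong≤ m n (λ i i≤n → trans (alg (V 1 m i) (X (suc m) i))
    (cong (λ z → z - X (suc m) i) (trans (trans (cong (λ k → V 1 m i + sh (suc k) (V 1 (suc m)) i) (sym (ℕP.+-identityʳ m)))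
      (sym (V-rec₁ 0 m i (ℕP.≤-trans i≤n n≤b)))) (V₀≡P m i (ℕP.≤-trans i≤n n≤b)))))
    where
    alg : ∀ a x → a ≡ a + x - x
    alg = solve-∀

  -- Expanding `V 1 m` by `V-rec₁` and `q V 1 (m+1)` by `V-rec₂` produces the same term
  -- `q^(m+2) V 2 (m+1)`, which cancels.
  X-diff : ∀ m n → n ℕ.≤ b → X m n - X (suc m) n ≡ C m n
  X-diff m n n≤b = trans (cong (λ z → X m n - z) (trans (cong (λ k → sh k (V 1 (suc m)) n) (ℕP.+-comm 1 m)) (sym (sh-sh m 1 (V 1 (suc m)) n))))
    (trans (sym (sh-- m (V 1 m) (sh 1 (V 1 (suc m))) n)) (sh-cong≤ m n (λ i i≤n → inner i (ℕP.≤-trans i≤n n≤b))))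
    where
    alg : ∀ a b c → (a + c) - (b + c) ≡ a - b
    alg = solve-∀
    inner : ∀ i → i ℕ.≤ b → V 1 m i - sh 1 (V 1 (suc m)) i ≡ V 2 m i - sh 1 (V 2 m) i
    inner i i≤b = trans (cong₂ _-_ (V-rec₁ 1 m i i≤b)
      (trans (sh-cong 1 (V-rec₂ 1 m) i) (trans (sh-+ 1 (V 2 m) (sh (suc m) (V 2 (suc m))) i)
        (cong (_+_ (sh 1 (V 2 m) i)) (trans (sh-sh 1 (suc m) (V 2 (suc m)) i) (cong (λ k → sh (suc k) (V 2 (suc m)) i) (ℕP.+-comm 1 m)))))))
      (alg (V 2 m i) (sh 1 (V 2 m) i) (sh (suc (m ℕ.+ 1)) (V 2 (suc m)) i))

-- Counting partitions by crank

Σ<-single : ∀ b w (f : ℕ → ℤ) → w ℕ.< b → (∀ i → ¬ i ≡ w → f i ≡ + 0) → Σ< b f ≡ f w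
Σ<-single (suc b) zero    f _         h = trans (cong (_+_ (f 0)) (Σ<-0 b (λ i _ → h (suc i) (λ ())))) (ℤP.+-identityʳ (f 0))
Σ<-single (suc b) (suc w) f (s≤s w<b) h = trans (cong₂ _+_ (h 0 (λ ())) (Σ<-single b w (f ∘ suc) w<b (λ i i≢ → h (suc i) (i≢ ∘ ℕP.suc-injective)))) (ℤP.+-identityˡ _)

-- multiplication by 1 − q
∇ : Series → Series
∇ f n = f n - sh 1 f n

∇-+ : ∀ f g n → ∇ (λ i → f i + g i) n ≡ ∇ f n + ∇ g n
∇-+ f g n = trans (cong (λ z → f n + g n - z) (sh-+ 1 f g n)) (alg (f n) (g n) (sh 1 f n) (sh 1 g n))
  where
  alg : ∀ a b c d → a + b - (c + d) ≡ (a - c) + (b - d)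
  alg = solve-∀

∇-sh : ∀ k f n → ∇ (sh k f) n ≡ sh k (∇ f) n
∇-sh k f n = trans (cong (λ z → sh k f n - z) (sh-comm 1 k f n)) (sym (sh-- k f (sh 1 f) n))

∇-cong : ∀ {f g} → (∀ n → f n ≡ g n) → ∀ n → ∇ f n ≡ ∇ g n
∇-cong h n = cong₂ _-_ (h n) (sh-cong 1 h n)

-- The threshold is v + 1 because a crank with v + 1 ones counts the parts exceeding v + 1.
above : ℕ → List ℕ → ℕ
above v r = length (filter (λ a → suc (suc v) ℕ.≤? a) r)

ones≤sum : ∀ r → ones r ℕ.≤ sum r
ones≤sum []      = z≤n
ones≤sum (zero ∷ r) = ones≤sum r
ones≤sum (suc zero ∷ r) = s≤s (ones≤sum r)
ones≤sum (suc (suc a) ∷ r) = ℕP.≤-trans (ones≤sum r) (ℕP.m≤n+m (sum r) (suc (suc a)))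

above-accept : ∀ v a r → suc (suc v) ℕ.≤ a → above v (a ∷ r) ≡ suc (above v r)
above-accept v a r h = cong length (filter-accept (λ a → suc (suc v) ℕ.≤? a) h)

above-0 : ∀ v r → All (ℕ._≤ suc v) r → above v r ≡ 0
above-0 v []      []         = refl
above-0 v (a ∷ r) (h ∷ hs) = trans (cong length (filter-reject (λ a → suc (suc v) ℕ.≤? a) {a} {r} (λ h′ → ℕP.<-irrefl refl (ℕP.≤-trans h′ h)))) (above-0 v r hs)

hasOnes : ℕ → List ℕ → ℤ
hasOnes v r = ind (ones r ℕ.≟ v)

-- Prescribing `v` ones replaces the factor `1 / (1 − q)` by `q^v`.
ones-series : ∀ k v i → E (suc k) (hasOnes v) i ≡ sh v (∇ (p (suc k))) i
ones-series zero v i = go v i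
  where
  ∇-p₁ : ∀ i → ∇ (p 1) i ≡ E 0 (λ _ → + 1) i
  ∇-p₁ i = trans (cong (λ z → z - sh 1 (p 1) i) (p-rec 0 i)) (alg (p 0 i) (sh 1 (p 1) i))
    where
    alg : ∀ a b → a + b - b ≡ a
    alg = solve-∀
  go : ∀ v i → E 1 (hasOnes v) i ≡ sh v (∇ (p 1)) i
  go zero i = trans (E-rec 0 (hasOnes 0) i) (trans (cong₂ _+_ (base i) (sh-0 1 i (λ j _ → E-0 1 j (λ r _ _ → ind-no (suc (ones r) ℕ.≟ 0) (λ ())))))
      (trans (ℤP.+-identityʳ (p 0 i)) (sym (∇-p₁ i))))
    where
    base : ∀ i → E 0 (hasOnes 0) i ≡ p 0 i
    base zero    = refl
    base (suc i) = refl
  go (suc v) i = trans (E-rec 0 (hasOnes (suc v)) i) (trans (cong₂ _+_ (base i)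
      (sh-cong 1 (λ j → trans (E-cong 1 j (λ r _ _ → ind-iff (suc (ones r) ℕ.≟ suc v) (ones r ℕ.≟ v) ℕP.suc-injective (cong suc))) (go v j)) i))
      (trans (ℤP.+-identityˡ _) (sh-sh 1 v (∇ (p 1)) i)))
    where
    base : ∀ i → E 0 (hasOnes (suc v)) i ≡ + 0
    base zero    = refl
    base (suc i) = refl
ones-series (suc k) v = geometric-unique (suc k) (E (suc k) (hasOnes v)) (E-rec (suc k) (hasOnes v))
  (λ n → trans (sh-cong v (λ i → trans (∇-cong (p-rec (suc k)) i) (∇-+ (p (suc k)) (sh (suc (suc k)) (p (suc (suc k)))) i)) n)
    (trans (sh-+ v (∇ (p (suc k))) (∇ (sh (suc (suc k)) (p (suc (suc k))))) n)
    (cong₂ _+_ (sym (ones-series k v n)) (trans (sh-cong v (∇-sh (suc (suc k)) (p (suc (suc k)))) n) (sh-comm v (suc (suc k)) (∇ (p (suc (suc k)))) n)))))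

module Above (v : ℕ) where

  private W = suc v

  φ : ℕ → List ℕ → ℤ
  φ t r = hasOnes W r * ind (above v r ℕ.≟ t)

  -- The bound `W + d` on the parts gives a recursion in the largest admissible part, from which
  -- `R-column` follows by induction on `d`. For `d` at least the degree the bound has no effect,
  -- and `R-column` becomes a division by `1 − q^(t+1)`.
  R : ℕ → ℕ → Series
  R d t = E (W ℕ.+ d) (φ t)

  private
    φ-∷ : ∀ d t r → φ (suc t) (suc (W ℕ.+ d) ∷ r) ≡ φ t r
    φ-∷ d t r = cong (_*_ (hasOnes W r)) (trans (cong (λ x → ind (x ℕ.≟ suc t)) (above-accept v (suc (W ℕ.+ d)) r (s≤s (s≤s (ℕP.m≤m+n v d)))))
      (ind-iff (suc (above v r) ℕ.≟ suc t) (above v r ℕ.≟ t) ℕP.suc-injective (cong suc)))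

    φ-∷₀ : ∀ d r → φ 0 (suc (W ℕ.+ d) ∷ r) ≡ + 0
    φ-∷₀ d r = trans (cong (_*_ (hasOnes W r)) (trans (cong (λ x → ind (x ℕ.≟ 0)) (above-accept v (suc (W ℕ.+ d)) r (s≤s (s≤s (ℕP.m≤m+n v d)))))
      (ind-no (suc (above v r) ℕ.≟ 0) (λ ())))) (ℤP.*-zeroʳ (hasOnes W r))

    R-suc : ∀ d t i → R (suc d) t i ≡ E (suc (W ℕ.+ d)) (φ t) i
    R-suc d t i = cong (λ k → E k (φ t) i) (ℕP.+-suc W d)

    R-rec : ∀ d t i → R (suc d) (suc t) i ≡ R d (suc t) i + sh (suc (W ℕ.+ d)) (R (suc d) t) i
    R-rec d t i = trans (R-suc d (suc t) i) (trans (E-rec (W ℕ.+ d) (φ (suc t)) i) (cong (_+_ (R d (suc t) i))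
      (sh-cong (suc (W ℕ.+ d)) (λ j → trans (E-cong (suc (W ℕ.+ d)) j (λ r _ _ → φ-∷ d t r)) (sym (R-suc d t j))) i)))

    R-rec₀ : ∀ d i → R (suc d) 0 i ≡ R d 0 i
    R-rec₀ d i = trans (R-suc d 0 i) (trans (E-rec (W ℕ.+ d) (φ 0) i) (trans (cong (_+_ (R d 0 i))
      (sh-0 (suc (W ℕ.+ d)) i (λ j _ → E-0 (suc (W ℕ.+ d)) j (λ r _ _ → φ-∷₀ d r)))) (ℤP.+-identityʳ (R d 0 i))))

    below : ∀ r → All (ℕ._≤ W ℕ.+ 0) r → above v r ≡ 0
    below r h = above-0 v r (All.map (λ {a} → subst (a ℕ.≤_) (ℕP.+-identityʳ W)) h)

    R-0 : ∀ t i → R 0 (suc t) i ≡ + 0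
    R-0 t i = E-0 (W ℕ.+ 0) i (λ r h _ → trans (cong (λ x → hasOnes W r * ind (x ℕ.≟ suc t)) (below r h)) (ℤP.*-zeroʳ (hasOnes W r)))

    R-00 : ∀ d i → R d 0 i ≡ sh W (∇ (p W)) i
    R-00 zero i = trans (E-cong (W ℕ.+ 0) i (λ r h _ → trans (cong (λ x → hasOnes W r * ind (x ℕ.≟ 0)) (below r h)) (ℤP.*-identityʳ (hasOnes W r))))
      (trans (cong (λ k → E k (hasOnes W) i) (ℕP.+-identityʳ W)) (ones-series v W i))
    R-00 (suc d) i = trans (R-rec₀ d i) (R-00 d i)

    -- Either every counted part loses a box, or a smallest possible counted part W + 1 is removed.
    R-column : ∀ d t i → R (suc d) (suc t) i ≡ sh (suc t) (R d (suc t)) i + sh (suc W) (R (suc d) t) i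
    R-column zero t i = trans (R-rec 0 t i) (cong₂ _+_ (trans (R-0 t i) (sym (sh-0 (suc t) i (λ j _ → R-0 t j))))
      (cong (λ k → sh (suc k) (R 1 t) i) (ℕP.+-identityʳ W)))
    R-column (suc d) t i = trans (R-rec (suc d) t i) (trans (cong₂ _+_ (R-column d t i) (expand t))
      (trans (interchange (sh (suc t) (R d (suc t)) i) (sh (suc W) (R (suc d) t) i) (sh (suc t) (sh (suc (W ℕ.+ d)) (R (suc d) t)) i) (rest t))
        (cong₂ _+_ (trans (sym (sh-+ (suc t) (R d (suc t)) (sh (suc (W ℕ.+ d)) (R (suc d) t)) i)) (sh-cong (suc t) (λ j → sym (R-rec d t j)) i))
                   (collect t))))
      where
      rest : ℕ → ℤ
      rest zero    = + 0
      rest (suc t) = sh (suc (W ℕ.+ suc d)) (sh (suc W) (R (suc (suc d)) t)) i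
      swap : ∀ t → suc (W ℕ.+ suc d) ℕ.+ t ≡ suc t ℕ.+ suc (W ℕ.+ d)
      swap t = alg v d t
        where
        alg : ∀ v d t → suc (suc v ℕ.+ suc d) ℕ.+ t ≡ suc t ℕ.+ suc (suc v ℕ.+ d)
        alg = ℕR.solve-∀
      expand : ∀ t → sh (suc (W ℕ.+ suc d)) (R (suc (suc d)) t) i ≡ sh (suc t) (sh (suc (W ℕ.+ d)) (R (suc d) t)) i + rest t
      expand zero = trans (sh-cong (suc (W ℕ.+ suc d)) (R-rec₀ (suc d)) i)
        (trans (cong (λ e → sh (suc e) (R (suc d) 0) i) (ℕP.+-suc W d)) (trans (sym (sh-sh 1 (suc (W ℕ.+ d)) (R (suc d) 0) i)) (sym (ℤP.+-identityʳ _))))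
      expand (suc t) = trans (sh-cong (suc (W ℕ.+ suc d)) (R-column (suc d) t) i)
        (trans (sh-+ (suc (W ℕ.+ suc d)) (sh (suc t) (R (suc d) (suc t))) (sh (suc W) (R (suc (suc d)) t)) i)
        (cong (λ z → z + rest (suc t)) (trans (sh-sh (suc (W ℕ.+ suc d)) (suc t) (R (suc d) (suc t)) i)
          (trans (cong (λ e → sh e (R (suc d) (suc t)) i) (swap (suc t))) (sym (sh-sh (suc (suc t)) (suc (W ℕ.+ d)) (R (suc d) (suc t)) i))))))
      collect : ∀ t → sh (suc W) (R (suc d) t) i + rest t ≡ sh (suc W) (R (suc (suc d)) t) i
      collect zero = trans (ℤP.+-identityʳ _) (sh-cong (suc W) (λ j → sym (R-rec₀ (suc d) j)) i)
      collect (suc t) = trans (cong (_+_ (sh (suc W) (R (suc d) (suc t)) i)) (sh-comm (suc (W ℕ.+ suc d)) (suc W) (R (suc (suc d)) t) i))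
        (trans (sym (sh-+ (suc W) (R (suc d) (suc t)) (sh (suc (W ℕ.+ suc d)) (R (suc (suc d)) t)) i)) (sh-cong (suc W) (λ j → sym (R-rec (suc d) t j)) i))

  R∞ : ℕ → Series
  R∞ t i = E i (φ t) i

  private
    R≡R∞ : ∀ d t i → i ℕ.≤ d → R d t i ≡ R∞ t i
    R≡R∞ d t i i≤d = E-stable≤ (W ℕ.+ d) (φ t) i (ℕP.≤-trans i≤d (ℕP.m≤n+m d W))

    R∞-rec : ∀ t i → R∞ (suc t) i ≡ sh (suc W) (R∞ t) i + sh (suc t) (R∞ (suc t)) i
    R∞-rec t i = trans (sym (R≡R∞ (suc i) (suc t) i (ℕP.n≤1+n i))) (trans (R-column i t i)
      (trans (ℤP.+-comm (sh (suc t) (R i (suc t)) i) (sh (suc W) (R (suc i) t) i))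
        (cong₂ _+_ (sh-cong≤ (suc W) i (λ j j≤i → R≡R∞ (suc i) t j (ℕP.m≤n⇒m≤1+n j≤i))) (sh-cong≤ (suc t) i (λ j j≤i → R≡R∞ i (suc t) j j≤i)))))

  -- The parts up to `W`, among them `W` ones, contribute `q^W (1 − q) / (q;q)_W`; the `t` parts of
  -- size at least `W + 1` contribute `q^(t(W+1)) / (q;q)_t`.
  R∞-series : ∀ t i → R∞ t i ≡ sh (t ℕ.* suc W ℕ.+ W) (∇ (U W t)) i
  R∞-series zero    i = trans (sym (R≡R∞ i 0 i ℕP.≤-refl)) (R-00 i i)
  R∞-series (suc t) = geometric-unique t (sh (suc W) (R∞ t)) (R∞-rec t)
    (λ n → trans (sh-cong e (λ i → trans (∇-cong (U-rec₂ W t) i) (∇-+ (U W t) (sh (suc t) (U W (suc t))) i)) n)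
      (trans (sh-+ e (∇ (U W t)) (∇ (sh (suc t) (U W (suc t)))) n)
        (cong₂ _+_ (trans (cong (λ e → sh e (∇ (U W t)) n) (ℕP.+-assoc (suc W) (t ℕ.* suc W) W))
                     (trans (sym (sh-sh (suc W) (t ℕ.* suc W ℕ.+ W) (∇ (U W t)) n)) (sh-cong (suc W) (λ i → sym (R∞-series t i)) n)))
                   (trans (sh-cong e (∇-sh (suc t) (U W (suc t))) n) (sh-comm e (suc t) (∇ (U W (suc t))) n)))))
    where e = suc t ℕ.* suc W ℕ.+ W

noOnes : ℕ → List ℕ → ℤ
noOnes m r = hasOnes 0 r * ind (largest r ℕ.≟ m)

largest≤ : ∀ k r → All (ℕ._≤ k) r → largest r ℕ.≤ k
largest≤ k []      _       = z≤n
largest≤ k (a ∷ r) (h ∷ _) = h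

-- A largest part `m + 1` gives `q^(m+1) / (q;q)_(m+1)`, and the absence of ones the factor `1 − q`.
-- For `m = 0` the formula yields `q` although no such partition exists; this is the anomaly of the
-- crank numbers at `n = 1`.
noOnes-series : ∀ m n → ¬ n ≡ 1 → E n (noOnes (suc m)) n ≡ sh (suc m) (∇ (p (suc m))) n
noOnes-series zero n n≢1 = trans (E-0 n n (λ r _ _ → vanish r)) (sym (rhs n n≢1))
  where
  vanish : ∀ r → noOnes 1 r ≡ + 0
  vanish []               = refl
  vanish (zero ∷ r)       = ℤP.*-zeroʳ (hasOnes 0 (zero ∷ r))
  vanish (suc zero ∷ r)   = refl
  vanish (suc (suc a) ∷ r) = ℤP.*-zeroʳ (hasOnes 0 (suc (suc a) ∷ r))
  rhs : ∀ n → ¬ n ≡ 1 → sh 1 (∇ (p 1)) n ≡ + 0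
  rhs zero          _   = refl
  rhs (suc zero)    n≢1 = ⊥-elim (n≢1 refl)
  rhs (suc (suc n)) _   = trans (sym (ones-series 0 0 (suc n))) (trans (E-rec 0 (hasOnes 0) (suc n))
    (trans (ℤP.+-identityˡ _) (sh-0 1 (suc n) (λ j _ → E-0 1 j (λ r _ _ → ind-no (suc (ones r) ℕ.≟ 0) (λ ()))))))
noOnes-series (suc m) n _ = trans (sym (E-stable≤ (k ℕ.+ n) (noOnes k) n (ℕP.m≤n+m n k))) (up n)
  where
  k = suc (suc m)
  at : ∀ r → noOnes k (k ∷ r) ≡ hasOnes 0 r
  at r = trans (cong (_*_ (hasOnes 0 r)) (ind-yes (k ℕ.≟ k) refl)) (ℤP.*-identityʳ (hasOnes 0 r))
  above-k : ∀ d r → noOnes k (suc (k ℕ.+ d) ∷ r) ≡ + 0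
  above-k d r = trans (cong (_*_ (hasOnes 0 r)) (ind-no (suc (k ℕ.+ d) ℕ.≟ k) (λ e → ℕP.<-irrefl (sym e) (s≤s (ℕP.m≤m+n k d))))) (ℤP.*-zeroʳ (hasOnes 0 r))
  up : ∀ d → E (k ℕ.+ d) (noOnes k) n ≡ sh k (∇ (p k)) n
  up zero = trans (cong (λ k′ → E k′ (noOnes k) n) (ℕP.+-identityʳ k)) (trans (E-rec (suc m) (noOnes k) n)
    (trans (cong₂ _+_ (E-0 (suc m) n (λ r h _ → trans (cong (_*_ (hasOnes 0 r)) (ind-no (largest r ℕ.≟ k)
        (λ e → ℕP.<-irrefl refl (subst (ℕ._≤ suc m) e (largest≤ (suc m) r h))))) (ℤP.*-zeroʳ (hasOnes 0 r))))
      (sh-cong k (λ j → trans (E-cong k j (λ r _ _ → at r)) (ones-series (suc m) 0 j)) n)) (ℤP.+-identityˡ _)))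
  up (suc d) = trans (cong (λ k′ → E k′ (noOnes k) n) (ℕP.+-suc k d)) (trans (E-rec (k ℕ.+ d) (noOnes k) n)
    (trans (cong (_+_ (E (k ℕ.+ d) (noOnes k) n)) (sh-0 (suc (k ℕ.+ d)) n (λ j _ → E-0 (suc (k ℕ.+ d)) j (λ r _ _ → above-k d r))))
      (trans (ℤP.+-identityʳ _) (up d))))

crank-noOnes : ∀ r → ones r ≡ 0 → crank r ≡ + largest r
crank-noOnes r e with ones r
crank-noOnes r refl | zero = refl

crank-ones : ∀ r w → ones r ≡ suc w → crank r ≡ + above w r - + suc w
crank-ones r w e with ones r
crank-ones r w refl | suc w = refl

-- Classifies by the number of ones: with `w + 1` of them, crank `m` means `m + w + 1` parts
-- exceeding `w + 1`.
crank-split : ∀ m b r → ones r ℕ.≤ b →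
  ind (crank r ℤ.≟ + m) ≡ noOnes m r + Σ< b (λ w → Above.φ w (m ℕ.+ suc w) r)
crank-split m b r h = go (ones r) refl
  where
  go : ∀ o → ones r ≡ o → ind (crank r ℤ.≟ + m) ≡ noOnes m r + Σ< b (λ w → Above.φ w (m ℕ.+ suc w) r)
  go zero e = sym (trans (cong₂ _+_ (trans (cong (λ z → z * ind (largest r ℕ.≟ m)) (ind-yes (ones r ℕ.≟ 0) e)) (ℤP.*-identityˡ _))
      (Σ<-0 b (λ w _ → cong (λ z → z * ind (above w r ℕ.≟ m ℕ.+ suc w)) (ind-no (ones r ℕ.≟ suc w) (λ e′ → 0≢ (trans (sym e) e′))))))
    (trans (ℤP.+-identityʳ _) (ind-iff (largest r ℕ.≟ m) (crank r ℤ.≟ + m) (λ l → trans (crank-noOnes r e) (cong +_ l))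
      (λ c → ℤP.+-injective (trans (sym (crank-noOnes r e)) c)))))
    where
    0≢ : ∀ {w} → ¬ 0 ≡ suc w
    0≢ ()
  go (suc w) e = sym (trans (cong₂ _+_ (cong (λ z → z * ind (largest r ℕ.≟ m)) (ind-no (ones r ℕ.≟ 0) (λ e′ → suc≢ (trans (sym e) e′))))
      (Σ<-single b w (λ w → Above.φ w (m ℕ.+ suc w) r) (ℕP.≤-trans (ℕP.≤-reflexive (sym e)) h)
        (λ i i≢w → cong (λ z → z * ind (above i r ℕ.≟ m ℕ.+ suc i)) (ind-no (ones r ℕ.≟ suc i) (λ e′ → i≢w (ℕP.suc-injective (trans (sym e′) e)))))))
    (trans (ℤP.+-identityˡ _) (trans (cong (λ z → z * ind (above w r ℕ.≟ m ℕ.+ suc w)) (ind-yes (ones r ℕ.≟ suc w) e)) (trans (ℤP.*-identityˡ _)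
      (ind-iff (above w r ℕ.≟ m ℕ.+ suc w) (crank r ℤ.≟ + m)
        (λ a → trans (crank-ones r w e) (trans (cong (λ x → + x - + suc w) a) (alg₁ (+ m) (+ suc w))))
        (λ c → ℤP.+-injective (trans (alg₂ (+ above w r) (+ suc w)) (cong (λ z → z + + suc w) (trans (sym (crank-ones r w e)) c)))))))))
    where
    suc≢ : ¬ suc w ≡ 0
    suc≢ ()
    alg₁ : ∀ a b → a + b - b ≡ a
    alg₁ = solve-∀
    alg₂ : ∀ a b → a ≡ a - b + b
    alg₂ = solve-∀

module _ (b : ℕ) where
  open Durfee b

  C-sum : ∀ m n → C m n ≡ Σ< (suc b) (λ w → sh m (∇ (term 2 m w)) n)
  C-sum m n = trans (sh-cong m (λ i → trans (cong (λ z → V 2 m i - z) (sh-Σ 1 (suc b) (term 2 m) i))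
      (sym (Σ<-- (suc b) (λ w → term 2 m w i) (λ w → sh 1 (term 2 m w) i)))) n)
    (sh-Σ m (suc b) (λ w → ∇ (term 2 m w)) n)

  term-exp : ∀ m w n → sh m (∇ (term 2 m w)) n ≡ sh (m ℕ.+ w ℕ.* (w ℕ.+ m ℕ.+ 2)) (∇ (U w (w ℕ.+ m))) n
  term-exp m w n = trans (sh-cong m (∇-sh (w ℕ.* (w ℕ.+ m ℕ.+ 2)) (U w (w ℕ.+ m))) n) (sh-sh m (w ℕ.* (w ℕ.+ m ℕ.+ 2)) (∇ (U w (w ℕ.+ m))) n)

  private
    term-0 : ∀ m n → sh m (∇ (term 2 m 0)) n ≡ sh m (∇ (p m)) n
    term-0 m n = sh-cong m (∇-cong (U-0 m)) n

    -- With `W = w + 1` the exponents agree, `(m + W)(W + 1) + W = m + W(W + m + 2)`: the partitions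
    -- with `W` ones make up the `W`-th Durfee term.
    term-suc : ∀ m w n → E n (Above.φ w (m ℕ.+ suc w)) n ≡ sh m (∇ (term 2 m (suc w))) n
    term-suc m w n = trans (Above.R∞-series w (m ℕ.+ suc w) n) (trans (cong₂ (λ e t → sh e (∇ (U (suc w) t)) n) (alg m w) (ℕP.+-comm m (suc w)))
      (sym (term-exp m (suc w) n)))
      where
      alg : ∀ m w → (m ℕ.+ suc w) ℕ.* suc (suc w) ℕ.+ suc w ≡ m ℕ.+ suc w ℕ.* (suc w ℕ.+ m ℕ.+ 2)
      alg = ℕR.solve-∀

    count : ∀ m n → ¬ n ≡ 1 → n ℕ.≤ b → + length (filter (λ r → crank r ℤ.≟ + suc m) (partitions n)) ≡ C (suc m) n
    count m n n≢1 n≤b = trans (length-filter (λ r → crank r ℤ.≟ + suc m) (partitions n))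
      (trans (E-cong n n (λ r _ s → crank-split (suc m) b r (ℕP.≤-trans (ones≤sum r) (ℕP.≤-trans (ℕP.≤-reflexive s) n≤b))))
      (trans (sumL-+ (noOnes (suc m)) (λ r → Σ< b (λ w → Above.φ w (suc m ℕ.+ suc w) r)) (partitions n))
      (trans (cong₂ _+_ (trans (noOnes-series m n n≢1) (sym (term-0 (suc m) n)))
        (trans (sumL-Σ b (λ w → Above.φ w (suc m ℕ.+ suc w)) (partitions n)) (Σ<-cong′ b (λ w → term-suc (suc m) w n))))
        (sym (C-sum (suc m) n)))))

    -- Only `w = 0` reaches degree 1, and its coefficient there is the one that `M` prescribes.
    C-1 : ∀ m → C (suc m) 1 ≡ sh (suc m) (∇ (p (suc m))) 1
    C-1 m = trans (C-sum (suc m) 1) (trans (cong₂ _+_ (term-0 (suc m) 1) (Σ<-0 b (λ w _ → trans (term-exp (suc m) (suc w) 1)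
      (sh-< (suc m ℕ.+ suc w ℕ.* (suc w ℕ.+ suc m ℕ.+ 2)) (∇ (U (suc w) (suc w ℕ.+ suc m))) 1
        (s≤s (ℕP.≤-trans (s≤s z≤n) (ℕP.m≤n+m (suc w ℕ.* (suc w ℕ.+ suc m ℕ.+ 2)) m))))))) (ℤP.+-identityʳ _))

  M≡C : ∀ m n → n ℕ.≤ b → M (+ suc m) n ≡ C (suc m) n
  M≡C m zero          n≤b = count m 0 (λ ()) n≤b
  M≡C zero (suc zero) n≤b = sym (C-1 0)
  M≡C (suc m) (suc zero) n≤b = sym (C-1 (suc m))
  M≡C m (suc (suc n)) n≤b = count m (suc (suc n)) (λ ()) n≤b

-- Overpartitions

Over : Set
Over = List (ℕ × Bool)

oE : ℕ → (Over → ℤ) → Series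
oE k φ n = sumL φ (overpartitionsLE k n)

-- Overpartitions with parts up to `k + 1` in which `k + 1` is not overlined. An overlined first
-- copy is put in front of these in `oE-rec`.
oB : ℕ → (Over → ℤ) → Series
oB k φ = geometric (suc k) (λ j → oE k (λ r → φ (replicate j (suc k , false) ++ r)))

oB-rec : ∀ k φ n → oB k φ n ≡ oE k φ n + sh (suc k) (oB k (λ r → φ ((suc k , false) ∷ r))) n
oB-rec k φ n = geometric-rec k (λ j → oE k (λ r → φ (replicate j (suc k , false) ++ r))) n

oE-rec : ∀ k φ n → oE (suc k) φ n ≡ oB k φ n + sh (suc k) (oB k (λ r → φ ((suc k , true) ∷ r))) n
oE-rec k φ n = trans (unfold (λ { zero r → ℤP.+-identityʳ (φ r) ; (suc j) r → cong (_+_ (φ ((suc k , false) ∷ (replicate j (suc k , false) ++ r)))) (ℤP.+-identityʳ (φ ((suc k , true) ∷ (replicate j (suc k , false) ++ r)))) }))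
  (trans (sumL-cong (λ j → split j (n ∸ j ℕ.* suc k)) js)
  (trans (sumL-filter-upTo (suc k) (λ j i → F j i + T j i) n (suc n))
  (trans (Σ<-cong′ (suc n) (λ j → sh-+ (j ℕ.* suc k) (F j) (T j) n))
  (trans (Σ<-+ (suc n) (λ j → sh (j ℕ.* suc k) (F j) n) (λ j → sh (j ℕ.* suc k) (T j) n))
    (cong (_+_ (oB k φ n)) (trans (geometric-rec k T n) (ℤP.+-identityˡ _)))))))
  where
  js = filter (λ j → j ℕ.* suc k ℕ.≤? n) (upTo (suc n))
  val : ℕ → Over → ℤ
  val zero    r = φ r
  val (suc j) r = φ ((suc k , false) ∷ (replicate j (suc k , false) ++ r)) + φ ((suc k , true) ∷ (replicate j (suc k , false) ++ r))
  F T : ℕ → Series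
  F j = oE k (λ r → φ (replicate j (suc k , false) ++ r))
  T zero    = λ _ → + 0
  T (suc j) = oE k (λ r → φ ((suc k , true) ∷ (replicate j (suc k , false) ++ r)))
  -- `G` stands for the local function `blocks`, of which only the sums over its values enter.
  unfold : ∀ {G : ℕ → Over → List Over} → (∀ j r → sumL φ (G j r) ≡ val j r) →
    sumL φ (concatMap (λ j → concatMap (G j) (overpartitionsLE k (n ∸ j ℕ.* suc k))) js) ≡ sumL (λ j → sumL (val j) (overpartitionsLE k (n ∸ j ℕ.* suc k))) js
  unfold {G} h = trans (sumL-concatMap φ (λ j → concatMap (G j) (overpartitionsLE k (n ∸ j ℕ.* suc k))) js)
    (sumL-cong (λ j → trans (sumL-concatMap φ (G j) (overpartitionsLE k (n ∸ j ℕ.* suc k))) (sumL-cong (h j) (overpartitionsLE k (n ∸ j ℕ.* suc k)))) js)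
  split : ∀ j i → sumL (val j) (overpartitionsLE k i) ≡ F j i + T j i
  split zero    i = sym (ℤP.+-identityʳ (F 0 i))
  split (suc j) i = sumL-+ (λ r → φ ((suc k , false) ∷ (replicate j (suc k , false) ++ r))) (λ r → φ ((suc k , true) ∷ (replicate j (suc k , false) ++ r))) (overpartitionsLE k i)

oE-1≡overSeries : ∀ k n → oE k (λ _ → + 1) n ≡ overSeries k n
oE-1≡overSeries zero    zero    = refl
oE-1≡overSeries zero    (suc n) = refl
oE-1≡overSeries (suc k) n = trans (oE-rec k (λ _ → + 1) n) (trans (cong₂ _+_ (inv-cong (suc k) (oE-1≡overSeries k) n)
    (trans (sh-cong (suc k) (inv-cong (suc k) (oE-1≡overSeries k)) n) (sym (inv-sh k (suc k) (overSeries k) n))))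
  (sym (inv-+ (suc k) (overSeries k) (sh (suc k) (overSeries k)) n)))

overSeries-stable : ∀ d n → overSeries (n ℕ.+ d) n ≡ overSeries n n
overSeries-stable zero    n = cong (λ k → overSeries k n) (ℕP.+-identityʳ n)
overSeries-stable (suc d) n = trans (cong (λ k → overSeries k n) (ℕP.+-suc n d)) (trans (inv-rec (n ℕ.+ d) (λ i → overSeries (n ℕ.+ d) i + sh (suc (n ℕ.+ d)) (overSeries (n ℕ.+ d)) i) n)
  (trans (cong₂ (λ x y → overSeries (n ℕ.+ d) n + x + y) (small (overSeries (n ℕ.+ d))) (small (overSeries (suc (n ℕ.+ d)))))
    (trans (ℤP.+-identityʳ _) (trans (ℤP.+-identityʳ _) (overSeries-stable d n)))))
  where
  small : ∀ f → sh (suc (n ℕ.+ d)) f n ≡ + 0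
  small f = sh-< (suc (n ℕ.+ d)) f n (s≤s (ℕP.m≤m+n n d))

overSeries-stable≤ : ∀ k n → n ℕ.≤ k → overSeries k n ≡ P̄ n
overSeries-stable≤ k n n≤k = trans (cong (λ k → overSeries k n) (sym (ℕP.m+[n∸m]≡n n≤k))) (overSeries-stable (k ∸ n) n)

-- c t ℓ n counts the overpartitions of n with t parts and largest part ℓ.
c : ℕ → ℕ → Series
c zero    zero    n = δ n
c zero    (suc ℓ) n = + 0
c (suc t) zero    n = + 0
c (suc t) (suc ℓ) n = sh (suc ℓ) (λ i → + 2 * Σ< (suc ℓ) (λ s → c t s i) + c t (suc ℓ) i) n

c-largest : ∀ t ℓ n → n ℕ.< ℓ → c t ℓ n ≡ + 0
c-largest zero    (suc ℓ) n h = refl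
c-largest (suc t) (suc ℓ) n h = sh-< (suc ℓ) _ n h

c-parts : ∀ t ℓ n → n ℕ.< t → c t ℓ n ≡ + 0
c-parts (suc t) zero    n h = refl
c-parts (suc t) (suc ℓ) n h = sh-0 (suc ℓ) n (λ i e → let i<t = ℕP.<-≤-trans (s≤s (ℕP.m≤n+m i ℓ)) (ℕP.≤-trans (ℕP.≤-reflexive e) (ℕP.≤-pred h)) in
  cong₂ (λ x y → + 2 * x + y) (Σ<-0 (suc ℓ) (λ s _ → c-parts t s i i<t)) (c-parts t (suc ℓ) i i<t))

Σ<-shift : ∀ B (f : ℕ → ℤ) → f 0 ≡ + 0 → f B ≡ + 0 → Σ< B f ≡ Σ< B (f ∘ suc)
Σ<-shift B f h₀ hB = trans (sym (trans (Σ<-snoc B f) (trans (cong (_+_ (Σ< B f)) hB) (ℤP.+-identityʳ _))))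
  (trans (cong (λ z → z + Σ< B (f ∘ suc)) h₀) (ℤP.+-identityˡ _))

Σ<-shift-by : ∀ B r (f : ℕ → ℤ) → (∀ i → i ℕ.< r → f i ≡ + 0) → (∀ i → B ℕ.≤ i → f i ≡ + 0) → Σ< B f ≡ Σ< B (λ j → f (r ℕ.+ j))
Σ<-shift-by B r f h₀ hB = trans (sym (Σ<-extend B (r ℕ.+ B) f (ℕP.m≤n+m B r) hB))
  (trans (Σ<-split r B f) (trans (cong (λ z → z + Σ< B (λ j → f (r ℕ.+ j))) (Σ<-0 r h₀)) (ℤP.+-identityˡ _)))

module _ (b : ℕ) where

  private B = suc b

  -- Such a statistic does not see overlines, so the two versions of a new largest part contribute
  -- equally. `tail` removes further copies of that part by induction on `n`; they match the summand
  -- of `c` without the factor 2.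
  oE-c : ∀ k (ψ : ℕ → ℕ → ℤ) n → n ℕ.≤ b →
    oE k (λ r → ψ (largestO r) (length r)) n ≡ Σ< (suc k) (λ ℓ → Σ< B (λ t → ψ ℓ t * c t ℓ n))
  oE-c zero ψ n n≤b = trans (base n) (sym (trans (ℤP.+-identityʳ _) (trans (cong (_+_ (ψ 0 0 * δ n)) (Σ<-0 b (λ t _ → ℤP.*-zeroʳ (ψ 0 (suc t))))) (ℤP.+-identityʳ _))))
    where
    base : ∀ n → oE 0 (λ r → ψ (largestO r) (length r)) n ≡ ψ 0 0 * δ n
    base zero    = trans (ℤP.+-identityʳ (ψ 0 0)) (sym (ℤP.*-identityʳ (ψ 0 0)))
    base (suc n) = sym (ℤP.*-zeroʳ (ψ 0 0))
  oE-c (suc k) ψ n n≤b = trans (oE-rec k φ n) (trans (cong (λ z → z + sh (suc k) (oB k φ′) n) (oB-rec k φ n))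
    (trans (alg (oE k φ n) (sh (suc k) (oB k φ′) n)) (trans (cong₂ _+_ (oE-c k ψ n n≤b) (sym (tail n (ψ (suc k)) n≤b)))
      (sym (Σ<-snoc (suc k) (λ ℓ → Σ< B (λ t → ψ ℓ t * c t ℓ n)))))))
    where
    φ φ′ : Over → ℤ
    φ r = ψ (largestO r) (length r)
    φ′ r = ψ (suc k) (suc (length r))
    alg : ∀ a x → a + x + x ≡ a + + 2 * x
    alg = solve-∀
    tail : ∀ n (χ : ℕ → ℤ) → n ℕ.≤ b → Σ< B (λ t → χ t * c t (suc k) n) ≡ + 2 * sh (suc k) (oB k (λ r → χ (suc (length r)))) n
    tail = <-rec (λ n → ∀ (χ : ℕ → ℤ) → n ℕ.≤ b → Σ< B (λ t → χ t * c t (suc k) n) ≡ + 2 * sh (suc k) (oB k (λ r → χ (suc (length r)))) n) step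
      where
      step : ∀ n → (∀ {i} → i ℕ.< n → ∀ (χ : ℕ → ℤ) → i ℕ.≤ b → Σ< B (λ t → χ t * c t (suc k) i) ≡ + 2 * sh (suc k) (oB k (λ r → χ (suc (length r)))) i) →
        ∀ (χ : ℕ → ℤ) → n ℕ.≤ b → Σ< B (λ t → χ t * c t (suc k) n) ≡ + 2 * sh (suc k) (oB k (λ r → χ (suc (length r)))) n
      step n ih χ n≤b = trans (Σ<-shift B (λ t → χ t * c t (suc k) n) (ℤP.*-zeroʳ (χ 0))
          (trans (cong (_*_ (χ B)) (c-parts B (suc k) n (s≤s n≤b))) (ℤP.*-zeroʳ (χ B))))
        (trans (Σ<-cong′ B (λ t → sym (sh-* (suc k) (χ (suc t)) (row t) n)))
        (trans (sym (sh-Σ (suc k) B (λ t i → χ (suc t) * row t i) n))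
        (trans (sh-cong-at (suc k) n inner) (sh-* (suc k) (+ 2) (oB k (λ r → χ (suc (length r)))) n))))
        where
        row : ℕ → Series
        row t i = + 2 * Σ< (suc k) (λ s → c t s i) + c t (suc k) i
        dist : ∀ x y z → x * (+ 2 * y + z) ≡ + 2 * (x * y) + x * z
        dist = solve-∀
        inner : ∀ i → suc k ℕ.+ i ≡ n → Σ< B (λ t → χ (suc t) * row t i) ≡ + 2 * oB k (λ r → χ (suc (length r))) i
        inner i e = trans (Σ<-cong′ B (λ t → dist (χ (suc t)) (Σ< (suc k) (λ s → c t s i)) (c t (suc k) i)))
          (trans (Σ<-+ B (λ t → + 2 * (χ (suc t) * Σ< (suc k) (λ s → c t s i))) (λ t → χ (suc t) * c t (suc k) i))
          (trans (cong₂ _+_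
            (trans (Σ<-* B (+ 2) (λ t → χ (suc t) * Σ< (suc k) (λ s → c t s i))) (cong (_*_ (+ 2)) (trans (Σ<-cong′ B (λ t → sym (Σ<-* (suc k) (χ (suc t)) (λ s → c t s i))))
              (trans (Σ<-swap B (suc k) (λ t s → χ (suc t) * c t s i)) (sym (oE-c k (λ _ t → χ (suc t)) i i≤b))))))
            (ih i<n (χ ∘ suc) i≤b))
          (trans (sym (ℤP.*-distribˡ-+ (+ 2) (oE k (λ r → χ (suc (length r))) i) (sh (suc k) (oB k (λ r → χ (suc (suc (length r))))) i)))
            (cong (_*_ (+ 2)) (sym (oB-rec k (λ r → χ (suc (length r))) i))))))
          where
          i<n : i ℕ.< n
          i<n = ℕP.<-≤-trans (s≤s (ℕP.m≤n+m i k)) (ℕP.≤-reflexive e)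
          i≤b : i ℕ.≤ b
          i≤b = ℕP.≤-trans (ℕP.<⇒≤ i<n) n≤b

-- Ranks: exchanging first rows and first columns

le : ℕ → ℕ → ℤ
le zero    n       = + 1
le (suc m) zero    = + 0
le (suc m) (suc n) = le m n

le-> : ∀ m n → n ℕ.< m → le m n ≡ + 0
le-> (suc m) zero    h       = refl
le-> (suc m) (suc n) (s≤s h) = le-> m n h

le-≤ : ∀ m n → m ℕ.≤ n → le m n ≡ + 1
le-≤ zero    n       h       = refl
le-≤ (suc m) (suc n) (s≤s h) = le-≤ m n h

le-+ : ∀ r m n → le (r ℕ.+ m) (r ℕ.+ n) ≡ le m n
le-+ zero    m n = refl
le-+ (suc r) m n = le-+ r m n

le-complement : ∀ m n → le m n ≡ + 1 - le (suc n) m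
le-complement zero    n       = refl
le-complement (suc m) zero    = refl
le-complement (suc m) (suc n) = le-complement m n

-- 2, 1 or 0 according to `s < ℓ`, `s = ℓ` or `s > ℓ`: the number of ways to put a row `ℓ` on top of
-- a largest part `s`. A lone part may be overlined or not, while a repeated one passes its overline
-- on.
weight : ℕ → ℕ → ℤ
weight s ℓ = le s ℓ + le (suc s) ℓ

-- Extends the sum in the definition of `c` to a range independent of `k`, so that sums over rows
-- and over columns can be interchanged.
weighted-sum : ∀ B k (f : ℕ → ℤ) → (∀ s → B ℕ.≤ s → f s ≡ + 0) → Σ< B (λ s → weight s (suc k) * f s) ≡ + 2 * Σ< (suc k) f + f (suc k)
weighted-sum B k f hf = trans (sym (Σ<-extend B (k ℕ.+ 2 ℕ.+ B) g (ℕP.m≤n+m B (k ℕ.+ 2)) (λ s B≤s → trans (cong (_*_ (weight s (suc k))) (hf s B≤s)) (ℤP.*-zeroʳ (weight s (suc k))))))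
  (trans (Σ<-extend (suc (suc k)) (k ℕ.+ 2 ℕ.+ B) g (ℕP.≤-trans (ℕP.≤-reflexive (ℕP.+-comm 2 k)) (ℕP.m≤m+n (k ℕ.+ 2) B))
      (λ s h → cong (λ z → z * f s) (cong₂ _+_ (le-> s (suc k) h) (le-> (suc s) (suc k) (ℕP.m≤n⇒m≤1+n h)))))
  (trans (Σ<-snoc (suc k) g) (cong₂ _+_
    (trans (Σ<-cong (suc k) (λ s s<k → cong (λ z → z * f s) (cong₂ _+_ (le-≤ s (suc k) (ℕP.<⇒≤ s<k)) (le-≤ (suc s) (suc k) s<k)))) (Σ<-* (suc k) (+ 2) f))
    (trans (cong (λ z → z * f (suc k)) (cong₂ _+_ (le-≤ k k ℕP.≤-refl) (le-> (suc k) k ℕP.≤-refl))) (ℤP.*-identityˡ (f (suc k)))))))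
  where
  g : ℕ → ℤ
  g s = weight s (suc k) * f s

module Counting (b : ℕ) where

  private B = suc b

  c-row : ∀ t ℓ n → n ℕ.≤ b → c (suc t) (suc ℓ) n ≡ sh (suc ℓ) (λ i → Σ< B (λ s → weight s (suc ℓ) * c t s i)) n
  c-row t ℓ n n≤b = sh-cong≤ (suc ℓ) n (λ i i≤n → sym (weighted-sum B ℓ (λ s → c t s i) (λ s B≤s → c-largest t s i (ℕP.≤-trans (s≤s (ℕP.≤-trans i≤n n≤b)) B≤s))))

  private
    only-0 : ∀ i (f : ℕ → ℤ) → Σ< B (λ s → f s * c 0 s i) ≡ f 0 * δ i
    only-0 i f = trans (cong (_+_ (f 0 * δ i)) (Σ<-0 b (λ s _ → ℤP.*-zeroʳ (f (suc s))))) (ℤP.+-identityʳ _)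

    only-0′ : ∀ i (f : ℕ → ℤ) → Σ< B (λ t → f t * c t 0 i) ≡ f 0 * δ i
    only-0′ i f = trans (cong (_+_ (f 0 * δ i)) (Σ<-0 b (λ t _ → ℤP.*-zeroʳ (f (suc t))))) (ℤP.+-identityʳ _)

    c-1 : ∀ ℓ n → n ℕ.≤ b → c 1 (suc ℓ) n ≡ sh (suc ℓ) (λ i → + 2 * δ i) n
    c-1 ℓ n n≤b = trans (c-row 0 ℓ n n≤b) (sh-cong (suc ℓ) (λ i → only-0 i (λ s → weight s (suc ℓ))) n)

  column : ℕ → ℕ → Series
  column j s i = Σ< B (λ t → weight t j * c t s i)

  -- Removal of the first column; it commutes with the removal of the first row, by which c is defined.
  c-column : ∀ j s n → n ℕ.≤ b → c (suc j) (suc s) n ≡ sh (suc j) (column (suc j) s) n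
  c-column zero zero n n≤b = trans (c-1 0 n n≤b) (sh-cong 1 (λ i → sym (only-0′ i (λ t → weight t 1))) n)
  c-column zero (suc s) n n≤b = trans (c-1 (suc s) n n≤b) (trans (sym (sh-sh 1 (suc s) (λ i → + 2 * δ i) n))
    (sh-cong≤ 1 n (λ i i≤n → trans (sym (c-1 s i (ℕP.≤-trans i≤n n≤b)))
      (sym (trans (weighted-sum B 0 (λ t → c t (suc s) i) (λ t B≤t → c-parts t (suc s) i (ℕP.≤-trans (s≤s (ℕP.≤-trans i≤n n≤b)) B≤t)))
        (ℤP.+-identityˡ (c 1 (suc s) i)))))))
  c-column (suc j) s n n≤b = trans (c-row (suc j) s n n≤b) (trans (sh-cong≤ (suc s) n inner) (trans (swap s) (sh-cong≤ (suc (suc j)) n (outer s))))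
    where
    inner : ∀ i → i ℕ.≤ n → Σ< B (λ s′ → weight s′ (suc s) * c (suc j) s′ i) ≡ sh (suc j) (λ i → Σ< B (λ s′ → weight s′ s * column (suc j) s′ i)) i
    inner i i≤n = trans (Σ<-shift B (λ s′ → weight s′ (suc s) * c (suc j) s′ i) refl
        (trans (cong (_*_ (weight B (suc s))) (c-largest (suc j) B i (s≤s i≤b))) (ℤP.*-zeroʳ (weight B (suc s)))))
      (trans (Σ<-cong′ B (λ s′ → trans (cong (_*_ (weight s′ s)) (c-column j s′ i i≤b)) (sym (sh-* (suc j) (weight s′ s) (column (suc j) s′) i))))
        (sym (sh-Σ (suc j) B (λ s′ i → weight s′ s * column (suc j) s′ i) i)))
      where i≤b = ℕP.≤-trans i≤n n≤b
    S : ℕ → Series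
    S s i = Σ< B (λ s′ → weight s′ s * column (suc j) s′ i)
    swap : ∀ s → sh (suc s) (sh (suc j) (S s)) n ≡ sh (suc (suc j)) (sh s (S s)) n
    swap s = trans (sh-sh (suc s) (suc j) (S s) n) (trans (cong (λ e → sh e (S s) n) (alg s j)) (sym (sh-sh (suc (suc j)) s (S s) n)))
      where
      alg : ∀ s j → suc s ℕ.+ suc j ≡ suc (suc j) ℕ.+ s
      alg = ℕR.solve-∀
    outer : ∀ s i → i ℕ.≤ n → sh s (S s) i ≡ column (suc (suc j)) s i
    outer zero i i≤n = trans (trans (cong (_+_ (weight 0 0 * column (suc j) 0 i)) (Σ<-0 b (λ s′ _ → refl))) (ℤP.+-identityʳ _))
      (trans (ℤP.*-identityˡ (column (suc j) 0 i)) (trans (only-0′ i (λ t → weight t (suc j))) (sym (only-0′ i (λ t → weight t (suc (suc j)))))))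
    outer (suc s) i i≤n = trans (sh-cong (suc s) (λ x → trans (Σ<-cong′ B (λ s′ → sym (Σ<-* B (weight s′ (suc s)) (λ t → weight t (suc j) * c t s′ x))))
          (trans (Σ<-swap B B (λ s′ t → weight s′ (suc s) * (weight t (suc j) * c t s′ x)))
            (Σ<-cong′ B (λ t → trans (Σ<-cong′ B (λ s′ → exch (weight s′ (suc s)) (weight t (suc j)) (c t s′ x))) (Σ<-* B (weight t (suc j)) (λ s′ → weight s′ (suc s) * c t s′ x)))))) i)
      (trans (sh-Σ (suc s) B (λ t x → weight t (suc j) * Σ< B (λ s′ → weight s′ (suc s) * c t s′ x)) i)
      (trans (Σ<-cong′ B (λ t → trans (sh-* (suc s) (weight t (suc j)) (λ x → Σ< B (λ s′ → weight s′ (suc s) * c t s′ x)) i)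
          (cong (_*_ (weight t (suc j))) (sym (c-row t s i (ℕP.≤-trans i≤n n≤b))))))
        (sym (Σ<-shift B (λ t → weight t (suc (suc j)) * c t (suc s) i) refl
          (trans (cong (_*_ (weight B (suc (suc j)))) (c-parts B (suc s) i (s≤s (ℕP.≤-trans i≤n n≤b)))) (ℤP.*-zeroʳ (weight B (suc (suc j)))))))))
      where
      exch : ∀ a b c → a * (b * c) ≡ b * (a * c)
      exch = solve-∀

  -- overpartitions of rank ≥ m
  G : ℕ → Series
  G m n = Σ< B (λ ℓ → Σ< B (λ t → le (t ℕ.+ m) ℓ * c t ℓ n))

  total : ∀ n → n ℕ.≤ b → Σ< B (λ ℓ → Σ< B (λ t → c t ℓ n)) ≡ P̄ n
  total n n≤b = trans (Σ<-cong′ B (λ ℓ → Σ<-cong′ B (λ t → sym (ℤP.*-identityˡ (c t ℓ n)))))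
    (trans (sym (oE-c b b (λ _ _ → + 1) n n≤b)) (trans (oE-1≡overSeries b n) (overSeries-stable≤ b n n≤b)))

  private
    -- A positive rank excludes the empty overpartition, so both indices can be shifted: one part is
    -- split off, and the largest part is written as `r + j`.
    vanish : ∀ m r n → n ℕ.≤ b → (∀ t ℓ → ℓ ℕ.< r → le (suc t ℕ.+ m) ℓ ≡ + 0) → 1 ℕ.≤ m →
      G m n ≡ Σ< B (λ j → Σ< B (λ t → le (suc t ℕ.+ m) (r ℕ.+ j) * c (suc t) (r ℕ.+ j) n))
    vanish m r n n≤b h 1≤m = trans (Σ<-cong′ B (λ ℓ → Σ<-shift B (λ t → le (t ℕ.+ m) ℓ * c t ℓ n) (first ℓ)
        (trans (cong (_*_ (le (B ℕ.+ m) ℓ)) (c-parts B ℓ n (s≤s n≤b))) (ℤP.*-zeroʳ (le (B ℕ.+ m) ℓ)))))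
      (Σ<-shift-by B r (λ ℓ → Σ< B (λ t → le (suc t ℕ.+ m) ℓ * c (suc t) ℓ n))
        (λ ℓ ℓ<r → Σ<-0 B (λ t _ → cong (λ z → z * c (suc t) ℓ n) (h t ℓ ℓ<r)))
        (λ ℓ B≤ℓ → Σ<-0 B (λ t _ → trans (cong (_*_ (le (suc t ℕ.+ m) ℓ)) (c-largest (suc t) ℓ n (ℕP.≤-trans (s≤s n≤b) B≤ℓ))) (ℤP.*-zeroʳ (le (suc t ℕ.+ m) ℓ)))))
      where
      first : ∀ ℓ → le m ℓ * c 0 ℓ n ≡ + 0
      first zero    = cong (λ z → z * δ n) (le-> m 0 1≤m)
      first (suc ℓ) = ℤP.*-zeroʳ (le m (suc ℓ))

  module _ (r′ : ℕ) where
    private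
      r = suc (suc r′)

      pairs : ℕ → ℤ
      pairs n = Σ< B (λ j → Σ< B (λ t → weight t j * c (suc t) (r ℕ.+ j) n))

      -- Two adjacent thresholds are added because `[t ≤ j] + [t < j]` is `weight t j`, the weight
      -- with which a column of height `j` is attached to `t` parts. A single threshold would have
      -- no such reading.
      pairs-rank : ∀ n → n ℕ.≤ b → G (suc r′) n + G r n ≡ pairs n
      pairs-rank n n≤b = trans (cong₂ _+_
          (vanish (suc r′) r n n≤b (λ t ℓ ℓ<r → le-> (suc t ℕ.+ suc r′) ℓ (ℕP.≤-trans ℓ<r (ℕP.+-monoˡ-≤ (suc r′) (s≤s (z≤n {t}))))) (s≤s z≤n))
          (vanish r r n n≤b (λ t ℓ ℓ<r → le-> (suc t ℕ.+ r) ℓ (ℕP.≤-trans ℓ<r (ℕP.m≤n+m r (suc t)))) (s≤s z≤n)))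
        (trans (sym (Σ<-+ B (λ j → Σ< B (λ t → le (suc t ℕ.+ suc r′) (r ℕ.+ j) * c (suc t) (r ℕ.+ j) n)) (λ j → Σ< B (λ t → le (suc t ℕ.+ r) (r ℕ.+ j) * c (suc t) (r ℕ.+ j) n))))
        (Σ<-cong′ B (λ j → trans (sym (Σ<-+ B (λ t → le (suc t ℕ.+ suc r′) (r ℕ.+ j) * c (suc t) (r ℕ.+ j) n) (λ t → le (suc t ℕ.+ r) (r ℕ.+ j) * c (suc t) (r ℕ.+ j) n)))
          (Σ<-cong′ B (λ t → trans (sym (ℤP.*-distribʳ-+ (c (suc t) (r ℕ.+ j) n) (le (suc t ℕ.+ suc r′) (r ℕ.+ j)) (le (suc t ℕ.+ r) (r ℕ.+ j))))
            (cong (λ z → z * c (suc t) (r ℕ.+ j) n) (cong₂ _+_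
              (trans (cong (λ x → le x (r ℕ.+ j)) (alg₁ t r′)) (le-+ r t j))
              (trans (cong (λ x → le x (r ℕ.+ j)) (ℕP.+-comm (suc t) r)) (le-+ r (suc t) j)))))))))
        where
        alg₁ : ∀ t r′ → suc t ℕ.+ suc r′ ≡ suc (suc r′) ℕ.+ t
        alg₁ = ℕR.solve-∀

      W₂ : ℕ → ℕ → Series
      W₂ j s i = weight s (r ℕ.+ j) * column j s i

      pairs-column : ∀ n → n ℕ.≤ b → pairs n ≡ sh r (λ i → Σ< B (λ j → sh j (λ i → Σ< B (λ s → W₂ j s i)) i)) n
      pairs-column n n≤b = trans (Σ<-cong′ B one) (sym (sh-Σ r B (λ j → sh j (λ i → Σ< B (λ s → W₂ j s i))) n))
        where
        exch : ∀ a b c → a * (b * c) ≡ b * (a * c)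
        exch = solve-∀
        one : ∀ j → Σ< B (λ t → weight t j * c (suc t) (r ℕ.+ j) n) ≡ sh r (sh j (λ i → Σ< B (λ s → W₂ j s i))) n
        one j = trans (Σ<-cong′ B (λ t → trans (cong (_*_ (weight t j)) (c-row t (suc r′ ℕ.+ j) n n≤b)) (sym (sh-* (r ℕ.+ j) (weight t j) (λ i → Σ< B (λ s → weight s (r ℕ.+ j) * c t s i)) n))))
          (trans (sym (sh-Σ (r ℕ.+ j) B (λ t i → weight t j * Σ< B (λ s → weight s (r ℕ.+ j) * c t s i)) n))
          (trans (sh-cong (r ℕ.+ j) (λ i → trans (Σ<-cong′ B (λ t → sym (Σ<-* B (weight t j) (λ s → weight s (r ℕ.+ j) * c t s i))))
              (trans (Σ<-swap B B (λ t s → weight t j * (weight s (r ℕ.+ j) * c t s i)))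
                (Σ<-cong′ B (λ s → trans (Σ<-cong′ B (λ t → exch (weight t j) (weight s (r ℕ.+ j)) (c t s i))) (Σ<-* B (weight s (r ℕ.+ j)) (λ t → weight t j * c t s i)))))) n)
            (sym (sh-sh r j (λ i → Σ< B (λ s → W₂ j s i)) n))))

      rest : ℕ → ℕ → ℤ
      rest ℓ t = + 2 - (le (t ℕ.+ suc r) ℓ + le (t ℕ.+ suc (suc r)) ℓ)

      -- The factor `q^j` left from the removed row pays for the new column, by `c-column`. The
      -- weight of the removed row becomes a condition on the rank of the new overpartition, bounded
      -- from above and hence written by complements.
      columns : ∀ i → i ℕ.≤ b → Σ< B (λ j → sh j (λ i → Σ< B (λ s → W₂ j s i)) i) ≡ Σ< B (λ t → Σ< B (λ ℓ → rest ℓ t * c t ℓ i))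
      columns i i≤b = cong₂ _+_ zeroth (Σ<-cong′ b step)
        where
        zeroth : Σ< B (λ s → W₂ 0 s i) ≡ Σ< B (λ ℓ → rest ℓ 0 * c 0 ℓ i)
        zeroth = trans (Σ<-cong′ B (λ s → cong (_*_ (weight s (r ℕ.+ 0))) (trans (cong (_+_ (+ 1 * c 0 s i)) (Σ<-0 b (λ t _ → refl))) (trans (ℤP.+-identityʳ _) (ℤP.*-identityˡ (c 0 s i))))))
          (trans (only-0 i (λ s → weight s (r ℕ.+ 0))) (sym (only-0 i (λ ℓ → rest ℓ 0))))
        weights : ∀ j s → weight s (r ℕ.+ suc j) ≡ rest (suc s) (suc j)
        weights j s = trans (cong₂ _+_ (le-complement s (r ℕ.+ suc j)) (le-complement (suc s) (r ℕ.+ suc j)))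
          (trans (cong₂ (λ x y → (+ 1 - le x s) + (+ 1 - le y s)) (alg₁ r′ j) (alg₂ r′ j)) (alg (le (j ℕ.+ suc (suc r)) s) (le (j ℕ.+ suc r) s)))
          where
          alg₁ : ∀ r′ j → suc (suc (suc r′) ℕ.+ suc j) ≡ j ℕ.+ suc (suc (suc (suc r′)))
          alg₁ = ℕR.solve-∀
          alg₂ : ∀ r′ j → suc (suc r′) ℕ.+ suc j ≡ j ℕ.+ suc (suc (suc r′))
          alg₂ = ℕR.solve-∀
          alg : ∀ a b → (+ 1 - a) + (+ 1 - b) ≡ + 2 - (b + a)
          alg = solve-∀
        step : ∀ j → sh (suc j) (λ i → Σ< B (λ s → W₂ (suc j) s i)) i ≡ Σ< B (λ ℓ → rest ℓ (suc j) * c (suc j) ℓ i)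
        step j = trans (sh-Σ (suc j) B (W₂ (suc j)) i)
          (trans (Σ<-cong′ B (λ s → trans (sh-* (suc j) (weight s (r ℕ.+ suc j)) (column (suc j) s) i)
            (cong₂ _*_ (weights j s) (sym (c-column j s i i≤b)))))
          (sym (Σ<-shift B (λ ℓ → rest ℓ (suc j) * c (suc j) ℓ i) (ℤP.*-zeroʳ (rest 0 (suc j)))
            (trans (cong (_*_ (rest B (suc j))) (c-largest (suc j) B i (s≤s i≤b))) (ℤP.*-zeroʳ (rest B (suc j)))))))

      rest-sum : ∀ i → i ℕ.≤ b → Σ< B (λ t → Σ< B (λ ℓ → rest ℓ t * c t ℓ i)) ≡ + 2 * P̄ i - (G (suc r) i + G (suc (suc r)) i)
      rest-sum i i≤b = trans (Σ<-swap B B (λ t ℓ → rest ℓ t * c t ℓ i))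
        (trans (Σ<-cong′ B (λ ℓ → trans (Σ<-cong′ B (λ t → alg (le (t ℕ.+ suc r) ℓ) (le (t ℕ.+ suc (suc r)) ℓ) (c t ℓ i)))
           (trans (Σ<-- B (λ t → + 2 * c t ℓ i) (λ t → g₁ ℓ t + g₂ ℓ t)) (cong₂ _-_ (Σ<-* B (+ 2) (λ t → c t ℓ i)) (Σ<-+ B (g₁ ℓ) (g₂ ℓ))))))
        (trans (Σ<-- B (λ ℓ → + 2 * Σ< B (λ t → c t ℓ i)) (λ ℓ → Σ< B (g₁ ℓ) + Σ< B (g₂ ℓ)))
          (cong₂ _-_ (trans (Σ<-* B (+ 2) (λ ℓ → Σ< B (λ t → c t ℓ i))) (cong (_*_ (+ 2)) (total i i≤b))) (Σ<-+ B (λ ℓ → Σ< B (g₁ ℓ)) (λ ℓ → Σ< B (g₂ ℓ))))))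
        where
        g₁ g₂ : ℕ → ℕ → ℤ
        g₁ ℓ t = le (t ℕ.+ suc r) ℓ * c t ℓ i
        g₂ ℓ t = le (t ℕ.+ suc (suc r)) ℓ * c t ℓ i
        alg : ∀ a b x → (+ 2 - (a + b)) * x ≡ + 2 * x - (a * x + b * x)
        alg = solve-∀

    -- The analogue of Dyson's adjoint: replace the first row ℓ by a first column of height ℓ − (r′ + 2).
    -- weight counts the possible overlinings of the removed row and of the added column.
    G-rec : ∀ n → n ℕ.≤ b → G (suc r′) n + G (suc (suc r′)) n ≡
      sh (suc (suc r′)) (λ i → + 2 * P̄ i - (G (suc (suc (suc r′))) i + G (suc (suc (suc (suc r′)))) i)) n
    G-rec n n≤b = trans (pairs-rank n n≤b) (trans (pairs-column n n≤b) (sh-cong≤ r n (λ i i≤n → let i≤b = ℕP.≤-trans i≤n n≤b in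
      trans (columns i i≤b) (rest-sum i i≤b))))

-- Unrolling the recursions into alternating sums

inv-Σ : ∀ c e B f N → N ℕ.< B → Σ< B (λ j → sh (e ℕ.+ j ℕ.* suc c) f N) ≡ sh e (inv (suc c) f) N
inv-Σ c e B f N N<B = trans (Σ<-cong′ B (λ j → sym (sh-sh e (j ℕ.* suc c) f N)))
  (trans (sym (sh-Σ e B (λ j → sh (j ℕ.* suc c) f) N))
  (sh-cong≤ e N (λ i i≤N → Σ<-extend (suc i) B (λ j → sh (j ℕ.* suc c) f i) (ℕP.≤-trans (s≤s i≤N) N<B)
    (λ j i<j → sh-< (j ℕ.* suc c) f i (ℕP.≤-trans i<j (ℕP.m≤m*n j (suc c)))))))

module _ (s b : ℕ) (f : Series) (y : ℕ → Series)
  (y-rec : ∀ j n → n ℕ.≤ b → y j n ≡ sh (suc s ℕ.* suc j) (λ i → f i - y (suc j) i) n) where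

  private
    B = suc b
    e : ℕ → ℕ → ℕ
    e j k = suc s ℕ.* (j ℕ.* k ℕ.+ tri k)
    e-suc : ∀ j k → e j k ℕ.+ suc s ℕ.* suc (j ℕ.+ k) ≡ e j (suc k)
    e-suc j k = alg s j k (tri k)
      where
      alg : ∀ s j k t → suc s ℕ.* (j ℕ.* k ℕ.+ t) ℕ.+ suc s ℕ.* suc (j ℕ.+ k) ≡ suc s ℕ.* (j ℕ.* suc k ℕ.+ (suc k ℕ.+ t))
      alg = ℕR.solve-∀
    e-row : ∀ j k → suc s ℕ.* tri (suc k) ℕ.+ j ℕ.* (suc s ℕ.* suc k) ≡ e j (suc k)
    e-row j k = alg s j k (tri (suc k))
      where
      alg : ∀ s j k t → suc s ℕ.* t ℕ.+ j ℕ.* (suc s ℕ.* suc k) ≡ suc s ℕ.* (j ℕ.* suc k ℕ.+ t)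
      alg = ℕR.solve-∀

    module _ (N : ℕ) (N≤b : N ℕ.≤ b) where
      -- After `k` unrollings the summand `y j` has become `q^(e j k) y (j + k)`, up to sign, and
      -- `P* k` collects these. One more step splits off the multiples `q^(e j (k+1)) f`; over `j`
      -- they form a geometric series of ratio `q^((s+1)(k+1))`, the origin of the denominators of
      -- `A`.
      P* A : ℕ → ℤ
      P* k = Σ< B (λ j → sh (e j k) (y (j ℕ.+ k)) N)
      A k = sh (suc s ℕ.* tri (suc k)) (inv (suc s ℕ.* suc k) f) N

      P*-rec : ∀ k → P* k ≡ A k - P* (suc k)
      P*-rec k = trans (Σ<-cong′ B (λ j → trans (sh-cong≤ (e j k) N (λ i i≤N → y-rec (j ℕ.+ k) i (ℕP.≤-trans i≤N N≤b)))
          (trans (sh-sh (e j k) (suc s ℕ.* suc (j ℕ.+ k)) (λ i → f i - y (suc (j ℕ.+ k)) i) N)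
          (trans (cong₂ (λ x m → sh x (λ i → f i - y m i) N) (e-suc j k) (sym (ℕP.+-suc j k)))
            (sh-- (e j (suc k)) f (y (j ℕ.+ suc k)) N)))))
        (trans (Σ<-- B (λ j → sh (e j (suc k)) f N) (λ j → sh (e j (suc k)) (y (j ℕ.+ suc k)) N))
          (cong (λ z → z - P* (suc k)) (trans (Σ<-cong′ B (λ j → cong (λ x → sh x f N) (sym (e-row j k))))
            (inv-Σ (k ℕ.+ s ℕ.* suc k) (suc s ℕ.* tri (suc k)) B f N (s≤s N≤b)))))

      expand : ∀ m → P* 0 ≡ Σ< m (λ k → sgn k * A k) + sgn m * P* m
      expand zero    = sym (trans (ℤP.+-identityˡ _) (ℤP.*-identityˡ (P* 0)))
      expand (suc m) = trans (expand m) (trans (cong (λ z → Σ< m (λ k → sgn k * A k) + sgn m * z) (P*-rec m))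
        (trans (alg (Σ< m (λ k → sgn k * A k)) (sgn m) (A m) (P* (suc m))) (cong (λ z → z + sgn (suc m) * P* (suc m)) (sym (Σ<-snoc m (λ k → sgn k * A k))))))
        where
        alg : ∀ S x a p → S + x * (a - p) ≡ S + x * a + (- x) * p
        alg = solve-∀

      P*-last : P* B ≡ + 0
      P*-last = Σ<-0 B (λ j _ → sh-< (e j B) (y (j ℕ.+ B)) N
        (ℕP.≤-trans (s≤s N≤b) (ℕP.≤-trans (n≤tri B) (ℕP.≤-trans (ℕP.m≤n+m (tri B) (j ℕ.* B)) (ℕP.m≤n*m (j ℕ.* B ℕ.+ tri B) (suc s))))))

  -- Unrolling y-rec k + 1 times turns the recursion into the k-th row of an alternating sum.
  alternating : ∀ N → N ℕ.≤ b → Σ< B (λ j → y j N) ≡ Σ< B (λ k → sgn k * sh (suc s ℕ.* tri (suc k)) (inv (suc s ℕ.* suc k) f) N)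
  alternating N N≤b = trans (Σ<-cong′ B (λ j → cong₂ (λ x m → sh x (y m) N) (sym (trans (cong (ℕ._*_ (suc s)) (trans (ℕP.+-identityʳ (j ℕ.* 0)) (ℕP.*-zeroʳ j))) (ℕP.*-zeroʳ (suc s)))) (sym (ℕP.+-identityʳ j))))
    (trans (expand N N≤b B) (trans (cong (λ z → Σ< B (λ k → sgn k * A N N≤b k) + sgn B * z) (P*-last N N≤b))
      (trans (cong (_+_ (Σ< B (λ k → sgn k * A N N≤b k))) (ℤP.*-zeroʳ (sgn B))) (ℤP.+-identityʳ _))))

-- The first moments and their difference

abel : ∀ n (z : ℕ → ℤ) → Σ< n (λ i → + suc i * (z i - z (suc i))) ≡ Σ< n z - + n * z n
abel zero    z = alg (z 0)
  where
  alg : ∀ x → + 0 ≡ + 0 - + 0 * x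
  alg = solve-∀
abel (suc n) z = trans (Σ<-snoc n (λ i → + suc i * (z i - z (suc i)))) (trans (cong (λ x → x + + suc n * (z n - z (suc n))) (abel n z))
  (trans (alg (Σ< n z) (+ n) (z n) (z (suc n))) (cong (λ x → x - + suc n * z (suc n)) (sym (Σ<-snoc n z)))))
  where
  alg : ∀ S n a b → S - n * a + (+ 1 + n) * (a - b) ≡ (S + a) - (+ 1 + n) * b
  alg = solve-∀

Σ<-pairs : ∀ m (f : ℕ → ℤ) → Σ< (m ℕ.+ m) f ≡ Σ< m (λ j → f (j ℕ.+ j) + f (suc (j ℕ.+ j)))
Σ<-pairs zero    f = refl
Σ<-pairs (suc m) f = trans (cong (λ k → Σ< (suc k) f) (ℕP.+-suc m m)) (trans (Σ<-snoc (suc (m ℕ.+ m)) f)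
  (trans (cong (λ z → z + f (suc (m ℕ.+ m))) (trans (Σ<-snoc (m ℕ.+ m) f) (cong (λ z → z + f (m ℕ.+ m)) (Σ<-pairs m f))))
  (trans (ℤP.+-assoc (Σ< m (λ j → f (j ℕ.+ j) + f (suc (j ℕ.+ j)))) (f (m ℕ.+ m)) (f (suc (m ℕ.+ m)))) (sym (Σ<-snoc m (λ j → f (j ℕ.+ j) + f (suc (j ℕ.+ j))))))))

module _ (n : ℕ) where

  private B = suc n

  private
    module Dur = Durfee n
    module R = Counting n

    Z : ℕ → Series
    Z m = conv Dₛ (Dur.X m)

    Z-rec : ∀ j i → i ℕ.≤ n → Z (suc j) i ≡ sh (1 ℕ.* suc j) (λ i → P̄ i - Z (suc (suc j)) i) i
    Z-rec j i i≤n = trans (conv-cong≤ {Dₛ} {Dₛ} i (λ _ _ → refl) (λ k k≤i → Dur.X-rec (suc j) k (ℕP.≤-trans k≤i i≤n)))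
      (trans (conv-shʳ (suc j) Dₛ (λ k → P k - Dur.X (suc (suc j)) k) i)
      (trans (sh-cong (suc j) (λ k → trans (conv--ʳ Dₛ P (Dur.X (suc (suc j))) k) (cong (λ z → z - Z (suc (suc j)) k) (Dₛ*P k))) i)
        (cong (λ e → sh e (λ i → P̄ i - Z (suc (suc j)) i) i) (sym (ℕP.*-identityˡ (suc j))))))

    Z-large : ∀ m → n ℕ.< m → Z m n ≡ + 0
    Z-large m n<m = trans (conv-shʳ m Dₛ (Dur.V 1 m) n) (sh-< m (conv Dₛ (Dur.V 1 m)) n n<m)

    Mbar-Z : ∀ i → Mbar (+ suc i) n ≡ Z (suc i) n - Z (suc (suc i)) n
    Mbar-Z i = trans (foldr-upTo (suc n) id (λ k → + D k * M (+ suc i) (n ∸ k)))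
      (trans (conv-cong≤ {Dₛ} {Dₛ} n (λ _ _ → refl) (λ k k≤n → trans (M≡C n i k k≤n) (sym (Dur.X-diff (suc i) k k≤n))))
        (conv--ʳ Dₛ (Dur.X (suc i)) (Dur.X (suc (suc i))) n))

  M1plus-Σ : M1plus n ≡ Σ< B (λ k → sgn k * sh (1 ℕ.* tri (suc k)) (inv (1 ℕ.* suc k) P̄) n)
  M1plus-Σ = trans (foldr-upTo n id (λ i → + suc i * Mbar (+ suc i) n))
    (trans (Σ<-cong′ n (λ i → cong (_*_ (+ suc i)) (Mbar-Z i)))
    -- Abel summation turns the moment into the sum of the tails `Z m`, `m ≥ 1`; its boundary term
    -- contains `Z (suc n) n`, which is zero.
    (trans (abel n (λ i → Z (suc i) n))
    (trans (cong₂ _-_ (sym (Σ<-extend n B (λ i → Z (suc i) n) (ℕP.n≤1+n n) (λ i n≤i → Z-large (suc i) (s≤s n≤i))))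
        (trans (cong (_*_ (+ n)) (Z-large (suc n) ℕP.≤-refl)) (ℤP.*-zeroʳ (+ n))))
    (trans (ℤP.+-identityʳ _) (alternating 0 n P̄ (λ j → Z (suc j)) Z-rec n ℕP.≤-refl)))))

  private
    rank-le : ∀ i ℓ t → ind ((+ ℓ - + t) ℤ.≟ + suc i) ≡ le (t ℕ.+ suc i) ℓ - le (t ℕ.+ suc (suc i)) ℓ
    rank-le i ℓ t with ℕP.<-cmp ℓ (t ℕ.+ suc i)
    ... | tri< h ≢ _ = trans (ind-no ((+ ℓ - + t) ℤ.≟ + suc i) (≢ ∘ to)) (sym (cong₂ _-_ (le-> (t ℕ.+ suc i) ℓ h) (le-> (t ℕ.+ suc (suc i)) ℓ (ℕP.<-trans h (ℕP.+-monoʳ-< t ℕP.≤-refl)))))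
      where
      alg : ∀ a b → a ≡ b + (a - b)
      alg = solve-∀
      to : + ℓ - + t ≡ + suc i → ℓ ≡ t ℕ.+ suc i
      to e = ℤP.+-injective (trans (alg (+ ℓ) (+ t)) (cong (_+_ (+ t)) e))
    ... | tri≈ _ e _ = trans (ind-yes ((+ ℓ - + t) ℤ.≟ + suc i) (trans (cong (λ x → + x - + t) e) (alg (+ t) (+ suc i))))
        (sym (cong₂ _-_ (le-≤ (t ℕ.+ suc i) ℓ (ℕP.≤-reflexive (sym e))) (le-> (t ℕ.+ suc (suc i)) ℓ (ℕP.≤-trans (s≤s (ℕP.≤-reflexive e)) (ℕP.≤-reflexive (sym (ℕP.+-suc t (suc i))))))))
      where
      alg : ∀ a b → a + b - a ≡ b
      alg = solve-∀
    ... | tri> _ ≢ h = trans (ind-no ((+ ℓ - + t) ℤ.≟ + suc i) (≢ ∘ to)) (sym (cong₂ _-_ (le-≤ (t ℕ.+ suc i) ℓ (ℕP.<⇒≤ h)) (le-≤ (t ℕ.+ suc (suc i)) ℓ (ℕP.≤-trans (ℕP.≤-reflexive (ℕP.+-suc t (suc i))) h))))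
      where
      alg : ∀ a b → a ≡ b + (a - b)
      alg = solve-∀
      to : + ℓ - + t ≡ + suc i → ℓ ≡ t ℕ.+ suc i
      to e = ℤP.+-injective (trans (alg (+ ℓ) (+ t)) (cong (_+_ (+ t)) e))

    Nbar-G : ∀ i → + Nbar (+ suc i) n ≡ R.G (suc i) n - R.G (suc (suc i)) n
    Nbar-G i = trans (length-filter (λ p → rank p ℤ.≟ + suc i) (overpartitions n))
      (trans (oE-c n n (λ ℓ t → ind ((+ ℓ - + t) ℤ.≟ + suc i)) n ℕP.≤-refl)
      (trans (Σ<-cong′ B (λ ℓ → trans (Σ<-cong′ B (λ t → trans (cong (λ z → z * c t ℓ n) (rank-le i ℓ t)) (alg (le (t ℕ.+ suc i) ℓ) (le (t ℕ.+ suc (suc i)) ℓ) (c t ℓ n))))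
          (Σ<-- B (λ t → le (t ℕ.+ suc i) ℓ * c t ℓ n) (λ t → le (t ℕ.+ suc (suc i)) ℓ * c t ℓ n))))
        (Σ<-- B (λ ℓ → Σ< B (λ t → le (t ℕ.+ suc i) ℓ * c t ℓ n)) (λ ℓ → Σ< B (λ t → le (t ℕ.+ suc (suc i)) ℓ * c t ℓ n)))))
      where
      alg : ∀ a b x → (a - b) * x ≡ a * x - b * x
      alg = solve-∀

    G-large : ∀ m → n ℕ.< m → R.G m n ≡ + 0
    G-large m n<m = Σ<-0 B (λ ℓ ℓ<B → Σ<-0 B (λ t _ → cong (λ z → z * c t ℓ n) (le-> (t ℕ.+ m) ℓ (ℕP.<-≤-trans (ℕP.<-≤-trans ℓ<B n<m) (ℕP.m≤n+m m t)))))

    -- Pairing the thresholds `2j + 1` and `2j + 2` uses every `G m` with `m ≥ 1` exactly once. As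
    -- `G-rec` raises thresholds by two, it takes pair `j` to pair `j + 1`, with exponents
    -- `2(j + 1)`.
    K : ℕ → Series
    K j i = R.G (suc (j ℕ.+ j)) i + R.G (suc (suc (j ℕ.+ j))) i

    K-rec : ∀ j i → i ℕ.≤ n → K j i ≡ sh (2 ℕ.* suc j) (λ i → + 2 * P̄ i - K (suc j) i) i
    K-rec j i i≤n = trans (R.G-rec (j ℕ.+ j) i i≤n)
      (cong₂ (λ e m → sh e (λ i → + 2 * P̄ i - (R.G (suc m) i + R.G (suc (suc m)) i)) i) (alg j) (alg′ j))
      where
      alg : ∀ j → suc (suc (j ℕ.+ j)) ≡ 2 ℕ.* suc j
      alg = ℕR.solve-∀
      alg′ : ∀ j → suc (suc (j ℕ.+ j)) ≡ suc j ℕ.+ suc j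
      alg′ = ℕR.solve-∀

  N1plus-Σ : N1plus n ≡ Σ< B (λ k → sgn k * sh (2 ℕ.* tri (suc k)) (inv (2 ℕ.* suc k) (λ i → + 2 * P̄ i)) n)
  N1plus-Σ = trans (foldr-upTo n id (λ i → + suc i * + Nbar (+ suc i) n))
    (trans (Σ<-cong′ n (λ i → cong (_*_ (+ suc i)) (Nbar-G i)))
    (trans (abel n (λ i → R.G (suc i) n))
    (trans (cong₂ _-_ (sym (Σ<-extend n (B ℕ.+ B) (λ i → R.G (suc i) n) (ℕP.≤-trans (ℕP.n≤1+n n) (ℕP.m≤m+n B B)) (λ i n≤i → G-large (suc i) (s≤s n≤i))))
        (trans (cong (_*_ (+ n)) (G-large (suc n) ℕP.≤-refl)) (ℤP.*-zeroʳ (+ n))))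
    (trans (ℤP.+-identityʳ _) (trans (Σ<-pairs B (λ i → R.G (suc i) n)) (alternating 1 n (λ i → + 2 * P̄ i) K K-rec n ℕP.≤-refl))))))

  -- The rows of the rank moment carry `2 P̄`, which yields the `2 A(q²)`. `P̄` is replaced by
  -- `overSeries (n + 4)`: it agrees with `P̄` up to degree `n` and has the four factors from which
  -- the comparison with `κ` starts.
  difference : M1plus n ≡ N1plus n + H B (overSeries (n ℕ.+ 4)) n
  difference = trans M1plus-Σ (trans (Σ<-cong′ B split) (trans (Σ<-+ B (λ k → sgn k * lo k) (λ k → sgn k * pairTerm k (overSeries (n ℕ.+ 4)) n))
    (cong (λ z → z + H B (overSeries (n ℕ.+ 4)) n) (sym N1plus-Σ))))
    where
    lo : ℕ → ℤ
    lo k = sh (2 ℕ.* tri (suc k)) (inv (2 ℕ.* suc k) (λ i → + 2 * P̄ i)) n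
    alg : ∀ s a b → s * a ≡ s * (+ 2 * b) + s * (a - + 2 * b)
    alg = solve-∀
    inv-cong≤ : ∀ k {f g : Series} i → (∀ j → j ℕ.≤ i → f j ≡ g j) → inv k f i ≡ inv k g i
    inv-cong≤ k i h = Σ<-cong′ (suc i) (λ j → sh-cong≤ (j ℕ.* k) i h)
    stable : ∀ e k → sh e (inv k P̄) n ≡ sh e (inv k (overSeries (n ℕ.+ 4))) n
    stable e k = sh-cong≤ e n (λ i i≤n → inv-cong≤ k i (λ j j≤i → sym (overSeries-stable≤ (n ℕ.+ 4) j (ℕP.≤-trans (ℕP.≤-trans j≤i i≤n) (ℕP.m≤m+n n 4)))))
    lo≡ : ∀ k → lo k ≡ + 2 * sh (2 ℕ.* tri (suc k)) (inv (suc (double k)) (overSeries (n ℕ.+ 4))) n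
    lo≡ k = trans (sh-cong (2 ℕ.* tri (suc k)) (λ i → trans (Σ<-cong′ (suc i) (λ j → sh-* (j ℕ.* (2 ℕ.* suc k)) (+ 2) P̄ i)) (Σ<-* (suc i) (+ 2) (λ j → sh (j ℕ.* (2 ℕ.* suc k)) P̄ i))) n)
      (trans (sh-* (2 ℕ.* tri (suc k)) (+ 2) (inv (2 ℕ.* suc k) P̄) n) (cong (_*_ (+ 2)) (trans (stable (2 ℕ.* tri (suc k)) (2 ℕ.* suc k))
        (cong (λ m → sh (2 ℕ.* tri (suc k)) (inv m (overSeries (n ℕ.+ 4))) n) (ℕP.*-suc 2 k)))))
    split : ∀ k → sgn k * sh (1 ℕ.* tri (suc k)) (inv (1 ℕ.* suc k) P̄) n ≡ sgn k * lo k + sgn k * pairTerm k (overSeries (n ℕ.+ 4)) n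
    split k = trans (cong (_*_ (sgn k)) (trans (cong₂ (λ e m → sh e (inv m P̄) n) (ℕP.*-identityˡ (tri (suc k))) (ℕP.*-identityˡ (suc k))) (stable (tri (suc k)) (suc k))))
      (trans (alg (sgn k) (sh (tri (suc k)) (inv (suc k) (overSeries (n ℕ.+ 4))) n) (sh (2 ℕ.* tri (suc k)) (inv (suc (double k)) (overSeries (n ℕ.+ 4))) n))
        (cong (λ z → sgn k * z + sgn k * pairTerm k (overSeries (n ℕ.+ 4)) n) (sym (lo≡ k))))

theorem1p1 : (n : ℕ) → 1 ≤ n → N1plus n < M1plus n
theorem1p1 n 1≤n = subst₂ ℤ._<_ (ℤP.+-identityʳ (N1plus n)) (sym (difference n))
  (ℤP.+-monoʳ-< (N1plus n) (HoverSeries>0 (suc n) n n 1≤n ℕP.≤-refl))
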